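{- Let $t=t(n)$. If $t=o(\log n)$, then $$\lim_{n\to\infty}\frac{\log M_{K_{t,t}}(n)}{\binom{n}{2}}=1.$$ If $t=c\log n$ for some constant $c>0$, then $$\lim_{n\to\infty}\frac{\log M_{K_{t,t}}(n)}{\binom{n}{2}}\leq1-2^{ -\frac{2}{c}}.$$
   Context: Logarithms are base 2. $K_{t,t}$ is the complete bipartite graph with both parts of size $t$. For graphs $G,G'$ on the same vertex set $[n]$, their symmetric difference $G\oplus G'$ is the graph on $[n]$ whose edge set consists of all edges belonging to exactly one of $G,G'$. For a graph $L$, $M_{L}(n)$ denotes the maximum possible size of a family $\mathcal{G}$ of graphs on vertex set $[n]$ such that for any two distinct $G,G'\in\mathcal{G}$, $G\oplus G'$ contains $L$ as a subgraph. -}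

module Defs where

open import Data.Bool.Base using (Bool; true; false; T; _xor_)
import Data.Bool.Properties as Bool
open import Data.Fin.Base using (Fin; zero; suc; splitAt; funToFin; finToFun)
import Data.Fin.Properties as Fin
open import Data.Integer.Base using (ℤ; +_; -[1+_])
open import Data.Nat.Base as ℕ using (ℕ; zero; suc)
import Data.Nat.Combinatorics as ℕ
import Data.Nat.Properties as ℕ
open import Data.Product.Base using (∃; ∃₂; _×_; _,_; proj₁; proj₂)
open import Data.Rational.Base as ℚ using (ℚ; 0ℚ; ½; ↥_; ↧ₙ_)
open import Data.Sum.Base using (_⊎_; inj₁; inj₂; [_,_])
open import Function.Base using (_∘_; const)
open import Function.Bundles using (_⇔_)
open import Function.Definitions using (Injective)
open import Relation.Binary.PropositionalEquality
  using (_≡_; _≢_; refl; sym; trans; cong; cong₂; subst)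
open import Relation.Nullary using (¬_; Dec; yes; no)
open import Relation.Nullary.Decidable using (map′; _×-dec_; _→-dec_; ¬?)
open import Relation.Unary using (Decidable)

open import Algebra.Definitions.RawSemiring ℚ.+-*-rawSemiring using (_^_)

infix  4 _<_ _≤_ _≺2^_ 2^_≺_ _=o_ _RoundingOf_ _≈_ _Contains_
infixl 6 _+_ _-_ _⊕_
infixl 7 _*_ _÷_
infix  8 -_
infix  9 2^_

------------------------------------------------------------------------
-- Real numbers as Dedekind cuts
--
-- A real number is a cut of ℚ satisfying IsDedekind.  The arithmetic is
-- defined by the usual formulas on the underlying cuts.

record Cut : Set₁ where
  field
    Lower Upper : ℚ → Set      -- Lower q: "q < x";  Upper q: "x < q"

open Cut public

record IsDedekind (x : Cut) : Set where
  field
    inhabitedˡ : ∃ (Lower x)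
    inhabitedᵘ : ∃ (Upper x)
    roundedˡ   : ∀ q → Lower x q ⇔ (∃ λ r → q ℚ.< r × Lower x r)
    roundedᵘ   : ∀ q → Upper x q ⇔ (∃ λ r → r ℚ.< q × Upper x r)
    disjoint   : ∀ q → ¬ (Lower x q × Upper x q)
    located    : ∀ q r → q ℚ.< r → Lower x q ⊎ Upper x r

record ℝ : Set₁ where
  field
    cut        : Cut
    isDedekind : IsDedekind cut

open ℝ public

_<_ : Cut → Cut → Set
x < y = ∃ λ q → Upper x q × Lower y q

_≤_ : Cut → Cut → Set
x ≤ y = ∀ q → Lower x q → Lower y q

fromℚ : ℚ → Cut
fromℚ p = record { Lower = λ q → q ℚ.< p ; Upper = λ q → p ℚ.< q }

ℕ→ℚ : ℕ → ℚ
ℕ→ℚ n = + n ℚ./ 1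

fromℕ : ℕ → Cut
fromℕ n = fromℚ (ℕ→ℚ n)

_+_ : Cut → Cut → Cut
x + y = record
  { Lower = λ q → ∃₂ λ r s → Lower x r × Lower y s × q ≡ r ℚ.+ s
  ; Upper = λ q → ∃₂ λ r s → Upper x r × Upper y s × q ≡ r ℚ.+ s
  }

-_ : Cut → Cut
- x = record { Lower = λ q → Upper x (ℚ.- q) ; Upper = λ q → Lower x (ℚ.- q) }

_-_ : Cut → Cut → Cut
x - y = x + (- y)

-- The product of the intervals (a , b) ∋ x and (c , d) ∋ y is bounded by
-- the least and the greatest of ac, ad, bc, bd, whatever the signs.
_*_ : Cut → Cut → Cut
x * y = record
  { Lower = λ q → ∃₂ λ a b → ∃₂ λ c d →
      Lower x a × Upper x b × Lower y c × Upper y d ×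
      q ℚ.< a ℚ.* c × q ℚ.< a ℚ.* d × q ℚ.< b ℚ.* c × q ℚ.< b ℚ.* d
  ; Upper = λ q → ∃₂ λ a b → ∃₂ λ c d →
      Lower x a × Upper x b × Lower y c × Upper y d ×
      a ℚ.* c ℚ.< q × a ℚ.* d ℚ.< q × b ℚ.* c ℚ.< q × b ℚ.* d ℚ.< q
  }

-- Only meaningful for y > 0, where q < x / y iff q y < x.
_÷_ : Cut → Cut → Cut
x ÷ y = record
  { Lower = λ q → fromℚ q * y < x
  ; Upper = λ q → x < fromℚ q * y
  }

2^ℤ : ℤ → ℚ
2^ℤ (+ n)    = ℕ→ℚ 2 ^ n
2^ℤ -[1+ n ] = ½ ^ suc n

-- Comparison of r with 2^(a/b), for p = a/b and b > 0, by comparing r^b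
-- with 2^a when r ≥ 0.
_≺2^_ : ℚ → ℚ → Set
r ≺2^ p = r ℚ.< 0ℚ ⊎ r ^ ↧ₙ p ℚ.< 2^ℤ (↥ p)

2^_≺_ : ℚ → ℚ → Set
2^ p ≺ r = 0ℚ ℚ.< r × 2^ℤ (↥ p) ℚ.< r ^ ↧ₙ p

2^_ : Cut → Cut
2^ x = record
  { Lower = λ q → ∃ λ p → Lower x p × q ≺2^ p
  ; Upper = λ q → ∃ λ p → Upper x p × 2^ p ≺ q
  }

-- The binary logarithm; only meaningful for m > 0.
log : ℕ → Cut
log m = record
  { Lower = λ q → 2^ q ≺ ℕ→ℚ m
  ; Upper = λ q → ℕ→ℚ m ≺2^ q
  }

------------------------------------------------------------------------
-- Asymptotics

Eventually : (ℕ → Set) → Set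
Eventually P = ∃ λ N → ∀ n → N ℕ.≤ n → P n

Lim_equals_ : (ℕ → Cut) → Cut → Set
Lim x equals y = ∀ ε → 0ℚ ℚ.< ε →
  Eventually λ n → (y - fromℚ ε < x n) × (x n < y + fromℚ ε)

LimSup_≤_ : (ℕ → Cut) → Cut → Set
LimSup x ≤ y = ∀ ε → 0ℚ ℚ.< ε → Eventually λ n → x n < y + fromℚ ε

-- f = o(g), for eventually non-negative f and g.
_=o_ : (ℕ → Cut) → (ℕ → Cut) → Set
f =o g = ∀ ε → 0ℚ ℚ.< ε → Eventually λ n → f n ≤ fromℚ ε * g n

-- |k - x| < 1, that is, k is the floor or the ceiling of x.
_RoundingOf_ : ℕ → Cut → Set
k RoundingOf x = (fromℕ k - fromℕ 1 < x) × (x < fromℕ k + fromℕ 1)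

------------------------------------------------------------------------
-- Graphs

record Graph (n : ℕ) : Set where
  field
    adj         : Fin n → Fin n → Bool
    symmetric   : ∀ i j → adj i j ≡ adj j i
    irreflexive : ∀ i → adj i i ≡ false

open Graph public

_≈_ : ∀ {n} → Graph n → Graph n → Set
G ≈ G′ = ∀ i j → adj G i j ≡ adj G′ i j

_⊕_ : ∀ {n} → Graph n → Graph n → Graph n
G ⊕ G′ = record
  { adj         = λ i j → adj G i j xor adj G′ i j
  ; symmetric   = λ i j → cong₂ _xor_ (symmetric G i j) (symmetric G′ i j)
  ; irreflexive = λ i → cong₂ _xor_ (irreflexive G i) (irreflexive G′ i)
  }

-- G contains a (not necessarily induced) copy of L.
_Contains_ : ∀ {n k} → Graph n → Graph k → Set
_Contains_ {n} {k} G L = ∃ λ (f : Fin k → Fin n) →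
  Injective _≡_ _≡_ f × (∀ i j → T (adj L i j) → T (adj G (f i) (f j)))

K : (s t : ℕ) → Graph (s ℕ.+ t)
K s t = record
  { adj         = λ i j → inFirstPart i xor inFirstPart j
  ; symmetric   = λ i j → Bool.xor-comm (inFirstPart i) (inFirstPart j)
  ; irreflexive = λ i → Bool.xor-same (inFirstPart i)
  }
  where
  inFirstPart : Fin (s ℕ.+ t) → Bool
  inFirstPart i = [ const true , const false ] (splitAt s i)

-- A family of m graphs, indexed without repetition by Fin m.
record IsCode {k n m} (L : Graph k) (𝒢 : Fin m → Graph n) : Set where
  field
    distinct : ∀ i j → i ≢ j → ¬ (𝒢 i ≈ 𝒢 j)
    differ   : ∀ i j → i ≢ j → (𝒢 i ⊕ 𝒢 j) Contains L

HasCode : ∀ {k} → Graph k → ℕ → ℕ → Set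
HasCode L n m = ∃ λ (𝒢 : Fin m → Graph n) → IsCode L 𝒢

IsMaximum : (ℕ → Set) → ℕ → Set
IsMaximum P m = P m × (∀ k → P k → k ℕ.≤ m)

------------------------------------------------------------------------
-- Existence of the maximum size of a code

private

  Searchable : (A : Set) → (A → A → Set) → Set₁
  Searchable A _∼_ = (P : A → Set) → (∀ {x y} → x ∼ y → P x → P y) →
                     Decidable P → Dec (∃ P)

  search-Fin : ∀ {n} → Searchable (Fin n) _≡_
  search-Fin P _ P? = Fin.any? P?

  search-Bool : Searchable Bool _≡_
  search-Bool P _ P? with P? true | P? false
  ... | yes p | _     = yes (true , p)
  ... | no _  | yes q = yes (false , q)
  ... | no ¬p | no ¬q = no λ { (true , p) → ¬p p ; (false , q) → ¬q q }

  search-→ : ∀ {A : Set} {_∼_ : A → A → Set} → (∀ {x} → x ∼ x) →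
             Searchable A _∼_ → ∀ m →
             Searchable (Fin m → A) (λ f g → ∀ i → f i ∼ g i)
  search-→ {A} ∼-refl search zero P resp P? =
    map′ (none ,_) (λ (_ , p) → resp (λ ()) p) (P? none)
    where
    none : Fin 0 → A
    none ()
  search-→ {A} {_∼_} ∼-refl search (suc m) P resp P? =
    map′ (λ (a , f , p) → cons a f , p)
         (λ (f , p) → f zero , f ∘ suc , resp (λ { zero → ∼-refl ; (suc _) → ∼-refl }) p)
         (search (λ a → ∃ λ f → P (cons a f))
           (λ a∼b (f , p) → f , resp (λ { zero → a∼b ; (suc _) → ∼-refl }) p)
           (λ a → search-→ ∼-refl search m (λ f → P (cons a f))
             (λ f∼g → resp λ { zero → ∼-refl ; (suc i) → f∼g i })
             (λ f → P? (cons a f))))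
    where
    cons : A → (Fin m → A) → Fin (suc m) → A
    cons a f zero    = a
    cons a f (suc i) = f i

  contains? : ∀ {n k} (G : Graph n) (L : Graph k) → Dec (G Contains L)
  contains? {n} {k} G L =
    map′ (λ (f , inj , h) → f , (λ {i} {j} → inj i j) , h)
         (λ (f , inj , h) → f , (λ i j → inj) , h)
         (search-→ refl search-Fin k _
           (λ f≗g (inj , h) →
               (λ i j e → inj i j (trans (f≗g i) (trans e (sym (f≗g j)))))
             , (λ i j l → subst T (cong₂ (adj G) (f≗g i) (f≗g j)) (h i j l)))
           (λ f → Fin.all? (λ i → Fin.all? λ j → (f i Fin.≟ f j) →-dec (i Fin.≟ j))
             ×-dec Fin.all? (λ i → Fin.all? λ j →
                     Bool.T? (adj L i j) →-dec Bool.T? (adj G (f i) (f j)))))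

  contains-resp : ∀ {n k} {G H : Graph n} {L : Graph k} →
                  G ≈ H → G Contains L → H Contains L
  contains-resp G≈H (f , inj , h) =
    f , inj , λ i j l → subst T (G≈H (f i) (f j)) (h i j l)

  isCode-resp : ∀ {k n m} {L : Graph k} {𝒢 ℋ : Fin m → Graph n} →
                (∀ i → 𝒢 i ≈ ℋ i) → IsCode L 𝒢 → IsCode L ℋ
  isCode-resp {L = L} {𝒢} {ℋ} 𝒢≈ℋ c = record
    { distinct = λ i j i≢j e → distinct i j i≢j λ u v →
        trans (𝒢≈ℋ i u v) (trans (e u v) (sym (𝒢≈ℋ j u v)))
    ; differ   = λ i j i≢j → contains-resp {G = 𝒢 i ⊕ 𝒢 j} {ℋ i ⊕ ℋ j} {L}
        (λ u v → cong₂ _xor_ (𝒢≈ℋ i u v) (𝒢≈ℋ j u v)) (differ i j i≢j)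
    } where open IsCode c

  isCode? : ∀ {k n m} (L : Graph k) (𝒢 : Fin m → Graph n) → Dec (IsCode L 𝒢)
  isCode? L 𝒢 =
    map′ (λ (p , q) → record { distinct = p ; differ = q })
         (λ c → IsCode.distinct c , IsCode.differ c)
         (Fin.all? (λ i → Fin.all? λ j → ¬? (i Fin.≟ j) →-dec
             ¬? (Fin.all? λ u → Fin.all? λ v → adj (𝒢 i) u v Bool.≟ adj (𝒢 j) u v))
           ×-dec
          Fin.all? (λ i → Fin.all? λ j → ¬? (i Fin.≟ j) →-dec
             contains? (𝒢 i ⊕ 𝒢 j) L))

  Adj : ℕ → Set
  Adj n = Fin n → Fin n → Bool

  IsGraph : ∀ {n} → Adj n → Set
  IsGraph a = (∀ i j → a i j ≡ a j i) × (∀ i → a i i ≡ false)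

  isGraph? : ∀ {n} (a : Adj n) → Dec (IsGraph a)
  isGraph? a = Fin.all? (λ i → Fin.all? λ j → a i j Bool.≟ a j i)
         ×-dec Fin.all? (λ i → a i i Bool.≟ false)

  graph : ∀ {n} (a : Adj n) → IsGraph a → Graph n
  graph a (s , r) = record { adj = a ; symmetric = s ; irreflexive = r }

  search-Graph : ∀ n → Searchable (Graph n) _≈_
  search-Graph n P resp P? =
    map′ (λ (a , g , p) → graph a g , p)
         (λ (G , p) → adj G , (symmetric G , irreflexive G) , p)
         (search-→ (λ _ → refl) (search-→ refl search-Bool n) n
           (λ a → ∃ λ g → P (graph a g))
           (λ {a} {b} e (g , p) →
             let s , r = g
                 g′ = (λ i j → trans (sym (e i j)) (trans (s i j) (e j i)))
                    , (λ i → trans (sym (e i i)) (r i))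
             in g′ , resp e p)
           P∘graph?)
    where
    P∘graph? : Decidable (λ a → ∃ λ g → P (graph a g))
    P∘graph? a with isGraph? a
    ... | no ¬g = no λ (g , _) → ¬g g
    ... | yes g = map′ (g ,_) (λ (g′ , p) → resp (λ _ _ → refl) p) (P? (graph a g))

  hasCode? : ∀ {k} (L : Graph k) n → Decidable (HasCode L n)
  hasCode? L n m =
    search-→ (λ _ _ → refl) (search-Graph n) m (IsCode L) isCode-resp (isCode? L)

  bit : Bool → Fin 2
  bit false = zero
  bit true  = suc zero

  bit-injective : ∀ {a b} → bit a ≡ bit b → a ≡ b
  bit-injective {false} {false} _ = refl
  bit-injective {true}  {true}  _ = refl

  funToFin-injective : ∀ {m n} {f g : Fin m → Fin n} →
                       funToFin f ≡ funToFin g → ∀ i → f i ≡ g i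
  funToFin-injective {f = f} {g} e i =
    trans (sym (Fin.finToFun-funToFin f i))
      (trans (cong (λ c → finToFun c i) e) (Fin.finToFun-funToFin g i))

  encode : ∀ {n} → Graph n → Fin ((2 ℕ.^ n) ℕ.^ n)
  encode G = funToFin λ i → funToFin λ j → bit (adj G i j)

  encode-injective : ∀ {n} {G H : Graph n} → encode G ≡ encode H → G ≈ H
  encode-injective e i j =
    bit-injective (funToFin-injective (funToFin-injective e i) j)

  code-bounded : ∀ {k} (L : Graph k) n m → HasCode L n m → m ℕ.≤ (2 ℕ.^ n) ℕ.^ n
  code-bounded L n m (𝒢 , c) = ℕ.≮⇒≥ λ b<m →
    let i , j , i<j , e = Fin.pigeonhole b<m (encode ∘ 𝒢)
    in IsCode.distinct c i j (Fin.<⇒≢ i<j) (encode-injective {G = 𝒢 i} {H = 𝒢 j} e)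

  maximum : ∀ {P : ℕ → Set} → Decidable P → P 0 →
            ∀ b → (∀ k → P k → k ℕ.≤ b) → ∃ (IsMaximum P)
  maximum P? p₀ zero    bound = 0 , p₀ , bound
  maximum P? p₀ (suc b) bound with P? (suc b)
  ... | yes p = suc b , p , bound
  ... | no ¬p = maximum P? p₀ b λ k p →
    ℕ.≤-pred (ℕ.≤∧≢⇒< (bound k p) λ { refl → ¬p p })

abstract
  maxCode : ∀ {k} (L : Graph k) n → ∃ (IsMaximum (HasCode L n))
  maxCode L n = maximum (hasCode? L n)
    ((λ ()) , record { distinct = λ () ; differ = λ () })
    ((2 ℕ.^ n) ℕ.^ n) (code-bounded L n)

M : ∀ {k} → Graph k → ℕ → ℕ
M L n = proj₁ (maxCode L n)

M-isMaximum : ∀ {k} (L : Graph k) n → IsMaximum (HasCode L n) (M L n)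
M-isMaximum L n = proj₂ (maxCode L n)

-- Only meaningful for n ≥ 2, where the denominator is positive.
rate : ∀ {k} → Graph k → ℕ → Cut
rate L n = log (M L n) ÷ fromℕ (n ℕ.C 2)

{-# OPTIONS --safe #-}

-- Lower bound.  In a maximal code every graph differs from some member by a
-- graph H without K (t + 1) (t + 1), so 2^(n C 2) is at most M times the number
-- of such H.  Cut the columns of the adjacency matrix of H into blocks of s
-- columns.  In each block a row with more than t ones can be repeated at most t
-- times, so at most t 2^s rows are not light; and for t = o(s) there are only
-- 2^o(s) light words.  With s a small multiple of log n this leaves 2^o(n^2)
-- graphs H.
--
-- Upper bound.  Two members of a code cannot differ inside a K t t-free graph F,
-- so M 2^e(F) ≤ 2^(n C 2).  A random graph of edge density p contains
-- n^(2t) p^(t^2) → 0 copies of K t t in expectation when p < 2^(-2/c), which gives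
-- an F with about p (n C 2) edges.
module Submission where

-- The lower bound excludes `K (suc t) (suc t)` rather than `K t t` because the larger graph has an
-- edge even at `t` = 0. A graph whose differences from all members contain it is therefore new to
-- the code. The block width is squeezed from both sides: `s` must be large against `t` for light
-- words to be few, and `2 ^ s * t` small against n for heavy rows to be negligible. Taking 2^(4s)
-- at most n meets both demands when `t` = o(log n).
--
-- In the upper bound, 2/c is known only through a cut and `t` only up to an error below 1. With g/h
-- < 2/c < (g+4)/h, the density a/b is chosen so that a^h 2^(g+4) < b^h. This is a strict inequality
-- of naturals, so the two sides have ratio at most k/(k+1) for a fixed k. In the h-th power of the
-- expected number of copies that ratio appears t^2 times, while rounding `t` costs only a factor
-- exponential in t. The uncertainty 4/h moves the density by a factor 2^(4/h), which 1 + 1/m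
-- outweighs once h is at least 5m.
--
-- Counting is done in ℕ with denominators cleared and roots replaced by powers; cuts enter only
-- when the rates are compared.

-- Finite counting: words, light words, vectors with few exceptional entries

module Counting where

  open import Data.Bool.Base using (Bool; true; false)
  open import Data.Fin.Base using (Fin; zero; suc; remQuot; combine)
  import Data.Fin.Properties as Fin
  open import Data.Fin.Subset using (Subset; ∣_∣)
  open import Data.List.Base using (List; []; _∷_; _++_; length; map; cartesianProductWith)
  open import Data.List.Properties using (length-++; length-map)
  open import Data.List.Membership.Propositional using (_∈_)
  open import Data.List.Membership.Propositional.Properties
    using (∈-cartesianProductWith⁺; ∈-map⁺; ∈-++⁺ˡ; ∈-++⁺ʳ)
  open import Data.List.Relation.Unary.Any using (here; there; index)
  open import Data.List.Relation.Unary.Any.Properties using (lookup-index)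
  import Data.List.Base as List
  open import Data.Nat.Base
  open import Data.Nat.Properties
  open import Data.Nat.Tactic.RingSolver using (solve-∀)
  open import Data.Product.Base using (∃; _×_; _,_; proj₁; proj₂)
  open import Data.Vec.Base as Vec using (Vec; []; _∷_; lookup; count)
  open import Data.Vec.Properties using (∷-injective)
  open import Function.Base using (_∘_)
  open import Function.Definitions using (Injective)
  open import Relation.Binary.Definitions using (DecidableEquality)
  open import Relation.Binary.PropositionalEquality
  open import Relation.Nullary using (¬_; yes; no; contradiction)
  open import Relation.Nullary.Decidable using (_×-dec_; ¬?)
  open import Relation.Unary using (Decidable)

  private variable
    A B C : Set
    m n s t h : ℕ

  injective⇒≤-length : {g : Fin m → A} {xs : List A} → Injective _≡_ _≡_ g →
                       (∀ i → g i ∈ xs) → m ≤ length xs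
  injective⇒≤-length {g = g} {xs} inj g∈xs = Fin.injective⇒≤ λ {i} {j} e → inj (begin
    g i                              ≡⟨ lookup-index (g∈xs i) ⟩
    List.lookup xs (index (g∈xs i))  ≡⟨ cong (List.lookup xs) e ⟩
    List.lookup xs (index (g∈xs j))  ≡⟨ lookup-index (g∈xs j) ⟨
    g j                              ∎)
    where open ≡-Reasoning

  length-cartesianProductWith : (f : A → B → C) (xs : List A) (ys : List B) →
    length (cartesianProductWith f xs ys) ≡ length xs * length ys
  length-cartesianProductWith f []       ys = refl
  length-cartesianProductWith f (x ∷ xs) ys = trans (length-++ (map (f x) ys))
    (cong₂ _+_ (length-map (f x) ys) (length-cartesianProductWith f xs ys))

  vecs : List A → ∀ n → List (Vec A n)
  vecs xs zero    = [] ∷ []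
  vecs xs (suc n) = cartesianProductWith _∷_ xs (vecs xs n)

  length-vecs : (xs : List A) → ∀ n → length (vecs xs n) ≡ length xs ^ n
  length-vecs xs zero    = refl
  length-vecs xs (suc n) = trans (length-cartesianProductWith _∷_ xs (vecs xs n))
    (cong (length xs *_) (length-vecs xs n))

  ∈-vecs : {xs : List A} (v : Vec A n) → (∀ i → lookup v i ∈ xs) → v ∈ vecs xs n
  ∈-vecs []      _    = here refl
  ∈-vecs (x ∷ v) v∈xs = ∈-cartesianProductWith⁺ _∷_ (v∈xs zero) (∈-vecs v (v∈xs ∘ suc))

  words : ∀ s → List (Subset s)
  words = vecs (false ∷ true ∷ [])

  ∈-words : (v : Subset s) → v ∈ words s
  ∈-words v = ∈-vecs v (∈-bools ∘ lookup v)
    where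
    ∈-bools : ∀ b → b ∈ false ∷ true ∷ []
    ∈-bools false = here refl
    ∈-bools true  = there (here refl)

  length-words : ∀ s → length (words s) ≡ 2 ^ s
  length-words = length-vecs _

  toBool : Fin 2 → Bool
  toBool zero    = false
  toBool (suc _) = true

  toBool-injective : Injective _≡_ _≡_ toBool
  toBool-injective {zero}     {zero}     _ = refl
  toBool-injective {suc zero} {suc zero} _ = refl

  word : ∀ s → Fin (2 ^ s) → Subset s
  word zero    _ = []
  word (suc s) i = toBool (proj₁ (remQuot {2} (2 ^ s) i)) ∷ word s (proj₂ (remQuot {2} (2 ^ s) i))

  word-injective : ∀ s → Injective _≡_ _≡_ (word s)
  word-injective zero    {zero} {zero} _ = refl
  word-injective (suc s) {i}    {j}    e =
    trans (sym (Fin.combine-remQuot {2} (2 ^ s) i))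
      (trans (cong₂ combine (toBool-injective (proj₁ (∷-injective e)))
                            (word-injective s (proj₂ (∷-injective e))))
             (Fin.combine-remQuot {2} (2 ^ s) j))

  -- The words with at most `t` ones. The recursion is Pascal's rule, so the length is the sum of
  -- the binomial coefficients of `s` over 0, ..., `t`.
  light : (t s : ℕ) → List (Subset s)
  light t       zero    = [] ∷ []
  light zero    (suc s) = map (false ∷_) (light zero s)
  light (suc t) (suc s) = map (true ∷_) (light t s) ++ map (false ∷_) (light (suc t) s)

  ∈-light : ∀ t (v : Subset s) → ∣ v ∣ ≤ t → v ∈ light t s
  ∈-light t       []          _       = here refl
  ∈-light zero    (false ∷ v) p       = ∈-map⁺ (false ∷_) (∈-light zero v p)
  ∈-light (suc t) (false ∷ v) p       =
    ∈-++⁺ʳ (map (true ∷_) (light t _)) (∈-map⁺ (false ∷_) (∈-light (suc t) v p))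
  ∈-light (suc t) (true ∷ v)  (s≤s p) = ∈-++⁺ˡ (∈-map⁺ (true ∷_) (∈-light t v p))

  -- The Chernoff bound (1 + x)^s / x^t for x = 1/k, in integral form.
  length-light : ∀ k .{{_ : NonZero k}} t s →
                 length (light t s) * k ^ s ≤ k ^ t * suc k ^ s
  length-light k t zero = begin
    1 * 1          ≤⟨ *-monoˡ-≤ 1 (m^n>0 k t) ⟩
    k ^ t * 1      ∎
    where open ≤-Reasoning
  length-light k zero (suc s) = begin
    length (light zero (suc s)) * (k * k ^ s)  ≡⟨ cong (_* (k * k ^ s)) (length-map _ (light zero s)) ⟩
    length (light zero s) * (k * k ^ s)        ≡⟨ swap (length (light zero s)) k (k ^ s) ⟩
    k * (length (light zero s) * k ^ s)        ≤⟨ *-mono-≤ (n≤1+n k) (length-light k zero s) ⟩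
    suc k * (1 * suc k ^ s)                    ≡⟨ swap₂ (suc k) (suc k ^ s) ⟩
    1 * (suc k * suc k ^ s)                    ∎
    where
    open ≤-Reasoning
    swap : ∀ a b c → a * (b * c) ≡ b * (a * c)
    swap = solve-∀
    swap₂ : ∀ b c → b * (1 * c) ≡ 1 * (b * c)
    swap₂ = solve-∀
  length-light k (suc t) (suc s) = begin
    length (light (suc t) (suc s)) * (k * k ^ s)
      ≡⟨ cong (_* (k * k ^ s)) (trans (length-++ (map (true ∷_) (light t s)))
           (cong₂ _+_ (length-map _ (light t s)) (length-map _ (light (suc t) s)))) ⟩
    (l₁ + l₂) * (k * k ^ s)                    ≡⟨ expand l₁ l₂ k (k ^ s) ⟩
    k * (l₁ * k ^ s) + k * (l₂ * k ^ s)
      ≤⟨ +-mono-≤ (*-monoʳ-≤ k (length-light k t s)) (*-monoʳ-≤ k (length-light k (suc t) s)) ⟩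
    k * (k ^ t * suc k ^ s) + k * (k * k ^ t * suc k ^ s)
      ≡⟨ collect k (k ^ t) (suc k ^ s) ⟩
    k * k ^ t * (suc k * suc k ^ s)            ∎
    where
    open ≤-Reasoning
    l₁ = length (light t s)
    l₂ = length (light (suc t) s)
    expand : ∀ a b c d → (a + b) * (c * d) ≡ c * (a * d) + c * (b * d)
    expand = solve-∀
    collect : ∀ a b c → a * (b * c) + a * (a * b * c) ≡ a * b * (suc a * c)
    collect = solve-∀

  -- All entries come from `ls` except at most `h`, which may be arbitrary members of `as`.
  -- Repetitions in the list are harmless, since only an upper bound on its length matters.
  sparse : (ls as : List A) (n h : ℕ) → List (Vec A n)
  sparse ls as zero    h       = [] ∷ []
  sparse ls as (suc n) zero    = cartesianProductWith _∷_ ls (sparse ls as n zero)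
  sparse ls as (suc n) (suc h) = cartesianProductWith _∷_ ls (sparse ls as n (suc h)) ++
                                 cartesianProductWith _∷_ as (sparse ls as n h)

  -- The factor `suc (length ls)` counts one extra symbol marking an exceptional position; the
  -- factor `length as ^ h` then fills in the marked positions.
  length-sparse : (ls as : List A) .{{_ : NonZero (length as)}} → ∀ n h →
                  length (sparse ls as n h) ≤ suc (length ls) ^ n * length as ^ h
  length-sparse ls as zero h = begin
    1                    ≤⟨ m^n>0 (length as) h ⟩
    length as ^ h        ≡⟨ +-identityʳ _ ⟨
    1 * length as ^ h    ∎
    where open ≤-Reasoning
  length-sparse ls as (suc n) zero = begin
    length (sparse ls as (suc n) zero)           ≡⟨ length-cartesianProductWith _∷_ ls (sparse ls as n zero) ⟩
    length ls * length (sparse ls as n zero)     ≤⟨ *-mono-≤ (n≤1+n (length ls)) (length-sparse ls as n zero) ⟩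
    suc (length ls) * (suc (length ls) ^ n * 1)  ≡⟨ *-assoc (suc (length ls)) (suc (length ls) ^ n) 1 ⟨
    suc (length ls) ^ suc n * 1                  ∎
    where open ≤-Reasoning
  length-sparse ls as (suc n) (suc h) = begin
    length (sparse ls as (suc n) (suc h))
      ≡⟨ trans (length-++ (cartesianProductWith _∷_ ls (sparse ls as n (suc h))))
           (cong₂ _+_ (length-cartesianProductWith _∷_ ls (sparse ls as n (suc h)))
                      (length-cartesianProductWith _∷_ as (sparse ls as n h))) ⟩
    L * length (sparse ls as n (suc h)) + N * length (sparse ls as n h)
      ≤⟨ +-mono-≤ (*-monoʳ-≤ L (length-sparse ls as n (suc h)))
                  (*-monoʳ-≤ N (length-sparse ls as n h)) ⟩
    L * (suc L ^ n * (N * N ^ h)) + N * (suc L ^ n * N ^ h)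
      ≡⟨ collect L (suc L ^ n) N (N ^ h) ⟩
    suc L * suc L ^ n * (N * N ^ h)  ∎
    where
    open ≤-Reasoning
    L = length ls
    N = length as
    collect : ∀ a b c d → a * (b * (c * d)) + c * (b * d) ≡ suc a * b * (c * d)
    collect = solve-∀

  ∈-sparse : {P : A → Set} (P? : Decidable P) {ls as : List A} →
             (∀ a → ¬ P a → a ∈ ls) → (∀ a → a ∈ as) →
             (w : Vec A n) → count P? w ≤ h → w ∈ sparse ls as n h
  ∈-sparse P? ∈ls ∈as [] _ = here refl
  ∈-sparse {h = zero} P? ∈ls ∈as (x ∷ w) p with P? x
  ... | no ¬px = ∈-cartesianProductWith⁺ _∷_ (∈ls x ¬px) (∈-sparse P? ∈ls ∈as w p)
  ∈-sparse {h = suc h} P? {ls} {as} ∈ls ∈as (x ∷ w) p with P? x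
  ... | no ¬px = ∈-++⁺ˡ (∈-cartesianProductWith⁺ _∷_ (∈ls x ¬px) (∈-sparse P? ∈ls ∈as w p))
  ... | yes _  = ∈-++⁺ʳ (cartesianProductWith _∷_ ls (sparse ls as _ (suc h)))
                   (∈-cartesianProductWith⁺ _∷_ (∈as x) (∈-sparse P? ∈ls ∈as w (s≤s⁻¹ p)))

  module _ (_≟_ : DecidableEquality A) where

    count-split : {P : A → Set} (P? : Decidable P) (a : A) (w : Vec A n) →
      count P? w ≤ count (a ≟_) w + count (λ x → P? x ×-dec ¬? (a ≟ x)) w
    count-split P? a [] = z≤n
    count-split P? a (x ∷ w) with P? x | a ≟ x
    ... | no _  | no _  = count-split P? a w
    ... | no _  | yes _ = m≤n⇒m≤1+n (count-split P? a w)
    ... | yes _ | yes _ = s≤s (count-split P? a w)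
    ... | yes _ | no _  = ≤-trans (s≤s (count-split P? a w)) (≤-reflexive (sym (+-suc _ _)))

    count-none : {P : A → Set} (P? : Decidable P) → (∀ a → ¬ P a) → (w : Vec A n) → count P? w ≡ 0
    count-none P? none []      = refl
    count-none P? none (x ∷ w) with P? x
    ... | no _   = count-none P? none w
    ... | yes px = contradiction px (none x)

    -- Induction on `as`: the occurrences of the head letter are counted separately, and that letter
    -- is then removed from `P`, so the tail still covers what remains.
    count-bounded : {P : A → Set} (P? : Decidable P) (as : List A) (w : Vec A n) →
      (∀ a → P a → a ∈ as) → (∀ a → P a → count (a ≟_) w ≤ t) → count P? w ≤ length as * t
    count-bounded P? [] w ∈as bound = ≤-reflexive (count-none P? (λ a pa → none (∈as a pa)) w)
      where
      none : ∀ {a : A} → ¬ a ∈ []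
      none ()
    count-bounded P? (a ∷ as) w ∈as bound with P? a
    ... | yes pa = ≤-trans (count-split P? a w) (+-mono-≤ (bound a pa)
          (count-bounded (λ x → P? x ×-dec ¬? (a ≟ x)) as w
            (λ x (px , a≢x) → tail a≢x (∈as x px)) (λ x (px , _) → bound x px)))
      where
      tail : ∀ {x} → a ≢ x → x ∈ a ∷ as → x ∈ as
      tail a≢x (here x≡a) = contradiction (sym x≡a) a≢x
      tail _   (there p)  = p
    ... | no ¬pa = ≤-trans (count-bounded P? as w (λ x px → tail px (∈as x px)) bound) (m≤n+m _ _)
      where
      tail : ∀ {x} → _ → x ∈ a ∷ as → x ∈ as
      tail px (here refl) = contradiction px ¬pa
      tail _  (there p)   = p

  pick : {P : A → Set} (P? : Decidable P) (w : Vec A n) → t ≤ count P? w →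
         ∃ λ (f : Fin t → Fin n) → Injective _≡_ _≡_ f × (∀ i → P (lookup w (f i)))
  pick {t = zero}  P? w  _ = (λ ()) , (λ { {()} }) , λ ()
  pick {t = suc t} P? (x ∷ w) p with P? x
  ... | no _ = let f , inj , h = pick P? w p in suc ∘ f , inj ∘ Fin.suc-injective , h
  pick {A = A} {n = suc n} {t = suc t} {P = P} P? (x ∷ w) (s≤s p) | yes px = f′ , inj′ , h′
    where
    rec = pick P? w p
    f′ : Fin (suc t) → Fin (suc n)
    f′ zero    = zero
    f′ (suc i) = suc (proj₁ rec i)
    inj′ : Injective _≡_ _≡_ f′
    inj′ {zero}  {zero}  _ = refl
    inj′ {suc i} {suc j} e = cong suc (proj₁ (proj₂ rec) (Fin.suc-injective e))
    h′ : ∀ i → P (lookup (x ∷ w) (f′ i))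
    h′ zero    = px
    h′ (suc i) = proj₂ (proj₂ rec) i

-- Graphs as bit vectors indexed by vertex pairs; copies of complete bipartite graphs

module GraphCoding where

  open import Data.Bool.Base using (true; false; T)
  open import Data.Fin.Base using (Fin; zero; suc; _↑ˡ_; _↑ʳ_; splitAt)
  import Data.Fin.Properties as Fin
  open import Data.Fin.Subset using (Subset)
  open import Data.Maybe.Base as Maybe using (Maybe; just; nothing; maybe)

  open import Data.Nat.Base
  open import Data.Nat.Combinatorics using (_C_; nC1≡n; nCk+nC[k+1]≡[n+1]C[k+1])
  open import Data.Product.Base using (∃; _×_; _,_; proj₁; proj₂; uncurry)
  open import Data.Sum.Base using (_⊎_; inj₁; inj₂; [_,_]′)
  open import Data.Vec.Base using (lookup; tabulate)
  open import Data.Vec.Properties using (lookup∘tabulate; tabulate∘lookup; tabulate-cong)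
  open import Function.Base using (_∘_)
  open import Function.Definitions using (Injective)
  open import Relation.Binary.PropositionalEquality
  open import Relation.Nullary using (yes; no; contradiction)

  open import Defs using
    (Graph; adj; symmetric; irreflexive; _≈_; _Contains_; K)

  private variable
    n k l m : ℕ

  -- The number of vertex pairs, by recursion on the vertices, so that an index splits into a pair
  -- at vertex `zero` or a pair of later vertices.
  slots : ℕ → ℕ
  slots zero    = 0
  slots (suc n) = n + slots n

  slots≡nC2 : ∀ n → slots n ≡ n C 2
  slots≡nC2 zero    = refl
  slots≡nC2 (suc n) = trans (cong₂ _+_ (sym (nC1≡n n)) (slots≡nC2 n)) (nCk+nC[k+1]≡[n+1]C[k+1] n 1)

  slot : Fin n → Fin n → Maybe (Fin (slots n))
  slot         zero    zero    = nothing
  slot {suc n} zero    (suc j) = just (j ↑ˡ slots n)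
  slot {suc n} (suc i) zero    = just (i ↑ˡ slots n)
  slot {suc n} (suc i) (suc j) = Maybe.map (n ↑ʳ_) (slot i j)

  slot-sym : (i j : Fin n) → slot i j ≡ slot j i
  slot-sym zero    zero    = refl
  slot-sym zero    (suc j) = refl
  slot-sym (suc i) zero    = refl
  slot-sym (suc i) (suc j) = cong (Maybe.map _) (slot-sym i j)

  slot-diagonal : (i : Fin n) → slot i i ≡ nothing
  slot-diagonal zero    = refl
  slot-diagonal (suc i) = cong (Maybe.map _) (slot-diagonal i)

  slot-≢ : (i j : Fin n) → i ≢ j → ∃ λ e → slot i j ≡ just e
  slot-≢ zero    zero    i≢j = contradiction refl i≢j
  slot-≢ zero    (suc j) _   = _ , refl
  slot-≢ (suc i) zero    _   = _ , refl
  slot-≢ (suc i) (suc j) i≢j with e , eq ← slot-≢ i j (i≢j ∘ cong suc) = _ , cong (Maybe.map _) eq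

  -- One orientation of each pair, smaller vertex first; `ends-slot` allows for the other one.
  ends : ∀ n → Fin (slots n) → Fin n × Fin n
  ends (suc n) e with splitAt n e
  ... | inj₁ j  = zero , suc j
  ... | inj₂ e′ = suc (proj₁ (ends n e′)) , suc (proj₂ (ends n e′))

  slot-ends : ∀ n (e : Fin (slots n)) → uncurry slot (ends n e) ≡ just e
  slot-ends (suc n) e with splitAt n e in eq
  ... | inj₁ j  = cong just (Fin.splitAt⁻¹-↑ˡ eq)
  ... | inj₂ e′ = trans (cong (Maybe.map (n ↑ʳ_)) (slot-ends n e′)) (cong just (Fin.splitAt⁻¹-↑ʳ eq))

  ends-slot : (i j : Fin n) {e : Fin (slots n)} → slot i j ≡ just e →
              ends n e ≡ (i , j) ⊎ ends n e ≡ (j , i)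
  ends-slot {suc n} zero (suc j) refl rewrite Fin.splitAt-↑ˡ n j (slots n) = inj₁ refl
  ends-slot {suc n} (suc i) zero refl rewrite Fin.splitAt-↑ˡ n i (slots n) = inj₂ refl
  ends-slot {suc n} (suc i) (suc j) eq with slot i j in eq′
  ends-slot {suc n} (suc i) (suc j) refl | just e rewrite Fin.splitAt-↑ʳ n (slots n) e
    with ends-slot i j eq′
  ... | inj₁ p = inj₁ (cong (λ (u , v) → suc u , suc v) p)
  ... | inj₂ p = inj₂ (cong (λ (u , v) → suc u , suc v) p)

  slot-injective : {i j i′ j′ : Fin n} → i ≢ j → slot i j ≡ slot i′ j′ →
                   (i ≡ i′ × j ≡ j′) ⊎ (i ≡ j′ × j ≡ i′)
  slot-injective {i = i} {j} {i′} {j′} i≢j eq with slot-≢ i j i≢j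
  ... | e , p with ends-slot i j p | ends-slot i′ j′ (trans (sym eq) p)
  ... | inj₁ q | inj₁ r with refl ← trans (sym q) r = inj₁ (refl , refl)
  ... | inj₁ q | inj₂ r with refl ← trans (sym q) r = inj₂ (refl , refl)
  ... | inj₂ q | inj₁ r with refl ← trans (sym q) r = inj₂ (refl , refl)
  ... | inj₂ q | inj₂ r with refl ← trans (sym q) r = inj₁ (refl , refl)

  fromBits : Subset (slots n) → Graph n
  fromBits x = record
    { adj         = λ i j → maybe (lookup x) false (slot i j)
    ; symmetric   = λ i j → cong (maybe (lookup x) false) (slot-sym i j)
    ; irreflexive = λ i → cong (maybe (lookup x) false) (slot-diagonal i)
    }

  toBits : Graph n → Subset (slots n)
  toBits {n} G = tabulate λ e → uncurry (adj G) (ends n e)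

  toBits∘fromBits : (x : Subset (slots n)) → toBits {n} (fromBits x) ≡ x
  toBits∘fromBits {n} x =
    trans (tabulate-cong λ e → cong (maybe (lookup x) false) (slot-ends n e)) (tabulate∘lookup x)

  lookup-toBits : (G : Graph n) {i j : Fin n} {e : Fin (slots n)} → slot i j ≡ just e →
                  lookup (toBits G) e ≡ adj G i j
  lookup-toBits G {i} {j} {e} p = trans (lookup∘tabulate _ e)
    ([ cong (uncurry (adj G)) , (λ q → trans (cong (uncurry (adj G)) q) (symmetric G j i)) ]′
      (ends-slot i j p))

  toBits-cong : {G H : Graph n} → G ≈ H → toBits G ≡ toBits H
  toBits-cong {n} G≈H = tabulate-cong λ e → uncurry G≈H (ends n e)

  toBits-injective : {G H : Graph n} → toBits G ≡ toBits H → G ≈ H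
  toBits-injective {G = G} {H} eq i j with i Fin.≟ j
  ... | yes refl = trans (irreflexive G i) (sym (irreflexive H i))
  ... | no i≢j with e , p ← slot-≢ i j i≢j =
    trans (sym (lookup-toBits G p)) (trans (cong (λ x → lookup x e) eq) (lookup-toBits H p))

  fromBits-injective : {x y : Subset (slots n)} → fromBits {n} x ≈ fromBits y → x ≡ y
  fromBits-injective {n} {x} {y} eq =
    trans (sym (toBits∘fromBits {n} x))
      (trans (toBits-cong {G = fromBits x} {fromBits y} eq) (toBits∘fromBits {n} y))

  Contains-mono : {G H : Graph n} (L : Graph k) →
    (∀ i j → T (adj G i j) → T (adj H i j)) → G Contains L → H Contains L
  Contains-mono _ G⊆H (f , inj , h) = f , inj , λ i j → G⊆H (f i) (f j) ∘ h i j

  Contains-trans : {G : Graph n} {H : Graph k} {L : Graph l} →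
                   G Contains H → H Contains L → G Contains L
  Contains-trans (f , f-inj , f-edge) (g , g-inj , g-edge) =
    f ∘ g , g-inj ∘ f-inj , λ i j → f-edge (g i) (g j) ∘ g-edge i j

  module _ {s t : ℕ} where

    private
      side : Fin (s + t) → Fin s ⊎ Fin t
      side = splitAt s

    K-adj : ∀ i j → adj (K s t) (i ↑ˡ t) (s ↑ʳ j) ≡ true
    K-adj i j rewrite Fin.splitAt-↑ˡ s i t | Fin.splitAt-↑ʳ s t j = refl

    ↑ˡ≢↑ʳ : ∀ i j → i ↑ˡ t ≢ s ↑ʳ j
    ↑ˡ≢↑ʳ i j eq with () ← trans (sym (Fin.splitAt-↑ˡ s i t)) (trans (cong side eq) (Fin.splitAt-↑ʳ s t j))

    -- Irreflexivity makes the two vertex sets disjoint.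
    complete⇒Contains-K : (G : Graph n) (f : Fin s → Fin n) (g : Fin t → Fin n) →
      Injective _≡_ _≡_ f → Injective _≡_ _≡_ g →
      (∀ i j → adj G (f i) (g j) ≡ true) → G Contains K s t
    complete⇒Contains-K {n} G f g f-inj g-inj edge = h , h-inj , h-edge
      where
      h : Fin (s + t) → Fin n
      h = [ f , g ]′ ∘ side
      f≢g : ∀ i j → f i ≢ g j
      f≢g i j eq with () ← trans (sym (irreflexive G (f i))) (trans (cong (adj G (f i)) eq) (edge i j))
      h-inj : Injective _≡_ _≡_ h
      h-inj {x} {y} eq with side x in p | side y in q
      ... | inj₁ i | inj₁ j = trans (sym (Fin.splitAt⁻¹-↑ˡ p))
                               (trans (cong (_↑ˡ t) (f-inj eq)) (Fin.splitAt⁻¹-↑ˡ q))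
      ... | inj₁ i | inj₂ j = contradiction eq (f≢g i j)
      ... | inj₂ i | inj₁ j = contradiction (sym eq) (f≢g j i)
      ... | inj₂ i | inj₂ j = trans (sym (Fin.splitAt⁻¹-↑ʳ p))
                               (trans (cong (s ↑ʳ_) (g-inj eq)) (Fin.splitAt⁻¹-↑ʳ q))
      h-edge : ∀ x y → T (adj (K s t) x y) → T (adj G (h x) (h y))
      h-edge x y p with side x | side y
      ... | inj₁ i | inj₂ j = subst T (sym (edge i j)) _
      ... | inj₂ i | inj₁ j = subst T (sym (trans (symmetric G (g i) (f j)) (edge j i))) _

  K-suc-Contains-K : ∀ t → K (suc t) (suc t) Contains K t t
  K-suc-Contains-K t = complete⇒Contains-K (K (suc t) (suc t))
    (λ i → suc i ↑ˡ suc t) (λ j → suc t ↑ʳ suc j)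
    (Fin.suc-injective ∘ Fin.↑ˡ-injective (suc t) _ _)
    (Fin.suc-injective ∘ Fin.↑ʳ-injective (suc t) _ _)
    (λ i j → K-adj {suc t} {suc t} (suc i) (suc j))

-- Lower bound, combinatorial part: a maximal code covers all graphs

module Covering where

  open import Data.Bool.Base using (Bool; true; false; _xor_; T)
  import Data.Bool.Properties as Bool

  open import Data.Fin.Base using (Fin; zero; suc; toℕ; fromℕ<; combine; remQuot; _↑ʳ_)
  import Data.Fin.Properties as Fin
  open import Data.Fin.Subset using (Subset; ∣_∣)
  open import Data.List.Base using (List; length; allFin; cartesianProduct)
  open import Data.List.Properties using (length-tabulate)
  open import Data.List.Membership.Propositional using (_∈_; lose)
  open import Data.List.Membership.Propositional.Properties using (∈-allFin; ∈-cartesianProduct⁺)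
  import Data.List.Relation.Unary.Any as Any
  open import Data.Nat.Base
  open import Data.Nat.Properties
  open import Data.Product.Base using (∃; _×_; _,_; proj₁; proj₂)
  open import Data.Product.Properties using (,-injective)
  open import Data.Sum.Base using (_⊎_; inj₁; inj₂)
  open import Data.Vec.Base using (Vec; lookup; tabulate; count)
  open import Data.Vec.Properties using (lookup∘tabulate; ≡-dec)
  open import Function.Base using (_∘_)
  open import Function.Definitions using (Injective)
  open import Relation.Binary.Definitions using (DecidableEquality)
  open import Relation.Binary.PropositionalEquality
  open import Relation.Nullary using (¬_; Dec; yes; no; contradiction)
  open import Relation.Nullary.Decidable using (_×-dec_)

  open import Defs using
    (Graph; adj; _≈_; _⊕_; _Contains_; K; IsCode; M; M-isMaximum)
  open Counting
  open GraphCoding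

  private variable
    n : ℕ

  _≟ʷ_ : DecidableEquality (Subset n)
  _≟ʷ_ = ≡-dec Bool._≟_

  -- Out-of-range columns are padded with false.
  cell : Graph n → Fin n → ℕ → Bool
  cell {n} H i j with j <? n
  ... | yes j<n = adj H i (fromℕ< j<n)
  ... | no  _   = false

  cell-toℕ : (H : Graph n) (i j : Fin n) → cell H i (toℕ j) ≡ adj H i j
  cell-toℕ {n} H i j with toℕ j <? n
  ... | yes j<n = cong (adj H i) (Fin.fromℕ<-toℕ j j<n)
  ... | no  j≮n = contradiction (Fin.toℕ<n j) j≮n

  cell-true : (H : Graph n) (i : Fin n) (j : ℕ) → cell H i j ≡ true →
              ∃ λ j′ → toℕ j′ ≡ j × adj H i j′ ≡ true
  cell-true {n} H i j p with j <? n
  ... | yes j<n = fromℕ< j<n , Fin.toℕ-fromℕ< j<n , p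

  module _ (n s q t : ℕ) where

    row : Graph n → Fin q → Fin n → Subset s
    row H b i = tabulate λ k → cell H i (toℕ (combine b k))

    block : Graph n → Fin q → Vec (Subset s) n
    block H b = tabulate (row H b)

    blocks : Graph n → Vec (Vec (Subset s) n) q
    blocks H = tabulate (block H)

    lookup-row : ∀ H b i k → lookup (row H b i) k ≡ cell H i (toℕ (combine b k))
    lookup-row H b i = lookup∘tabulate _

    lookup-blocks : ∀ H b i → lookup (lookup (blocks H) b) i ≡ row H b i
    lookup-blocks H b i = trans (cong (λ w → lookup w i) (lookup∘tabulate (block H) b))
                                (lookup∘tabulate (row H b) i)

    -- The hypothesis says that `q` blocks of width `s` reach every column; quotient and remainder
    -- by `s` locate column `j`.
    blocks-injective : n ≤ q * s → {H H′ : Graph n} → blocks H ≡ blocks H′ → H ≈ H′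
    blocks-injective n≤qs {H} {H′} eq i j = begin
      adj H i j                            ≡⟨ cell-toℕ H i j ⟨
      cell H i (toℕ j)                     ≡⟨ cong (cell H i) toℕ-bk ⟨
      cell H i (toℕ (combine b k))         ≡⟨ lookup-row H b i k ⟨
      lookup (row H b i) k                 ≡⟨ cong (λ v → lookup v k) rows ⟩
      lookup (row H′ b i) k                ≡⟨ lookup-row H′ b i k ⟩
      cell H′ i (toℕ (combine b k))        ≡⟨ cong (cell H′ i) toℕ-bk ⟩
      cell H′ i (toℕ j)                    ≡⟨ cell-toℕ H′ i j ⟩
      adj H′ i j                           ∎
      where
      open ≡-Reasoning
      j<qs = <-≤-trans (Fin.toℕ<n j) n≤qs
      b = proj₁ (remQuot {q} s (fromℕ< j<qs))
      k = proj₂ (remQuot {q} s (fromℕ< j<qs))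
      toℕ-bk : toℕ (combine b k) ≡ toℕ j
      toℕ-bk = trans (cong toℕ (Fin.combine-remQuot {q} s (fromℕ< j<qs))) (Fin.toℕ-fromℕ< j<qs)
      rows : row H b i ≡ row H′ b i
      rows = trans (sym (lookup-blocks H b i))
        (trans (cong (λ w → lookup (lookup w b) i) eq) (lookup-blocks H′ b i))

    Heavy : Subset s → Set
    Heavy v = t < ∣ v ∣

    heavy? : ∀ v → Dec (Heavy v)
    heavy? v = t <? ∣ v ∣

    -- A family containing the matrices of all graphs without K (suc t) (suc t).
    exceptional : List (Vec (Vec (Subset s) n) q)
    exceptional = vecs (sparse (light t s) (words s) n (2 ^ s * t)) q

    length-exceptional :
      length exceptional ≤ (suc (length (light t s)) ^ n * (2 ^ s) ^ (2 ^ s * t)) ^ q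
    length-exceptional = begin
      length exceptional  ≡⟨ length-vecs (sparse (light t s) (words s) n (2 ^ s * t)) q ⟩
      length (sparse (light t s) (words s) n (2 ^ s * t)) ^ q
        ≤⟨ ^-monoˡ-≤ q (length-sparse (light t s) (words s) n (2 ^ s * t)) ⟩
      (suc (length (light t s)) ^ n * length (words s) ^ (2 ^ s * t)) ^ q
        ≡⟨ cong (λ N → (suc (length (light t s)) ^ n * N ^ (2 ^ s * t)) ^ q) (length-words s) ⟩
      (suc (length (light t s)) ^ n * (2 ^ s) ^ (2 ^ s * t)) ^ q  ∎
      where
      open ≤-Reasoning
      instance
        words≢0 : NonZero (length (words s))
        words≢0 = subst NonZero (sym (length-words s)) (m^n≢0 2 s)

    -- With too many heavy rows in a block, one of the 2^s words is heavy and occurs in more than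
    -- `t` rows. Those rows and `suc t` of the ones of the word are the two sides of the copy.
    exceptional⊎K : (H : Graph n) → blocks H ∈ exceptional ⊎ H Contains K (suc t) (suc t)
    exceptional⊎K H with Fin.all? (λ b → count heavy? (lookup (blocks H) b) ≤? 2 ^ s * t)
    ... | yes few = inj₁ (∈-vecs (blocks H) λ b →
          ∈-sparse heavy? (λ v v-light → ∈-light t v (≮⇒≥ v-light)) ∈-words (lookup (blocks H) b) (few b))
    ... | no ¬few with Fin.¬∀⟶∃¬ q _ (λ b → count heavy? (lookup (blocks H) b) ≤? 2 ^ s * t) ¬few
    ... | b , many with Any.any? (λ v → t <? count (v ≟ʷ_) (lookup (blocks H) b) ×-dec heavy? v) (words s)
    ... | no none = contradiction
          (≤-trans (count-bounded _≟ʷ_ heavy? (words s) (lookup (blocks H) b) (λ v _ → ∈-words v)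
                     (λ v v-heavy → ≮⇒≥ λ often → none (lose (∈-words v) (often , v-heavy))))
                   (≤-reflexive (cong (_* t) (length-words s))))
          many
    ... | yes some with v , often , v-heavy ← Any.satisfied some
      with f , f-inj , f-row ← pick (v ≟ʷ_) (lookup (blocks H) b) often
         | g , g-inj , g-in  ← pick (Bool._≟ true) v v-heavy
      = inj₂ (complete⇒Contains-K H f g′ f-inj g′-inj edge)
      where
      cell≡true : ∀ i k → cell H (f i) (toℕ (combine b (g k))) ≡ true
      cell≡true i k = begin
        cell H (f i) (toℕ (combine b (g k)))      ≡⟨ lookup-row H b (f i) (g k) ⟨
        lookup (row H b (f i)) (g k)              ≡⟨ cong (λ w → lookup w (g k)) (lookup-blocks H b (f i)) ⟨
        lookup (lookup (lookup (blocks H) b) (f i)) (g k)  ≡⟨ cong (λ w → lookup w (g k)) (f-row i) ⟨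
        lookup v (g k)                            ≡⟨ g-in k ⟩
        true                                      ∎
        where open ≡-Reasoning
      column : ∀ i k → ∃ λ j → toℕ j ≡ toℕ (combine b (g k)) × adj H (f i) j ≡ true
      column i k = cell-true H (f i) _ (cell≡true i k)
      g′ : Fin (suc t) → Fin n
      -- A true cell is never padding, so each chosen position is a genuine column. Row `zero`,
      -- available because the index type is `Fin (suc t)`, is used to name it; `edge` checks that
      -- every other row names the same column.
      g′ k = proj₁ (column zero k)
      g′-inj : Injective _≡_ _≡_ g′
      g′-inj {k} {l} eq = g-inj (Fin.combine-injectiveʳ b (g k) b (g l) (Fin.toℕ-injective
        (trans (sym (proj₁ (proj₂ (column zero k))))
          (trans (cong toℕ eq) (proj₁ (proj₂ (column zero l)))))))
      edge : ∀ i k → adj H (f i) (g′ k) ≡ true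
      edge i k = trans (cong (adj H (f i)) (Fin.toℕ-injective
        (trans (proj₁ (proj₂ (column zero k))) (sym (proj₁ (proj₂ (column i k)))))))
        (proj₂ (proj₂ (column i k)))

  ⊕-cancelˡ : (F G H : Graph n) → F ⊕ G ≈ F ⊕ H → G ≈ H
  ⊕-cancelˡ F G H eq i j = xor-cancelˡ (adj F i j) (eq i j)
    where
    xor-cancelˡ : ∀ a {b c} → (a xor b) ≡ (a xor c) → b ≡ c
    xor-cancelˡ false p = p
    xor-cancelˡ true  p = Bool.not-injective p

  -- If no element of a largest code is exceptional relative to G, the code extends by G.
  greedy : ∀ t n (P : Graph n → Set) → (∀ H → Dec (P H)) →
    (∀ H → P H ⊎ H Contains K (suc t) (suc t)) →
    (G : Graph n) → ∃ λ i → P (proj₁ (proj₁ (M-isMaximum (K t t) n)) i ⊕ G)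
  greedy t n P P? P⊎K G = go
    where
    code = proj₁ (M-isMaximum (K t t) n)
    𝒢 = proj₁ code
    open IsCode (proj₂ code)
    go : ∃ λ i → P (𝒢 i ⊕ G)
    go with Fin.any? (λ i → P? (𝒢 i ⊕ G))
    ... | yes found = found
    ... | no  none  = contradiction (proj₂ (M-isMaximum (K t t) n) _ (𝒢′ , isCode)) (<⇒≱ ≤-refl)
      where
      𝒢′ : Fin (suc (M (K t t) n)) → Graph n
      𝒢′ zero    = G
      𝒢′ (suc i) = 𝒢 i
      far : ∀ i → (𝒢 i ⊕ G) Contains K (suc t) (suc t)
      far i with P⊎K (𝒢 i ⊕ G)
      ... | inj₁ p = contradiction (i , p) none
      ... | inj₂ c = c
      xor≡false : ∀ {a b} → a ≡ b → (a xor b) ≡ false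
      xor≡false {a} refl = Bool.xor-same a
      -- The difference contains an edge of `K (suc t) (suc t)`, which exists for every `t`;
      -- containing `K 0 0` would not separate the graphs.
      apart : ∀ i → ¬ (𝒢 i ≈ G)
      apart i eq with f , _ , edge ← far i =
        subst T (xor≡false (eq (f zero) (f (suc t ↑ʳ zero))))
          (edge zero (suc t ↑ʳ zero)
            (subst T (sym (K-adj {suc t} {suc t} zero zero)) _))
      close : ∀ i → (𝒢 i ⊕ G) Contains K t t
      close i = Contains-trans {G = 𝒢 i ⊕ G} {K (suc t) (suc t)} {K t t} (far i) (K-suc-Contains-K t)
      isCode : IsCode (K t t) 𝒢′
      isCode = record { distinct = distinct′ ; differ = differ′ }
        where
        distinct′ : ∀ i j → i ≢ j → ¬ (𝒢′ i ≈ 𝒢′ j)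
        distinct′ zero    zero    i≢j _  = i≢j refl
        distinct′ zero    (suc j) _   eq = apart j λ u v → sym (eq u v)
        distinct′ (suc i) zero    _   eq = apart i eq
        distinct′ (suc i) (suc j) i≢j eq = distinct i j (i≢j ∘ cong suc) eq
        differ′ : ∀ i j → i ≢ j → (𝒢′ i ⊕ 𝒢′ j) Contains K t t
        differ′ zero    zero    i≢j = contradiction refl i≢j
        differ′ zero    (suc j) _   = Contains-mono {G = 𝒢 j ⊕ G} {G ⊕ 𝒢 j} (K t t)
          (λ u v → subst T (Bool.xor-comm (adj (𝒢 j) u v) (adj G u v))) (close j)
        differ′ (suc i) zero    _   = close i
        differ′ (suc i) (suc j) i≢j = differ i j (i≢j ∘ cong suc)

  -- Each graph is recorded as the index of a nearby member together with the block matrix of the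
  -- difference. Cancelling the member from the difference recovers the graph, so the number of such
  -- pairs bounds the number of graphs.
  covering : ∀ n s q t → n ≤ q * s → 2 ^ slots n ≤
    M (K t t) n * (suc (length (light t s)) ^ n * (2 ^ s) ^ (2 ^ s * t)) ^ q
  covering n s q t n≤qs = begin
    2 ^ slots n                                  ≤⟨ injective⇒≤-length pair-injective pair∈ ⟩
    length (cartesianProduct (allFin (M (K t t) n)) (exceptional n s q t))
      ≡⟨ length-cartesianProductWith _,_ (allFin (M (K t t) n)) (exceptional n s q t) ⟩
    length (allFin (M (K t t) n)) * length (exceptional n s q t)
      ≡⟨ cong (_* length (exceptional n s q t)) (length-tabulate {n = M (K t t) n} (λ i → i)) ⟩
    M (K t t) n * length (exceptional n s q t)
      ≤⟨ *-monoʳ-≤ (M (K t t) n) (length-exceptional n s q t) ⟩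
    M (K t t) n * (suc (length (light t s)) ^ n * (2 ^ s) ^ (2 ^ s * t)) ^ q  ∎
    where
    open ≤-Reasoning
    𝒢 = proj₁ (proj₁ (M-isMaximum (K t t) n))
    graph : Fin (2 ^ slots n) → Graph n
    graph x = fromBits (word (slots n) x)
    near : ∀ x → ∃ λ i → blocks n s q t (𝒢 i ⊕ graph x) ∈ exceptional n s q t
    near x = greedy t n (λ H → blocks n s q t H ∈ exceptional n s q t)
      (λ H → Any.any? (≡-dec (≡-dec _≟ʷ_) (blocks n s q t H)) (exceptional n s q t))
      (exceptional⊎K n s q t) (graph x)
    pair : Fin (2 ^ slots n) → Fin (M (K t t) n) × Vec (Vec (Subset s) n) q
    pair x = proj₁ (near x) , blocks n s q t (𝒢 (proj₁ (near x)) ⊕ graph x)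
    pair∈ : ∀ x → pair x ∈ cartesianProduct (allFin (M (K t t) n)) (exceptional n s q t)
    pair∈ x = ∈-cartesianProduct⁺ (∈-allFin _) (proj₂ (near x))
    pair-injective : Injective _≡_ _≡_ pair
    pair-injective {x} {y} eq with i≡j , b≡b ← ,-injective eq =
      word-injective (slots n) (fromBits-injective {n} (⊕-cancelˡ (𝒢 (proj₁ (near y))) (graph x) (graph y)
        (blocks-injective n s q t n≤qs {𝒢 (proj₁ (near y)) ⊕ graph x}
          (trans (cong (λ i → blocks n s q t (𝒢 i ⊕ graph x)) (sym i≡j)) b≡b))))

-- Upper bound, combinatorial part: packing and the first moment method

module Packing where

  open import Data.Bool.Base using (Bool; true; false; _xor_; T)
  import Data.Bool.Properties as Bool
  open import Data.Fin.Base using (Fin; zero; suc; combine; remQuot; _↑ˡ_; _↑ʳ_)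
  import Data.Fin.Properties as Fin
  open import Data.Fin.Subset using (Subset; ∣_∣; _-_)
  import Data.Fin.Subset as Subset
  open import Data.Fin.Subset.Properties using (x∈p⇒∣p-x∣<∣p∣; x∈p∧x≢y⇒x∈p-y; ∣p∣≤n)
  open import Data.List.Base using (List; []; _∷_; _++_; length; map; allFin; filter)
  open import Data.List.Properties using (length-++; length-map; length-tabulate; length-filter)
  open import Data.List.Membership.Propositional using (_∈_)
  open import Data.List.Membership.Propositional.Properties
    using (∈-map⁺; ∈-map⁻; ∈-++⁺ˡ; ∈-++⁺ʳ; ∈-allFin; ∈-filter⁺; ∈-filter⁻)
  open import Data.List.Relation.Unary.Any using (here; there)
  open import Data.Maybe.Base using (just; maybe)
  open import Data.Maybe.Properties using (≡-dec)
  open import Data.Nat.Base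
  open import Data.Nat.ListAction using (sum)
  open import Data.Nat.Properties
  open import Data.Nat.Tactic.RingSolver using (solve-∀)
  open import Data.Product.Base using (∃; _×_; _,_; proj₁; proj₂)
  open import Data.Sum.Base using (inj₁; inj₂)
  open import Data.Vec.Base using (Vec; []; _∷_; lookup; tabulate)
  open import Data.Vec.Properties using (lookup∘tabulate; lookup⇒[]=)
  open import Function.Base using (_∘_)
  open import Function.Definitions using (Injective)
  open import Relation.Binary.PropositionalEquality
  open import Relation.Nullary using (¬_; Dec; yes; no; does; contradiction)
  open import Relation.Nullary.Decidable using (_→-dec_; dec-true)

  open import Defs using
    (Graph; adj; _⊕_; _Contains_; K; IsCode; M; M-isMaximum)
  open Counting
  open GraphCoding

  private variable
    n k t : ℕ

  mask : Subset n → Subset n → Subset n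
  mask []          []      = []
  mask (true ∷ p)  (_ ∷ v) = false ∷ mask p v
  mask (false ∷ p) (x ∷ v) = x ∷ mask p v

  -- The vectors that vanish on `p`, standing for the restrictions of bit vectors to the complement
  -- of `p`.
  masks : Subset n → List (Subset n)
  masks []          = [] ∷ []
  masks (true ∷ p)  = map (false ∷_) (masks p)
  masks (false ∷ p) = map (false ∷_) (masks p) ++ map (true ∷_) (masks p)

  length-masks : (p : Subset n) → length (masks p) * 2 ^ ∣ p ∣ ≡ 2 ^ n
  length-masks []          = refl
  length-masks {suc n} (true ∷ p)  = begin
    length (map (false ∷_) (masks p)) * (2 * 2 ^ ∣ p ∣)  ≡⟨ cong (_* (2 * 2 ^ ∣ p ∣)) (length-map _ (masks p)) ⟩
    length (masks p) * (2 * 2 ^ ∣ p ∣)                   ≡⟨ swap (length (masks p)) (2 ^ ∣ p ∣) ⟩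
    2 * (length (masks p) * 2 ^ ∣ p ∣)                   ≡⟨ cong (2 *_) (length-masks p) ⟩
    2 * 2 ^ n                                            ∎
    where
    open ≡-Reasoning
    swap : ∀ a b → a * (2 * b) ≡ 2 * (a * b)
    swap = solve-∀
  length-masks {suc n} (false ∷ p) = begin
    length (masks (false ∷ p)) * 2 ^ ∣ p ∣
      ≡⟨ cong (_* 2 ^ ∣ p ∣) (trans (length-++ (map (false ∷_) (masks p)))
           (cong₂ _+_ (length-map _ (masks p)) (length-map _ (masks p)))) ⟩
    (length (masks p) + length (masks p)) * 2 ^ ∣ p ∣    ≡⟨ swap (length (masks p)) (2 ^ ∣ p ∣) ⟩
    2 * (length (masks p) * 2 ^ ∣ p ∣)                   ≡⟨ cong (2 *_) (length-masks p) ⟩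
    2 * 2 ^ n                                            ∎
    where
    open ≡-Reasoning
    swap : ∀ a b → (a + a) * b ≡ 2 * (a * b)
    swap = solve-∀

  mask∈masks : (p v : Subset n) → mask p v ∈ masks p
  mask∈masks []          []          = here refl
  mask∈masks (true ∷ p)  (_ ∷ v)     = ∈-map⁺ (false ∷_) (mask∈masks p v)
  mask∈masks (false ∷ p) (false ∷ v) = ∈-++⁺ˡ (∈-map⁺ (false ∷_) (mask∈masks p v))
  mask∈masks (false ∷ p) (true ∷ v)  = ∈-++⁺ʳ (map (false ∷_) (masks p)) (∈-map⁺ (true ∷_) (mask∈masks p v))

  lookup-mask : (p v : Subset n) (e : Fin n) → lookup p e ≡ false → lookup (mask p v) e ≡ lookup v e
  lookup-mask (false ∷ p) (x ∷ v) zero    _  = refl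
  lookup-mask (true ∷ p)  (x ∷ v) (suc e) eq = lookup-mask p v e eq
  lookup-mask (false ∷ p) (x ∷ v) (suc e) eq = lookup-mask p v e eq

  M≤2^slots : ∀ {l} (L : Graph l) n → M L n ≤ 2 ^ slots n
  M≤2^slots L n = ≤-trans (injective⇒≤-length trace-injective (λ i → ∈-words (toBits (𝒢 i))))
                          (≤-reflexive (length-words (slots n)))
    where
    𝒢 = proj₁ (proj₁ (M-isMaximum L n))
    open IsCode (proj₂ (proj₁ (M-isMaximum L n)))
    trace-injective : Injective _≡_ _≡_ (λ i → toBits (𝒢 i))
    trace-injective {i} {j} eq with i Fin.≟ j
    ... | yes i≡j = i≡j
    ... | no  i≢j = contradiction (toBits-injective {G = 𝒢 i} {𝒢 j} eq) (distinct i j i≢j)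

  -- Two members of a code agreeing off an L-free graph F would differ by a subgraph of F.
  packing : ∀ {l} (L : Graph l) n (F : Subset (slots n)) → ¬ (fromBits {n} F Contains L) →
            M L n * 2 ^ ∣ F ∣ ≤ 2 ^ slots n
  packing L n F F-free = begin
    M L n * 2 ^ ∣ F ∣             ≤⟨ *-monoˡ-≤ (2 ^ ∣ F ∣) (injective⇒≤-length trace-injective trace∈) ⟩
    length (masks F) * 2 ^ ∣ F ∣  ≡⟨ length-masks F ⟩
    2 ^ slots n                   ∎
    where
    open ≤-Reasoning
    𝒢 = proj₁ (proj₁ (M-isMaximum L n))
    open IsCode (proj₂ (proj₁ (M-isMaximum L n)))
    trace : Fin (M L n) → Subset (slots n)
    trace i = mask F (toBits (𝒢 i))
    trace∈ : ∀ i → trace i ∈ masks F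
    trace∈ i = mask∈masks F (toBits (𝒢 i))
    within : ∀ i j → trace i ≡ trace j → ∀ u v →
             T (adj (𝒢 i ⊕ 𝒢 j) u v) → T (adj (fromBits {n} F) u v)
    within i j eq u v differs with u Fin.≟ v
    ... | yes refl = contradiction differs
          (subst T (Graph.irreflexive (𝒢 i ⊕ 𝒢 j) u))
    ... | no u≢v with e , p ← slot-≢ u v u≢v rewrite p with lookup F e in q
    ... | true  = _
    ... | false = subst T (trans (cong (_xor adj (𝒢 j) u v) same) (Bool.xor-same (adj (𝒢 j) u v))) differs
      where
      same : adj (𝒢 i) u v ≡ adj (𝒢 j) u v
      same = trans (sym (lookup-toBits (𝒢 i) p))
        (trans (sym (lookup-mask F (toBits (𝒢 i)) e q))
          (trans (cong (λ w → lookup w e) eq)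
            (trans (lookup-mask F (toBits (𝒢 j)) e q) (lookup-toBits (𝒢 j) p))))
    trace-injective : Injective _≡_ _≡_ trace
    trace-injective {i} {j} eq with i Fin.≟ j
    ... | yes i≡j = i≡j
    ... | no  i≢j = contradiction
      (Contains-mono {G = 𝒢 i ⊕ 𝒢 j} {fromBits F} L (within i j eq) (differ i j i≢j)) F-free

  -- Expectation for independent bits that are true with odds a : c, scaled by (a + c) ^ n.
  module Expectation (a c : ℕ) where

    b : ℕ
    b = a + c

    𝔼 : ∀ n → (Subset n → ℕ) → ℕ
    𝔼 zero    f = f []
    𝔼 (suc n) f = a * 𝔼 n (f ∘ (true ∷_)) + c * 𝔼 n (f ∘ (false ∷_))

    𝔼-+ : ∀ n f g → 𝔼 n (λ x → f x + g x) ≡ 𝔼 n f + 𝔼 n g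
    𝔼-+ zero    f g = refl
    𝔼-+ (suc n) f g = trans
      (cong₂ (λ u v → a * u + c * v) (𝔼-+ n (f ∘ (true ∷_)) (g ∘ (true ∷_)))
                                     (𝔼-+ n (f ∘ (false ∷_)) (g ∘ (false ∷_))))
      (expand a c _ _ _ _)
      where
      expand : ∀ a c p q r s → a * (p + q) + c * (r + s) ≡ (a * p + c * r) + (a * q + c * s)
      expand = solve-∀

    𝔼-* : ∀ n d f → 𝔼 n (λ x → d * f x) ≡ d * 𝔼 n f
    𝔼-* zero    d f = refl
    𝔼-* (suc n) d f = trans
      (cong₂ (λ u v → a * u + c * v) (𝔼-* n d (f ∘ (true ∷_))) (𝔼-* n d (f ∘ (false ∷_))))
      (expand a c d _ _)
      where
      expand : ∀ a c d p q → a * (d * p) + c * (d * q) ≡ d * (a * p + c * q)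
      expand = solve-∀

    𝔼-const : ∀ n d → 𝔼 n (λ _ → d) ≡ d * b ^ n
    𝔼-const zero    d = sym (*-identityʳ d)
    𝔼-const (suc n) d = trans (cong (λ u → a * u + c * u) (𝔼-const n d)) (collect a c d (b ^ n))
      where
      collect : ∀ a c d p → a * (d * p) + c * (d * p) ≡ d * ((a + c) * p)
      collect = solve-∀

    𝔼-card : ∀ n → b * 𝔼 n ∣_∣ ≡ n * a * b ^ n
    𝔼-card zero    = *-zeroʳ b
    𝔼-card (suc n) = begin
      b * (a * 𝔼 n (λ x → 1 + ∣ x ∣) + c * 𝔼 n ∣_∣)
        ≡⟨ cong (λ u → b * (a * u + c * 𝔼 n ∣_∣))
             (trans (𝔼-+ n (λ _ → 1) ∣_∣) (cong (_+ 𝔼 n ∣_∣) (𝔼-const n 1))) ⟩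
      b * (a * (1 * b ^ n + 𝔼 n ∣_∣) + c * 𝔼 n ∣_∣)  ≡⟨ expand a c (b ^ n) (𝔼 n ∣_∣) ⟩
      b * (b * 𝔼 n ∣_∣) + a * (b * b ^ n)            ≡⟨ cong (λ u → b * u + a * (b * b ^ n)) (𝔼-card n) ⟩
      b * (n * a * b ^ n) + a * (b * b ^ n)          ≡⟨ collect n a b (b ^ n) ⟩
      suc n * a * (b * b ^ n)                        ∎
      where
      open ≡-Reasoning
      expand : ∀ a c p e → (a + c) * (a * (1 * p + e) + c * e) ≡ (a + c) * ((a + c) * e) + a * ((a + c) * p)
      expand = solve-∀
      collect : ∀ n a b p → b * (n * a * p) + a * (b * p) ≡ suc n * a * (b * p)
      collect = solve-∀

    -- If `f` had the larger expectation on both halves, the weighted sum would be strictly larger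
    -- too; the positive weight `a` provides the strictness even when `c` is 0.
    𝔼≤⇒∃≤ : .{{NonZero a}} → ∀ n f g → 𝔼 n f ≤ 𝔼 n g → ∃ λ x → f x ≤ g x
    𝔼≤⇒∃≤ zero    f g p = [] , p
    𝔼≤⇒∃≤ (suc n) f g p with 𝔼 n (f ∘ (true ∷_)) ≤? 𝔼 n (g ∘ (true ∷_))
                           | 𝔼 n (f ∘ (false ∷_)) ≤? 𝔼 n (g ∘ (false ∷_))
    ... | yes q | _     = let x , r = 𝔼≤⇒∃≤ n _ _ q in true ∷ x , r
    ... | no _  | yes q = let x , r = 𝔼≤⇒∃≤ n _ _ q in false ∷ x , r
    ... | no q  | no r  = contradiction p
          (<⇒≱ (+-mono-<-≤ (*-monoʳ-< a (≰⇒> q)) (*-monoʳ-≤ c (<⇒≤ (≰⇒> r)))))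

    -- The indicator of `p` ⊆ `x`, valued in ℕ so that it can be averaged and summed.
    within : Subset n → Subset n → ℕ
    within []          []          = 1
    within (false ∷ p) (_ ∷ x)     = within p x
    within (true ∷ p)  (false ∷ x) = 0
    within (true ∷ p)  (true ∷ x)  = within p x

    -- Independence gives the inclusion probability (a/b)^∣p∣, at most (a/b)^k; both denominators
    -- are cleared.
    𝔼-within : (p : Subset n) → k ≤ ∣ p ∣ → 𝔼 n (within p) * b ^ k ≤ a ^ k * b ^ n
    𝔼-within {k = zero}  []          _       = ≤-refl
    𝔼-within {n = suc n} {k} (false ∷ p) q   = begin
      (a * e + c * e) * b ^ k   ≡⟨ expand a c e (b ^ k) ⟩
      b * (e * b ^ k)           ≤⟨ *-monoʳ-≤ b (𝔼-within p q) ⟩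
      b * (a ^ k * b ^ n)       ≡⟨ swap b (a ^ k) (b ^ n) ⟩
      a ^ k * (b * b ^ n)       ∎
      where
      open ≤-Reasoning
      e = 𝔼 n (within p)
      expand : ∀ a c e p → (a * e + c * e) * p ≡ (a + c) * (e * p)
      expand = solve-∀
      swap : ∀ a b c → a * (b * c) ≡ b * (a * c)
      swap = solve-∀
    𝔼-within {n = suc n} {zero} (true ∷ p) _ = begin
      (a * e + c * 𝔼 n (λ _ → 0)) * 1   ≡⟨ cong (λ u → (a * e + c * u) * 1) (𝔼-const n 0) ⟩
      (a * e + c * 0) * 1               ≡⟨ expand a c e ⟩
      a * (e * 1)                       ≤⟨ *-mono-≤ (m≤m+n a c) (𝔼-within p z≤n) ⟩
      b * (1 * b ^ n)                   ≡⟨ swap b (b ^ n) ⟩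
      1 * (b * b ^ n)                   ∎
      where
      open ≤-Reasoning
      e = 𝔼 n (within p)
      expand : ∀ a c e → (a * e + c * 0) * 1 ≡ a * (e * 1)
      expand = solve-∀
      swap : ∀ b p → b * (1 * p) ≡ 1 * (b * p)
      swap = solve-∀
    𝔼-within {n = suc n} {suc k} (true ∷ p) (s≤s q) = begin
      (a * e + c * 𝔼 n (λ _ → 0)) * (b * b ^ k)   ≡⟨ cong (λ u → (a * e + c * u) * (b * b ^ k)) (𝔼-const n 0) ⟩
      (a * e + c * 0) * (b * b ^ k)               ≡⟨ expand a c e b (b ^ k) ⟩
      a * b * (e * b ^ k)                         ≤⟨ *-monoʳ-≤ (a * b) (𝔼-within p q) ⟩
      a * b * (a ^ k * b ^ n)                     ≡⟨ swap a b (a ^ k) (b ^ n) ⟩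
      a * a ^ k * (b * b ^ n)                     ∎
      where
      open ≤-Reasoning
      e = 𝔼 n (within p)
      expand : ∀ a c e b p → (a * e + c * 0) * (b * p) ≡ a * b * (e * p)
      expand = solve-∀
      swap : ∀ a b p q → a * b * (p * q) ≡ a * p * (b * q)
      swap = solve-∀

    hits : List (Subset n) → Subset n → ℕ
    hits ps x = sum (map (λ p → within p x) ps)

    𝔼-hits : (ps : List (Subset n)) → (∀ {p} → p ∈ ps → k ≤ ∣ p ∣) →
             𝔼 n (hits ps) * b ^ k ≤ length ps * (a ^ k * b ^ n)
    𝔼-hits {n} {k} [] _ = ≤-reflexive (cong (_* b ^ k) (𝔼-const n 0))
    𝔼-hits {n} {k} (p ∷ ps) large = begin
      𝔼 n (hits (p ∷ ps)) * b ^ k                         ≡⟨ cong (_* b ^ k) (𝔼-+ n (within p) (hits ps)) ⟩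
      (𝔼 n (within p) + 𝔼 n (hits ps)) * b ^ k            ≡⟨ *-distribʳ-+ (b ^ k) (𝔼 n (within p)) _ ⟩
      𝔼 n (within p) * b ^ k + 𝔼 n (hits ps) * b ^ k
        ≤⟨ +-mono-≤ (𝔼-within p (large (here refl))) (𝔼-hits ps (large ∘ there)) ⟩
      suc (length ps) * (a ^ k * b ^ n)                   ∎
      where open ≤-Reasoning

    within≤hits : {p : Subset n} {ps : List (Subset n)} (x : Subset n) → p ∈ ps → within p x ≤ hits ps x
    within≤hits x (here refl)  = m≤m+n _ _
    within≤hits x (there p∈ps) = ≤-trans (within≤hits x p∈ps) (m≤n+m _ _)

    within≡1 : (p x : Subset n) → (∀ e → lookup p e ≡ true → lookup x e ≡ true) → within p x ≡ 1
    within≡1 []          []          _   = refl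
    within≡1 (false ∷ p) (_ ∷ x)     p⊆x = within≡1 p x (p⊆x ∘ suc)
    within≡1 (true ∷ p)  (true ∷ x)  p⊆x = within≡1 p x (p⊆x ∘ suc)
    within≡1 (true ∷ p)  (false ∷ x) p⊆x with () ← p⊆x zero refl

    -- The factor n on the hits makes a single hit outweigh the n elements of x.
    first-moment : ∀ n .{{_ : NonZero n}} .{{_ : NonZero a}} R (ps : List (Subset n)) →
      (∀ {p} → p ∈ ps → k ≤ ∣ p ∣) → R * (length ps * a ^ k) ≤ b ^ k → b < a * R →
      ∃ λ x → hits ps x ≡ 0 × n * (a * R) ≤ R * b * ∣ x ∣ + n * b
    first-moment {k} n R ps large few b<aR = x , no-hits (hits ps x) refl , ≤-trans (m≤n+m _ _) fx≤gx
      where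
      f g : Subset n → ℕ
      f x = R * b * n * hits ps x + n * (a * R)
      g x = R * b * ∣ x ∣ + n * b
      instance
        b≢0 : NonZero b
        b≢0 = >-nonZero (<-≤-trans (>-nonZero⁻¹ a) (m≤m+n a c))
        bᵏ≢0 : NonZero (b ^ k)
        bᵏ≢0 = m^n≢0 b k
      -- In normalised form: the hypothesis `few` makes the expected number of hits at most 1/R.
      R𝔼≤ : R * 𝔼 n (hits ps) ≤ b ^ n
      R𝔼≤ = *-cancelʳ-≤ _ _ (b ^ k) (begin
        R * 𝔼 n (hits ps) * b ^ k              ≡⟨ *-assoc R _ _ ⟩
        R * (𝔼 n (hits ps) * b ^ k)            ≤⟨ *-monoʳ-≤ R (𝔼-hits ps large) ⟩
        R * (length ps * (a ^ k * b ^ n))      ≡⟨ assoc R (length ps) (a ^ k) (b ^ n) ⟩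
        R * (length ps * a ^ k) * b ^ n        ≤⟨ *-monoˡ-≤ (b ^ n) few ⟩
        b ^ k * b ^ n                          ≡⟨ *-comm (b ^ k) (b ^ n) ⟩
        b ^ n * b ^ k                          ∎)
        where
        open ≤-Reasoning
        assoc : ∀ r l p q → r * (l * (p * q)) ≡ r * (l * p) * q
        assoc = solve-∀
      𝔼f≤𝔼g : 𝔼 n f ≤ 𝔼 n g
      𝔼f≤𝔼g = begin
        𝔼 n f                                          ≡⟨ 𝔼-+ n (λ x → R * b * n * hits ps x) (λ _ → n * (a * R)) ⟩
        𝔼 n (λ x → R * b * n * hits ps x) + 𝔼 n (λ _ → n * (a * R))
          ≡⟨ cong₂ _+_ (𝔼-* n (R * b * n) (hits ps)) (𝔼-const n (n * (a * R))) ⟩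
        R * b * n * 𝔼 n (hits ps) + n * (a * R) * b ^ n
          ≡⟨ rearrange R b n (𝔼 n (hits ps)) a (b ^ n) ⟩
        n * b * (R * 𝔼 n (hits ps)) + R * (n * a * b ^ n)
          ≤⟨ +-monoˡ-≤ _ (*-monoʳ-≤ (n * b) R𝔼≤) ⟩
        n * b * b ^ n + R * (n * a * b ^ n)            ≡⟨ cong (λ u → n * b * b ^ n + R * u) (𝔼-card n) ⟨
        n * b * b ^ n + R * (b * 𝔼 n ∣_∣)              ≡⟨ swap R b (𝔼 n ∣_∣) (n * b * b ^ n) ⟩
        R * b * 𝔼 n ∣_∣ + n * b * b ^ n
          ≡⟨ cong₂ _+_ (𝔼-* n (R * b) ∣_∣) (𝔼-const n (n * b)) ⟨
        𝔼 n (λ x → R * b * ∣ x ∣) + 𝔼 n (λ _ → n * b)  ≡⟨ 𝔼-+ n (λ x → R * b * ∣ x ∣) (λ _ → n * b) ⟨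
        𝔼 n g                                          ∎
        where
        open ≤-Reasoning
        rearrange : ∀ r b n h a p → r * b * n * h + n * (a * r) * p ≡ n * b * (r * h) + r * (n * a * p)
        rearrange = solve-∀
        swap : ∀ r b e z → z + r * (b * e) ≡ r * b * e + z
        swap = solve-∀
      found = 𝔼≤⇒∃≤ n f g 𝔼f≤𝔼g
      x = proj₁ found
      fx≤gx = proj₂ found
      no-hits : ∀ h → hits ps x ≡ h → h ≡ 0
      no-hits zero    _  = refl
      no-hits (suc h) eq = contradiction naR≤nb (<⇒≱ (*-monoʳ-< n b<aR))
        where
        open ≤-Reasoning
        naR≤nb : n * (a * R) ≤ n * b
        naR≤nb = +-cancelˡ-≤ (R * b * n) _ _ (begin
          R * b * n + n * (a * R)                  ≤⟨ +-monoˡ-≤ _ (m≤m*n (R * b * n) (suc h)) ⟩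
          R * b * n * suc h + n * (a * R)          ≡⟨ cong (λ u → R * b * n * u + n * (a * R)) eq ⟨
          f x                                      ≤⟨ fx≤gx ⟩
          R * b * ∣ x ∣ + n * b                    ≤⟨ +-monoˡ-≤ (n * b) (*-monoʳ-≤ (R * b) (∣p∣≤n x)) ⟩
          R * b * n + n * b                        ∎)

  injection⇒≤∣∣ : ∀ k (f : Fin k → Fin n) (p : Subset n) → Injective _≡_ _≡_ f →
                  (∀ i → f i Subset.∈ p) → k ≤ ∣ p ∣
  injection⇒≤∣∣ zero    f p inj f∈p = z≤n
  injection⇒≤∣∣ (suc k) f p inj f∈p = <-≤-trans
    (s≤s (injection⇒≤∣∣ k (f ∘ suc) (p - f zero) (Fin.suc-injective ∘ inj)
      (λ i → x∈p∧x≢y⇒x∈p-y (f∈p (suc i)) λ eq → Fin.0≢1+n (sym (inj eq)))))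
    (x∈p⇒∣p-x∣<∣p∣ (f∈p zero))

  module _ (n t : ℕ) where

    private
      left : Fin t → Fin (t + t)
      left i = i ↑ˡ t
      right : Fin t → Fin (t + t)
      right j = t ↑ʳ j

    Joins : Vec (Fin n) (t + t) → Fin (slots n) → Fin t → Fin t → Set
    Joins v e i j = slot (lookup v (left i)) (lookup v (right j)) ≡ just e

    joined? : ∀ v e → Dec (∃ λ i → ∃ λ j → Joins v e i j)
    joined? v e = Fin.any? λ i → Fin.any? λ j → ≡-dec Fin._≟_ _ (just e)

    edges : Vec (Fin n) (t + t) → Subset (slots n)
    edges v = tabulate λ e → does (joined? v e)

    Distinct : Vec (Fin n) (t + t) → Set
    Distinct v = ∀ x y → lookup v x ≡ lookup v y → x ≡ y

    distinct? : ∀ v → Dec (Distinct v)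
    distinct? v = Fin.all? λ x → Fin.all? λ y → (lookup v x Fin.≟ lookup v y) →-dec (x Fin.≟ y)

    -- Edge sets are indexed by ordered tuples of distinct vertices, so one copy may be listed
    -- repeatedly; this keeps the bound n^(2t) on their number immediate.
    copies : List (Subset (slots n))
    copies = map edges (filter distinct? (vecs (allFin n) (t + t)))

    length-copies : length copies ≤ n ^ (t + t)
    length-copies = begin
      length copies                                        ≡⟨ length-map edges (filter distinct? (vecs (allFin n) (t + t))) ⟩
      length (filter distinct? (vecs (allFin n) (t + t)))  ≤⟨ length-filter distinct? (vecs (allFin n) (t + t)) ⟩
      length (vecs (allFin n) (t + t))                     ≡⟨ length-vecs (allFin n) (t + t) ⟩
      length (allFin n) ^ (t + t)                          ≡⟨ cong (_^ (t + t)) (length-tabulate {n = n} (λ i → i)) ⟩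
      n ^ (t + t)                                          ∎
      where open ≤-Reasoning

    -- The `t * t` pairs of a left and a right vertex occupy distinct slots: equal slots mean equal
    -- unordered pairs, and a crosswise match would identify a left vertex with a right one.
    edges-large : ∀ v → Distinct v → t * t ≤ ∣ edges v ∣
    edges-large v distinct = injection⇒≤∣∣ (t * t) edge (edges v) edge-injective
      (λ x → lookup⇒[]= _ (edges v) (trans (lookup∘tabulate _ (edge x))
        (dec-true (joined? v (edge x)) (i x , j x , proj₂ (slot′ x)))))
      where
      i : Fin (t * t) → Fin t
      i x = proj₁ (remQuot {t} t x)
      j : Fin (t * t) → Fin t
      j x = proj₂ (remQuot {t} t x)
      disjoint : ∀ i j → lookup v (left i) ≢ lookup v (right j)
      disjoint i j eq = ↑ˡ≢↑ʳ i j (distinct _ _ eq)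
      slot′ : ∀ x → ∃ λ e → slot (lookup v (left (i x))) (lookup v (right (j x))) ≡ just e
      slot′ x = slot-≢ _ _ (disjoint (i x) (j x))
      edge : Fin (t * t) → Fin (slots n)
      edge x = proj₁ (slot′ x)
      edge-injective : Injective _≡_ _≡_ edge
      edge-injective {x} {y} eq
        with slot-injective (disjoint (i x) (j x))
               (trans (proj₂ (slot′ x)) (trans (cong just eq) (sym (proj₂ (slot′ y)))))
      ... | inj₁ (p , q) = trans (sym (Fin.combine-remQuot {t} t x))
            (trans (cong₂ combine (Fin.↑ˡ-injective t _ _ (distinct _ _ p))
                                  (Fin.↑ʳ-injective t _ _ (distinct _ _ q)))
                   (Fin.combine-remQuot {t} t y))
      ... | inj₂ (p , _) = contradiction p (disjoint (i x) (j y))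

    copies-large : ∀ {p} → p ∈ copies → t * t ≤ ∣ p ∣
    copies-large p∈ with v , v∈ , refl ← ∈-map⁻ edges p∈ =
      edges-large v (proj₂ (∈-filter⁻ distinct? {xs = vecs (allFin n) (t + t)} v∈))

    contains⇒copy : ∀ x → fromBits {n} x Contains K t t →
      ∃ λ p → p ∈ copies × (∀ e → lookup p e ≡ true → lookup x e ≡ true)
    contains⇒copy x (f , f-inj , f-edge) = edges v ,
      ∈-map⁺ edges (∈-filter⁺ distinct? (∈-vecs v λ i → ∈-allFin _) v-distinct) , edges⊆x
      where
      v = tabulate f
      v-distinct : Distinct v
      v-distinct y z eq = f-inj (trans (sym (lookup∘tabulate f y)) (trans eq (lookup∘tabulate f z)))
      edges⊆x : ∀ e → lookup (edges v) e ≡ true → lookup x e ≡ true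
      edges⊆x e eq with joined? v e | trans (sym (lookup∘tabulate _ e)) eq
      ... | yes (i , j , s) | _ = T⇒≡true (subst T
            (cong (maybe (lookup x) false)
              (trans (cong₂ slot (sym (lookup∘tabulate f (left i))) (sym (lookup∘tabulate f (right j)))) s))
            (f-edge (left i) (right j) (subst T (sym (K-adj {t} {t} i j)) _)))
        where
        T⇒≡true : ∀ {b} → T b → b ≡ true
        T⇒≡true {true} _ = refl

  -- With b = a + c, the first hypothesis bounds the expected number of copies by 1/R, and the
  -- conclusion reads ∣F∣ ≥ (a/b - 1/R) `slots n`.
  random-K-free : ∀ n t a c R .{{_ : NonZero (slots n)}} .{{_ : NonZero a}} →
    R * (n ^ (t + t) * a ^ (t * t)) ≤ (a + c) ^ (t * t) → a + c < a * R →
    ∃ λ F → ¬ (fromBits {n} F Contains K t t) ×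
      slots n * (a * R) ≤ R * (a + c) * ∣ F ∣ + slots n * (a + c)
  random-K-free n t a c R few b<aR
    = F , free , proj₂ (proj₂ found)
    where
    open Expectation a c
    found = first-moment (slots n) R (copies n t) (copies-large n t)
      (≤-trans (*-monoʳ-≤ R (*-monoˡ-≤ (a ^ (t * t)) (length-copies n t))) few) b<aR
    F = proj₁ found
    free : ¬ (fromBits {n} F Contains K t t)
    free contains = contradiction 1≤0 λ ()
      where
      copy = contains⇒copy n t F contains
      open ≤-Reasoning
      1≤0 : 1 ≤ 0
      1≤0 = begin
        1                        ≡⟨ within≡1 (proj₁ copy) F (proj₂ (proj₂ copy)) ⟨
        within (proj₁ copy) F    ≤⟨ within≤hits F (proj₁ (proj₂ copy)) ⟩
        hits (copies n t) F      ≡⟨ proj₁ (proj₂ found) ⟩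
        0                        ∎

-- Choice of parameters and explicit bounds in natural numbers

module Bounds where

  open import Data.Fin.Subset using (∣_∣)
  open import Data.Fin.Subset.Properties using (∣p∣≤n)
  open import Data.List.Base using (length)
  open import Data.Nat.Base
  open import Data.Nat.DivMod using (m≡m%n+[m/n]*n; m%n<n; m/n*n≤m)
  open import Data.Nat.Properties
  open import Data.Nat.Tactic.RingSolver using (solve-∀)
  open import Data.Product.Base using (∃; _×_; _,_; proj₁; proj₂)
  open import Relation.Binary.PropositionalEquality
  open import Relation.Nullary using (yes; no; contradiction)

  open import Defs using (K; M)
  open Counting
  open GraphCoding
  open Covering
  open Packing

  ^-distribʳ-* : ∀ m n o → (m * n) ^ o ≡ m ^ o * n ^ o
  ^-distribʳ-* m n zero    = refl
  ^-distribʳ-* m n (suc o) = trans (cong (m * n *_) (^-distribʳ-* m n o)) (swap m n (m ^ o) (n ^ o))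
    where
    swap : ∀ a b c d → a * b * (c * d) ≡ a * c * (b * d)
    swap = solve-∀

  ^-cancelʳ-≤ : ∀ m n o → .{{NonZero o}} → m ^ o ≤ n ^ o → m ≤ n
  ^-cancelʳ-≤ m n o p = ≮⇒≥ λ n<m → <⇒≱ (^-monoˡ-< o n<m) p

  ^-cancelʳ-< : ∀ m n o → m ^ o < n ^ o → m < n
  ^-cancelʳ-< m n o p = ≰⇒> λ n≤m → <⇒≱ p (^-monoˡ-≤ o n≤m)

  ^-cancelˡ-< : ∀ m n o → .{{NonZero m}} → m ^ n < m ^ o → n < o
  ^-cancelˡ-< m n o p = ≰⇒> λ o≤n → <⇒≱ p (^-monoʳ-≤ m o≤n)

  n<2^n : ∀ n → n < 2 ^ n
  n<2^n zero    = s≤s z≤n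
  n<2^n (suc n) = begin-strict
    suc n           ≤⟨ n<2^n n ⟩
    2 ^ n           <⟨ m<m+n (2 ^ n) (m^n>0 2 n) ⟩
    2 ^ n + 2 ^ n   ≡⟨ cong (2 ^ n +_) (+-identityʳ (2 ^ n)) ⟨
    2 * 2 ^ n       ∎
    where open ≤-Reasoning

  module _ (k : ℕ) where

    -- (1 - 1/(k+1))^i ≥ 1 - i/(k+1), with r = k + 1 - i.
    bernoulli⁻ : ∀ i r → i + r ≡ suc k → suc k ^ i * r ≤ suc k * k ^ i
    bernoulli⁻ zero    r refl = ≤-reflexive (*-comm 1 r)
    bernoulli⁻ (suc i) r eq   = begin
      suc k * suc k ^ i * r          ≡⟨ rearrange k (suc k ^ i) r ⟩
      suc k ^ i * (k * r + r)        ≤⟨ *-monoʳ-≤ (suc k ^ i) (+-monoʳ-≤ (k * r) r≤k) ⟩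
      suc k ^ i * (k * r + k)        ≡⟨ rearrange′ k (suc k ^ i) r ⟩
      k * (suc k ^ i * suc r)        ≤⟨ *-monoʳ-≤ k (bernoulli⁻ i (suc r) (trans (+-suc i r) eq)) ⟩
      k * (suc k * k ^ i)            ≡⟨ swap k (suc k) (k ^ i) ⟩
      suc k * (k * k ^ i)            ∎
      where
      open ≤-Reasoning
      r≤k : r ≤ k
      r≤k = ≤-trans (m≤n+m r i) (≤-reflexive (suc-injective eq))
      rearrange : ∀ k p r → suc k * p * r ≡ p * (k * r + r)
      rearrange = solve-∀
      rearrange′ : ∀ k p r → p * (k * r + k) ≡ k * (p * suc r)
      rearrange′ = solve-∀
      swap : ∀ a b c → a * (b * c) ≡ b * (a * c)
      swap = solve-∀

    -- Bernoulli's inequality at half the denominator: (1 - 1/(2j))^j ≥ 1/2.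
    decay : ∀ j .{{_ : NonZero j}} → j + j ≡ suc k → suc k ^ j ≤ 2 * k ^ j
    decay j eq = *-cancelʳ-≤ _ _ j (begin
      suc k ^ j * j      ≤⟨ bernoulli⁻ j j eq ⟩
      suc k * k ^ j      ≡⟨ cong (_* k ^ j) eq ⟨
      (j + j) * k ^ j    ≡⟨ double j (k ^ j) ⟩
      2 * k ^ j * j      ∎)
      where
      open ≤-Reasoning
      double : ∀ j p → (j + j) * p ≡ 2 * p * j
      double = solve-∀

    -- Bernoulli's inequality (1 + 1/k)^i ≥ 1 + i/k with denominators cleared.
    bernoulli⁺ : ∀ i → k ^ i * (k + i) ≤ k * suc k ^ i
    bernoulli⁺ zero    = ≤-reflexive (identity k)
      where
      identity : ∀ k → 1 * (k + 0) ≡ k * 1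
      identity = solve-∀
    bernoulli⁺ (suc i) = begin
      k * k ^ i * (k + suc i)                ≤⟨ m≤m+n _ (k ^ i * i) ⟩
      k * k ^ i * (k + suc i) + k ^ i * i    ≡⟨ factor k (k ^ i) i ⟩
      suc k * (k ^ i * (k + i))              ≤⟨ *-monoʳ-≤ (suc k) (bernoulli⁺ i) ⟩
      suc k * (k * suc k ^ i)                ≡⟨ swap k (suc k) (suc k ^ i) ⟩
      k * (suc k * suc k ^ i)                ∎
      where
      open ≤-Reasoning
      factor : ∀ k p i → k * p * (k + suc i) + p * i ≡ suc k * (p * (k + i))
      factor = solve-∀
      swap : ∀ a b c → b * (a * c) ≡ a * (b * c)
      swap = solve-∀

    growth : .{{NonZero k}} → 2 * k ^ k ≤ suc k ^ k
    growth = *-cancelˡ-≤ k (begin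
      k * (2 * k ^ k)      ≡⟨ double k (k ^ k) ⟩
      k ^ k * (k + k)      ≤⟨ bernoulli⁺ k ⟩
      k * suc k ^ k        ∎)
      where
      open ≤-Reasoning
      double : ∀ k p → k * (2 * p) ≡ p * (k + k)
      double = solve-∀

    -- Every `k` factors 1 + 1/k contribute at least a factor 2. This is how a fixed ratio below 1
    -- overcomes any fixed power of 2.
    growth-^ : .{{NonZero k}} → ∀ i t → k * i ≤ t → 2 ^ i * k ^ t ≤ suc k ^ t
    growth-^ i t ki≤t = begin
      2 ^ i * k ^ t                                ≡⟨ cong (λ u → 2 ^ i * k ^ u) split ⟨
      2 ^ i * k ^ (k * i + r)                      ≡⟨ cong (2 ^ i *_) (^-distribˡ-+-* k (k * i) r) ⟩
      2 ^ i * (k ^ (k * i) * k ^ r)                ≡⟨ *-assoc (2 ^ i) _ _ ⟨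
      2 ^ i * k ^ (k * i) * k ^ r                  ≡⟨ cong (λ u → 2 ^ i * u * k ^ r) (^-*-assoc k k i) ⟨
      2 ^ i * (k ^ k) ^ i * k ^ r                  ≡⟨ cong (_* k ^ r) (^-distribʳ-* 2 (k ^ k) i) ⟨
      (2 * k ^ k) ^ i * k ^ r                      ≤⟨ *-mono-≤ (^-monoˡ-≤ i growth) (^-monoˡ-≤ r (n≤1+n k)) ⟩
      (suc k ^ k) ^ i * suc k ^ r                  ≡⟨ cong (_* suc k ^ r) (^-*-assoc (suc k) k i) ⟩
      suc k ^ (k * i) * suc k ^ r                  ≡⟨ ^-distribˡ-+-* (suc k) (k * i) r ⟨
      suc k ^ (k * i + r)                          ≡⟨ cong (suc k ^_) split ⟩
      suc k ^ t                                    ∎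
      where
      open ≤-Reasoning
      r = t ∸ k * i
      split : k * i + r ≡ t
      split = m+[n∸m]≡n ki≤t

  -- With k + 1 = 2j = 2^a the bound on light words is 2^(a t + u) for length s = j u.
  length-light-≤ : ∀ a t u → let j = 2 ^ a in
                   length (light t (j * u)) ≤ 2 ^ (suc a * t + u)
  length-light-≤ a t u = *-cancelʳ-≤ _ _ (k ^ (j * u)) (begin
    length (light t (j * u)) * k ^ (j * u)        ≤⟨ length-light k t (j * u) ⟩
    k ^ t * suc k ^ (j * u)                       ≡⟨ cong (k ^ t *_) (^-*-assoc (suc k) j u) ⟨
    k ^ t * (suc k ^ j) ^ u
      ≤⟨ *-mono-≤ (^-monoˡ-≤ t k≤2^a) (^-monoˡ-≤ u (decay k j (sym k+1≡2j))) ⟩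
    (2 ^ suc a) ^ t * (2 * k ^ j) ^ u
      ≡⟨ cong₂ _*_ (^-*-assoc 2 (suc a) t)
           (trans (^-distribʳ-* 2 (k ^ j) u) (cong (2 ^ u *_) (^-*-assoc k j u))) ⟩
    2 ^ (suc a * t) * (2 ^ u * k ^ (j * u))       ≡⟨ *-assoc (2 ^ (suc a * t)) _ _ ⟨
    2 ^ (suc a * t) * 2 ^ u * k ^ (j * u)
      ≡⟨ cong (_* k ^ (j * u)) (^-distribˡ-+-* 2 (suc a * t) u) ⟨
    2 ^ (suc a * t + u) * k ^ (j * u)             ∎)
    where
    open ≤-Reasoning
    j = 2 ^ a
    k = pred (j + j)
    instance
      j≢0 : NonZero j
      j≢0 = m^n≢0 2 a
      2j≢0 : NonZero (j + j)
      2j≢0 = >-nonZero (≤-trans (m^n>0 2 a) (m≤m+n j j))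
    k+1≡2j : suc k ≡ j + j
    k+1≡2j = suc-pred (j + j)
    instance
      k≢0 : NonZero k
      k≢0 = >-nonZero (s≤s⁻¹ (≤-trans (+-mono-≤ (m^n>0 2 a) (m^n>0 2 a)) (≤-reflexive (sym k+1≡2j))))
      kᵘ≢0 : NonZero (k ^ (j * u))
      kᵘ≢0 = m^n≢0 k (j * u)
    k≤2^a : k ≤ 2 ^ suc a
    k≤2^a = ≤-trans (n≤1+n k) (≤-reflexive (trans k+1≡2j (cong (j +_) (sym (+-identityʳ j)))))

  bracket : ∀ B → 1 < B → ∀ n → 0 < n → ∃ λ u → B ^ u ≤ n × n < B ^ suc u
  bracket B 1<B (suc zero)    _ = 0 , ≤-refl , ≤-trans 1<B (≤-reflexive (sym (*-identityʳ B)))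
  bracket B 1<B (suc (suc n)) _ with bracket B 1<B (suc n) (s≤s z≤n)
  ... | u , low , high with suc (suc n) <? B ^ suc u
  ... | yes p = u , m≤n⇒m≤1+n low , p
  ... | no ¬p = suc u , ≮⇒≥ ¬p , ≤-<-trans high (^-monoʳ-< B 1<B {suc u} ≤-refl)

  exceptional-bound : ∀ a t u n q → let s = 2 ^ a * u in
    (suc (length (light t s)) ^ n * (2 ^ s) ^ (2 ^ s * t)) ^ q ≤
    2 ^ ((suc (suc a * t + u) * n + s * (2 ^ s * t)) * q)
  exceptional-bound a t u n q = begin
    (suc L ^ n * (2 ^ s) ^ h) ^ q
      ≤⟨ ^-monoˡ-≤ q (*-monoˡ-≤ ((2 ^ s) ^ h) (^-monoˡ-≤ n sucL≤)) ⟩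
    ((2 ^ x) ^ n * (2 ^ s) ^ h) ^ q
      ≡⟨ cong (_^ q) (cong₂ _*_ (^-*-assoc 2 x n) (^-*-assoc 2 s h)) ⟩
    (2 ^ (x * n) * 2 ^ (s * h)) ^ q       ≡⟨ cong (_^ q) (^-distribˡ-+-* 2 (x * n) (s * h)) ⟨
    (2 ^ (x * n + s * h)) ^ q             ≡⟨ ^-*-assoc 2 (x * n + s * h) q ⟩
    2 ^ ((x * n + s * h) * q)             ∎
    where
    open ≤-Reasoning
    s = 2 ^ a * u
    h = 2 ^ s * t
    L = length (light t s)
    x = suc (suc a * t + u)
    -- The outer `suc` in `x` doubles the power, which absorbs the extra symbol counted by `suc L`.
    sucL≤ : suc L ≤ 2 ^ x
    sucL≤ = ≤-trans (+-mono-≤ (m^n>0 2 (suc a * t + u)) (length-light-≤ a t u))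
              (≤-reflexive (cong (2 ^ (suc a * t + u) +_) (sym (+-identityʳ _))))

  -- Blocks of s = j u columns with 2^(4s) ≤ n < 2^(4(s+j)); then t is at most a small multiple of s.
  module LowerBound (e : ℕ) .{{_ : NonZero e}} where

    private
      -- The target is `z` ≤ n^2/e. Two error terms of at most 2n^2/d each give `d` = 4e. One of
      -- them splits into three parts, which requires 3d ≤ `j`; `a` = 3d achieves this because 3d <
      -- 2^(3d).
      d a j B : ℕ
      d = 4 * e
      a = 3 * d
      j = 2 ^ a
      B = 2 ^ (4 * j)

    -- The factor 8 in `slope` pays for log n < 4j(u + 1) ≤ 8ju = 8s; the rest is the multiple of
    -- `t` that has to fit below `s`. Starting at `B` makes `u` positive.
    slope threshold : ℕ
    slope = 8 * (3 * d * suc a)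
    threshold = B

    private
      instance
        d≢0 : NonZero d
        d≢0 = m*n≢0 4 e
        j≢0 : NonZero j
        j≢0 = m^n≢0 2 a

      1<B : 1 < B
      1<B = ^-monoʳ-< 2 (s≤s (s≤s z≤n)) {0} (≤-trans (m^n>0 2 a) (m≤m+n j _))

    module _ (n t : ℕ) (B≤n : threshold ≤ n) (2^Kt≤n : 2 ^ (slope * t) ≤ n) where

      private
        br : ∃ λ u → B ^ u ≤ n × n < B ^ suc u
        br = bracket B 1<B n (≤-trans (<⇒≤ 1<B) B≤n)
        u s W q x z : ℕ
        u = proj₁ br
        s = j * u
        W = 2 ^ s
        x = suc (suc a * t + u)

        u≢0 : u ≢ 0
        u≢0 u≡0 = <⇒≱ (subst (λ v → n < B ^ suc v) u≡0 (proj₂ (proj₂ br)))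
                      (≤-trans (≤-reflexive (*-identityʳ B)) B≤n)

        instance
          u-nonZero : NonZero u
          u-nonZero = ≢-nonZero u≢0
          s-nonZero : NonZero s
          s-nonZero = m*n≢0 j u
          W-nonZero : NonZero W
          W-nonZero = m^n≢0 2 s

        q = suc (n / s)
        z = (x * n + s * (W * t)) * q

        W⁴≤n : W * W * (W * W) ≤ n
        W⁴≤n = begin
          W * W * (W * W)      ≡⟨ fourth W ⟩
          W ^ 4                ≡⟨ ^-*-assoc 2 s 4 ⟩
          2 ^ (j * u * 4)      ≡⟨ cong (2 ^_) (swap j u) ⟩
          2 ^ (4 * j * u)      ≡⟨ ^-*-assoc 2 (4 * j) u ⟨
          B ^ u                ≤⟨ proj₁ (proj₂ br) ⟩
          n                    ∎
          where
          open ≤-Reasoning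
          fourth : ∀ w → w * w * (w * w) ≡ w * (w * (w * (w * 1)))
          fourth = solve-∀
          swap : ∀ j u → j * u * 4 ≡ 4 * j * u
          swap = solve-∀

        s≤W : s ≤ W
        s≤W = <⇒≤ (n<2^n s)

        d≤s : d ≤ s
        d≤s = begin
          d      ≤⟨ m≤n*m d 3 ⟩
          3 * d  ≤⟨ <⇒≤ (n<2^n a) ⟩
          j      ≤⟨ m≤m*n j u ⟩
          s      ∎
          where open ≤-Reasoning

        s≤n : s ≤ n
        s≤n = ≤-trans s≤W (≤-trans (m≤m*n W W) (≤-trans (m≤m*n (W * W) (W * W) {{m*n≢0 W W}}) W⁴≤n))

        n≤qs : n ≤ q * s
        n≤qs = begin
          n                      ≡⟨ m≡m%n+[m/n]*n n s ⟩
          n % s + n / s * s      ≤⟨ +-monoˡ-≤ _ (<⇒≤ (m%n<n n s)) ⟩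
          q * s                  ∎
          where open ≤-Reasoning

        qs≤2n : q * s ≤ n + n
        qs≤2n = +-mono-≤ s≤n (m/n*n≤m n s)

        3dat≤s : 3 * d * suc a * t ≤ s
        3dat≤s = *-cancelˡ-≤ 8 (<⇒≤ (begin-strict
          8 * (3 * d * suc a * t)      ≡⟨ *-assoc 8 (3 * d * suc a) t ⟨
          slope * t                    <⟨ ^-cancelˡ-< 2 (slope * t) (4 * j * suc u)
            (≤-<-trans 2^Kt≤n (<-≤-trans (proj₂ (proj₂ br)) (≤-reflexive (^-*-assoc 2 (4 * j) (suc u))))) ⟩
          4 * j * suc u                ≤⟨ *-monoʳ-≤ (4 * j) (+-monoˡ-≤ u (>-nonZero⁻¹ u)) ⟩
          4 * j * (u + u)              ≡⟨ double j u ⟩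
          8 * (j * u)                  ∎))
          where
          open ≤-Reasoning
          double : ∀ j u → 4 * j * (u + u) ≡ 8 * (j * u)
          double = solve-∀

        -- The summands (a + 1)t, u and 1 of `x` are each at most s/(3d): the first by the choice of
        -- `slope`, the others because 3d ≤ `j`.
        dx≤s : d * x ≤ s
        dx≤s = *-cancelˡ-≤ 3 (begin
          3 * (d * x)                             ≡⟨ expand d a t u ⟩
          3 * d * suc a * t + 3 * d * u + 3 * d
            ≤⟨ +-mono-≤ (+-mono-≤ 3dat≤s (*-monoˡ-≤ u 3d≤j)) (≤-trans 3d≤j (m≤m*n j u)) ⟩
          s + s + s                               ≡⟨ triple s ⟩
          3 * s                                   ∎)
          where
          open ≤-Reasoning
          3d≤j : 3 * d ≤ j
          3d≤j = <⇒≤ (n<2^n a)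
          expand : ∀ d a t u → 3 * (d * suc (suc a * t + u)) ≡ 3 * d * suc a * t + 3 * d * u + 3 * d
          expand = solve-∀
          triple : ∀ s → s + s + s ≡ 3 * s
          triple = solve-∀

        t≤s : t ≤ s
        t≤s = ≤-trans (m≤n*m t (3 * d * suc a) {{m*n≢0 (3 * d) (suc a) {{m*n≢0 3 d}}}}) 3dat≤s

        -- Both `d` and `t` are at most `s`, hence at most `W`, so three of the four factors `W`
        -- that fit below n suffice.
        dWt≤n : d * (W * t) ≤ n
        dWt≤n = begin
          d * (W * t)      ≤⟨ *-mono-≤ (≤-trans d≤s s≤W) (*-monoʳ-≤ W (≤-trans t≤s s≤W)) ⟩
          W * (W * W)      ≡⟨ *-assoc W W W ⟨
          W * W * W        ≤⟨ *-monoʳ-≤ (W * W) (m≤m*n W W) ⟩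
          W * W * (W * W)  ≤⟨ W⁴≤n ⟩
          n                ∎
          where open ≤-Reasoning

      -- The exponent `z` collects the light rows and the heavy rows over all `q` blocks. Since q s
      -- ≤ 2n, each part is at most 2n^2/d = n^2/(2e).
      lower-bound : ∃ λ z → e * z ≤ n * n × 2 ^ slots n ≤ M (K t t) n * 2 ^ z
      lower-bound = z , ez≤nn , ≤-trans (covering n s q t n≤qs)
        (*-monoʳ-≤ (M (K t t) n) (exceptional-bound a t u n q))
        where
        open ≤-Reasoning
        expand : ∀ e x n s w q → 4 * (e * ((x * n + s * w) * q)) ≡ 4 * e * x * (n * q) + 4 * e * w * (q * s)
        expand = solve-∀
        collect : ∀ s n q → s * (n * q) ≡ n * (q * s)
        collect = solve-∀
        double : ∀ n → n * (n + n) + n * (n + n) ≡ 4 * (n * n)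
        double = solve-∀
        ez≤nn : e * z ≤ n * n
        ez≤nn = *-cancelˡ-≤ 4 (begin
          4 * (e * z)                                      ≡⟨ expand e x n s (W * t) q ⟩
          d * x * (n * q) + d * (W * t) * (q * s)          ≤⟨ +-mono-≤ (*-monoˡ-≤ (n * q) dx≤s) (*-mono-≤ dWt≤n qs≤2n) ⟩
          s * (n * q) + n * (n + n)                        ≡⟨ cong (_+ n * (n + n)) (collect s n q) ⟩
          n * (q * s) + n * (n + n)                        ≤⟨ +-monoˡ-≤ _ (*-monoʳ-≤ n qs≤2n) ⟩
          n * (n + n) + n * (n + n)                        ≡⟨ double n ⟩
          4 * (n * n)                                      ∎)

  -- The edge density is a/(a + c), strictly below 2^(-G/h), where G/h plays the role of an upper
  -- estimate of 2/c; 1/R is the tolerated loss of density.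
  module UpperBound (a c G h R : ℕ) .{{_ : NonZero a}} .{{_ : NonZero c}} .{{_ : NonZero h}}
    (aʰ2ᴳ<bʰ : a ^ h * 2 ^ G < (a + c) ^ h) (b<aR : a + c < a * R) where

    private
      -- As k + 1 = b^h, strictness gives a^h 2^G ≤ k. In `t₀` the term `k * suc G` lets (1 + 1/k)^t
      -- exceed 2^(G+1), and `R * h` gives R^h ≤ 2^t.
      b k t₀ : ℕ
      b = a + c
      k = pred (b ^ h)
      t₀ = k * suc G + R * h

      instance
        b≢0 : NonZero b
        b≢0 = >-nonZero (≤-trans (>-nonZero⁻¹ a) (m≤m+n a c))
        bʰ≢0 : NonZero (b ^ h)
        bʰ≢0 = m^n≢0 b h

      k+1≡bʰ : suc k ≡ b ^ h
      k+1≡bʰ = suc-pred (b ^ h)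

      aʰ2ᴳ≤k : a ^ h * 2 ^ G ≤ k
      aʰ2ᴳ≤k = s≤s⁻¹ (≤-trans aʰ2ᴳ<bʰ (≤-reflexive (sym k+1≡bʰ)))

      instance
        k≢0 : NonZero k
        k≢0 = >-nonZero (≤-trans (*-mono-≤ (m^n>0 a h) (m^n>0 2 G)) aʰ2ᴳ≤k)

    -- Since n ≤ n^(2h) < 2^((t+1)G), a large n forces `t₀` ≤ `t`. The added 2 makes `slots n`
    -- nonzero.
    threshold : ℕ
    threshold = 2 ^ (G * suc t₀) + 2

    private module _ (n t : ℕ) (large : t₀ ≤ t) (n²ʰ< : n ^ (2 * h) < 2 ^ (suc t * G)) where

      -- The h-th power removes the fraction G/h. Of the factor 2^(G+1) gathered under the outer
      -- t-th power, 2^G stems from `suc t` in place of `t` and 2 from the auxiliary 2^t on the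
      -- left; the 2^t on the right pays for R^h.
      power : (R * (n ^ (t + t) * a ^ (t * t))) ^ h * 2 ^ t ≤ (b ^ (t * t)) ^ h * 2 ^ t
      power = begin
        (R * (n ^ (t + t) * a ^ (t * t))) ^ h * 2 ^ t
          ≡⟨ cong (_* 2 ^ t) (trans (^-distribʳ-* R _ h) (cong (R ^ h *_) (^-distribʳ-* (n ^ (t + t)) _ h))) ⟩
        R ^ h * ((n ^ (t + t)) ^ h * (a ^ (t * t)) ^ h) * 2 ^ t
          ≡⟨ cong₂ (λ u v → R ^ h * (u * v) * 2 ^ t) regroup-n regroup-a ⟩
        R ^ h * ((n ^ (2 * h)) ^ t * ((a ^ h) ^ t) ^ t) * 2 ^ t
          ≤⟨ *-monoˡ-≤ (2 ^ t) (*-monoʳ-≤ (R ^ h) (*-monoˡ-≤ (((a ^ h) ^ t) ^ t) (^-monoˡ-≤ t (<⇒≤ n²ʰ<)))) ⟩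
        R ^ h * ((2 ^ (suc t * G)) ^ t * ((a ^ h) ^ t) ^ t) * 2 ^ t
          ≡⟨ cong (λ u → R ^ h * u * 2 ^ t) (^-distribʳ-* (2 ^ (suc t * G)) _ t) ⟨
        R ^ h * (2 ^ (suc t * G) * (a ^ h) ^ t) ^ t * 2 ^ t
          ≡⟨ trans (*-assoc (R ^ h) _ _) (cong (R ^ h *_) (sym (^-distribʳ-* _ 2 t))) ⟩
        R ^ h * (2 ^ (suc t * G) * (a ^ h) ^ t * 2) ^ t
          ≡⟨ cong (λ u → R ^ h * u ^ t) regroup ⟩
        R ^ h * (2 ^ suc G * (a ^ h * 2 ^ G) ^ t) ^ t
          ≤⟨ *-monoʳ-≤ (R ^ h) (^-monoˡ-≤ t (*-monoʳ-≤ (2 ^ suc G) (^-monoˡ-≤ t aʰ2ᴳ≤k))) ⟩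
        R ^ h * (2 ^ suc G * k ^ t) ^ t
          ≤⟨ *-mono-≤ Rʰ≤2ᵗ (^-monoˡ-≤ t (growth-^ k (suc G) t (≤-trans (m≤m+n _ _) large))) ⟩
        2 ^ t * (suc k ^ t) ^ t
          ≡⟨ cong (λ u → 2 ^ t * (u ^ t) ^ t) k+1≡bʰ ⟩
        2 ^ t * ((b ^ h) ^ t) ^ t
          ≡⟨ cong (2 ^ t *_) (regroup-power b) ⟨
        2 ^ t * (b ^ (t * t)) ^ h
          ≡⟨ *-comm (2 ^ t) _ ⟩
        (b ^ (t * t)) ^ h * 2 ^ t  ∎
        where
        open ≤-Reasoning
        regroup-power : ∀ x → (x ^ (t * t)) ^ h ≡ ((x ^ h) ^ t) ^ t
        regroup-power x = trans (^-*-assoc x (t * t) h) (trans (cong (x ^_) (swap t h))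
          (trans (sym (^-*-assoc x (h * t) t)) (cong (_^ t) (sym (^-*-assoc x h t)))))
          where
          swap : ∀ t h → t * t * h ≡ h * t * t
          swap = solve-∀
        regroup-a = regroup-power a
        regroup-n : (n ^ (t + t)) ^ h ≡ (n ^ (2 * h)) ^ t
        regroup-n = trans (^-*-assoc n (t + t) h) (trans (cong (n ^_) (swap t h)) (sym (^-*-assoc n (2 * h) t)))
          where
          swap : ∀ t h → (t + t) * h ≡ 2 * h * t
          swap = solve-∀
        regroup : 2 ^ (suc t * G) * (a ^ h) ^ t * 2 ≡ 2 ^ suc G * (a ^ h * 2 ^ G) ^ t
        regroup = begin-equality
          2 ^ (G + t * G) * (a ^ h) ^ t * 2
            ≡⟨ cong (λ u → u * (a ^ h) ^ t * 2)
                 (trans (^-distribˡ-+-* 2 G (t * G))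
                   (cong (2 ^ G *_) (trans (cong (2 ^_) (*-comm t G)) (sym (^-*-assoc 2 G t))))) ⟩
          2 ^ G * (2 ^ G) ^ t * (a ^ h) ^ t * 2  ≡⟨ swap (2 ^ G) ((2 ^ G) ^ t) ((a ^ h) ^ t) ⟩
          2 * 2 ^ G * ((a ^ h) ^ t * (2 ^ G) ^ t) ≡⟨ cong (2 * 2 ^ G *_) (^-distribʳ-* (a ^ h) (2 ^ G) t) ⟨
          2 * 2 ^ G * (a ^ h * 2 ^ G) ^ t         ∎
          where
          swap : ∀ g p q → g * p * q * 2 ≡ 2 * g * (q * p)
          swap = solve-∀
        Rʰ≤2ᵗ : R ^ h ≤ 2 ^ t
        Rʰ≤2ᵗ = begin
          R ^ h            ≤⟨ ^-monoˡ-≤ h (<⇒≤ (n<2^n R)) ⟩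
          (2 ^ R) ^ h      ≡⟨ ^-*-assoc 2 R h ⟩
          2 ^ (R * h)      ≤⟨ ^-monoʳ-≤ 2 (≤-trans (m≤n+m (R * h) (k * suc G)) large) ⟩
          2 ^ t            ∎

      few-copies : R * (n ^ (t + t) * a ^ (t * t)) ≤ b ^ (t * t)
      few-copies = ^-cancelʳ-≤ _ _ h (*-cancelʳ-≤ _ _ (2 ^ t) {{m^n≢0 2 t}} power)

    private
      t₀≤ : ∀ n t .{{_ : NonZero n}} → threshold ≤ n → n ^ (2 * h) < 2 ^ (suc t * G) → t₀ ≤ t
      t₀≤ n t large n²ʰ< = s≤s⁻¹ (<⇒≤ (*-cancelˡ-< G (suc t₀) (suc t) (^-cancelˡ-< 2 (G * suc t₀) (G * suc t) (begin-strict
        2 ^ (G * suc t₀)      ≤⟨ m≤m+n _ 2 ⟩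
        threshold             ≤⟨ large ⟩
        n                     ≡⟨ *-identityʳ n ⟨
        n ^ 1                 ≤⟨ ^-monoʳ-≤ n (≤-trans (>-nonZero⁻¹ h) (m≤n*m h 2)) ⟩
        n ^ (2 * h)           <⟨ n²ʰ< ⟩
        2 ^ (suc t * G)       ≡⟨ cong (2 ^_) (*-comm (suc t) G) ⟩
        2 ^ (G * suc t)       ∎))))
        where open ≤-Reasoning

    -- Here `x` is the number of pairs outside the random graph, and the inequality says x ≤ (1 +
    -- 1/R - a/(a + c)) `slots n`.
    upper-bound : ∀ n t → threshold ≤ n → n ^ (2 * h) < 2 ^ (suc t * G) →
      ∃ λ x → M (K t t) n ≤ 2 ^ x ×
        slots n * (a * R) + R * (a + c) * x ≤ R * (a + c) * slots n + slots n * (a + c)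
    upper-bound n@(suc (suc _)) t large n²ʰ< = x , *-cancelʳ-≤ _ _ (2 ^ ∣ F ∣) {{m^n≢0 2 ∣ F ∣}} M2ᶠ≤ , combine
      where
      open ≤-Reasoning
      found = random-K-free n t a c R (few-copies n t (t₀≤ n t large n²ʰ<) n²ʰ<) b<aR
      F = proj₁ found
      x = slots n ∸ ∣ F ∣
      x+F≡C : x + ∣ F ∣ ≡ slots n
      x+F≡C = m∸n+n≡m (∣p∣≤n F)
      M2ᶠ≤ : M (K t t) n * 2 ^ ∣ F ∣ ≤ 2 ^ x * 2 ^ ∣ F ∣
      M2ᶠ≤ = begin
        M (K t t) n * 2 ^ ∣ F ∣  ≤⟨ packing (K t t) n F (proj₁ (proj₂ found)) ⟩
        2 ^ slots n              ≡⟨ cong (2 ^_) x+F≡C ⟨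
        2 ^ (x + ∣ F ∣)          ≡⟨ ^-distribˡ-+-* 2 x ∣ F ∣ ⟩
        2 ^ x * 2 ^ ∣ F ∣        ∎
      combine : slots n * (a * R) + R * b * x ≤ R * b * slots n + slots n * b
      combine = begin
        slots n * (a * R) + R * b * x                ≤⟨ +-monoˡ-≤ (R * b * x) (proj₂ (proj₂ found)) ⟩
        R * b * ∣ F ∣ + slots n * b + R * b * x      ≡⟨ regroup (R * b) ∣ F ∣ (slots n * b) x ⟩
        R * b * (x + ∣ F ∣) + slots n * b            ≡⟨ cong (λ y → R * b * y + slots n * b) x+F≡C ⟩
        R * b * slots n + slots n * b                ∎
        where
        regroup : ∀ r f z x → r * f + z + r * x ≡ r * (x + f) + z
        regroup = solve-∀
    upper-bound zero       t large _ = contradiction (≤-trans (m≤n+m 2 _) large) λ ()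
    upper-bound (suc zero) t large _ = contradiction (≤-trans (m≤n+m 2 _) large) λ { (s≤s ()) }

-- Rational arithmetic and comparison with rational powers of 2

module Rationals where

  open import Data.Integer.Base as ℤ using (ℤ; +_; -[1+_])
  import Data.Integer.Properties as ℤ
  import Data.Integer.Tactic.RingSolver as ℤ
  open import Data.Nat.Base as ℕ using (ℕ; zero; suc)
  import Data.Nat.Properties as ℕ
  open import Data.Product.Base using (_,_)
  open import Data.Rational.Base
  open import Data.Rational.Properties
  open import Data.Rational.Solver using (module +-*-Solver)
  import Data.Rational.Unnormalised.Base as ℚᵘ
  import Data.Rational.Unnormalised.Properties as ℚᵘ
  open import Data.Sum.Base using (inj₁; inj₂)
  open import Relation.Binary.PropositionalEquality
  open import Relation.Nullary using (¬_; contradiction)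
  open import Relation.Nullary.Decidable using (from-yes)
  open +-*-Solver using (solve; _:=_; _:+_; _:*_; :-_; con)

  open import Algebra.Definitions.RawSemiring +-*-rawSemiring using (_^_)
  open import Defs using (ℕ→ℚ; 2^ℤ; _≺2^_; 2^_≺_)
  open Bounds using (^-cancelʳ-<; ^-distribʳ-*)

  private variable
    p q r s x y : ℚ
    m n : ℕ

  *-mono-<ʳ : 0ℚ < r → p < q → p * r < q * r
  *-mono-<ʳ {r} 0<r = *-monoˡ-<-pos r {{positive 0<r}}

  *-mono-≤ʳ : 0ℚ ≤ r → p ≤ q → p * r ≤ q * r
  *-mono-≤ʳ {r} 0≤r = *-monoʳ-≤-nonNeg r {{nonNegative 0≤r}}

  *-cancel-<ʳ : 0ℚ ≤ r → p * r < q * r → p < q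
  *-cancel-<ʳ {r} 0≤r = *-cancelʳ-<-nonNeg r {{nonNegative 0≤r}}

  *-cancel-≤ʳ : 0ℚ < r → p * r ≤ q * r → p ≤ q
  *-cancel-≤ʳ {r} 0<r = *-cancelʳ-≤-pos r {{positive 0<r}}

  0<* : 0ℚ < p → 0ℚ < q → 0ℚ < p * q
  0<* {p} {q} 0<p 0<q = subst (_< p * q) (*-zeroˡ q) (*-mono-<ʳ 0<q 0<p)

  0≤* : 0ℚ ≤ p → 0ℚ ≤ q → 0ℚ ≤ p * q
  0≤* {p} {q} 0≤p 0≤q = subst (_≤ p * q) (*-zeroˡ q) (*-mono-≤ʳ 0≤q 0≤p)

  p<q⇒0<q-p : p < q → 0ℚ < q - p
  p<q⇒0<q-p {p} {q} p<q = subst (_< q - p) (+-inverseʳ p) (+-monoˡ-< (- p) p<q)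

  ι : ℕ → ℚ
  ι = ℕ→ℚ

  toℚᵘ-/1 : ∀ i → toℚᵘ (i / 1) ℚᵘ.≃ ℚᵘ.mkℚᵘ i 0
  toℚᵘ-/1 i = toℚᵘ-fromℚᵘ (ℚᵘ.mkℚᵘ i 0)

  /1-+ : ∀ i j → (i ℤ.+ j) / 1 ≡ i / 1 + j / 1
  /1-+ i j = toℚᵘ-injective (begin
    toℚᵘ ((i ℤ.+ j) / 1)                       ≈⟨ toℚᵘ-/1 (i ℤ.+ j) ⟩
    ℚᵘ.mkℚᵘ (i ℤ.+ j) 0                        ≈⟨ ℚᵘ.*≡* (identity i j) ⟩
    ℚᵘ.mkℚᵘ i 0 ℚᵘ.+ ℚᵘ.mkℚᵘ j 0               ≈⟨ ℚᵘ.+-cong (toℚᵘ-/1 i) (toℚᵘ-/1 j) ⟨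
    toℚᵘ (i / 1) ℚᵘ.+ toℚᵘ (j / 1)             ≈⟨ toℚᵘ-homo-+ (i / 1) (j / 1) ⟨
    toℚᵘ (i / 1 + j / 1)                       ∎)
    where
    open ℚᵘ.≃-Reasoning
    identity : ∀ i j → (i ℤ.+ j) ℤ.* + 1 ≡ (i ℤ.* + 1 ℤ.+ j ℤ.* + 1) ℤ.* + 1
    identity = ℤ.solve-∀

  /1-* : ∀ i j → (i ℤ.* j) / 1 ≡ i / 1 * (j / 1)
  /1-* i j = toℚᵘ-injective (begin
    toℚᵘ ((i ℤ.* j) / 1)                       ≈⟨ toℚᵘ-/1 (i ℤ.* j) ⟩
    ℚᵘ.mkℚᵘ i 0 ℚᵘ.* ℚᵘ.mkℚᵘ j 0               ≈⟨ ℚᵘ.*-cong (toℚᵘ-/1 i) (toℚᵘ-/1 j) ⟨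
    toℚᵘ (i / 1) ℚᵘ.* toℚᵘ (j / 1)             ≈⟨ toℚᵘ-homo-* (i / 1) (j / 1) ⟨
    toℚᵘ (i / 1 * (j / 1))                     ∎)
    where open ℚᵘ.≃-Reasoning

  ι-+ : ∀ m n → ι (m ℕ.+ n) ≡ ι m + ι n
  ι-+ m n = /1-+ (+ m) (+ n)

  ι-* : ∀ m n → ι (m ℕ.* n) ≡ ι m * ι n
  ι-* m n = trans (cong (_/ 1) (ℤ.pos-* m n)) (/1-* (+ m) (+ n))

  ι-^ : ∀ m n → ι m ^ n ≡ ι (m ℕ.^ n)
  ι-^ m zero    = refl
  ι-^ m (suc n) = trans (cong (ι m *_) (ι-^ m n)) (sym (ι-* m (m ℕ.^ n)))

  ι-mono-< : m ℕ.< n → ι m < ι n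
  ι-mono-< {m} {n} m<n = toℚᵘ-cancel-< (ℚᵘ.<-respˡ-≃ (ℚᵘ.≃-sym (toℚᵘ-/1 (+ m)))
    (ℚᵘ.<-respʳ-≃ (ℚᵘ.≃-sym (toℚᵘ-/1 (+ n)))
      (ℚᵘ.*<* (subst₂ ℤ._<_ (sym (ℤ.*-identityʳ (+ m))) (sym (ℤ.*-identityʳ (+ n))) (ℤ.+<+ m<n)))))

  ι-mono-≤ : m ℕ.≤ n → ι m ≤ ι n
  ι-mono-≤ {m} {n} m≤n with ℕ.m≤n⇒m<n∨m≡n m≤n
  ... | inj₁ m<n  = <⇒≤ (ι-mono-< {m} {n} m<n)
  ... | inj₂ refl = ≤-refl

  ι-cancel-< : ι m < ι n → m ℕ.< n
  ι-cancel-< {m} {n} lt = ℕ.≰⇒> λ n≤m → <-irrefl refl (<-≤-trans lt (ι-mono-≤ n≤m))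

  0≤ι : ∀ n → 0ℚ ≤ ι n
  0≤ι n = ι-mono-≤ {0} {n} ℕ.z≤n

  0<ι : ∀ n .{{_ : ℕ.NonZero n}} → 0ℚ < ι n
  0<ι n = ι-mono-< {0} {n} (ℕ.>-nonZero⁻¹ n)

  fraction : ∀ i n .{{_ : ℕ.NonZero n}} → i / n * ι n ≡ i / 1
  fraction i n@(suc n-1) = toℚᵘ-injective (begin
    toℚᵘ (i / n * ι n)                          ≈⟨ toℚᵘ-homo-* (i / n) (ι n) ⟩
    toℚᵘ (i / n) ℚᵘ.* toℚᵘ (ι n)                ≈⟨ ℚᵘ.*-cong (toℚᵘ-fromℚᵘ (ℚᵘ.mkℚᵘ i n-1)) (toℚᵘ-/1 (+ n)) ⟩
    ℚᵘ.mkℚᵘ i n-1 ℚᵘ.* ℚᵘ.mkℚᵘ (+ n) 0          ≈⟨ ℚᵘ.*≡* (trans (ℤ.*-identityʳ _) (cong (i ℤ.*_) (sym (trans (ℤ.pos-* n 1) (ℤ.*-identityʳ (+ n)))))) ⟩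
    ℚᵘ.mkℚᵘ i 0                                 ≈⟨ toℚᵘ-/1 i ⟨
    toℚᵘ (i / 1)                                ∎)
    where open ℚᵘ.≃-Reasoning

  abstract
    _/ι_ : (k n : ℕ) .{{_ : ℕ.NonZero n}} → ℚ
    k /ι n = + k / n

    /ι-* : (k n : ℕ) .{{_ : ℕ.NonZero n}} → k /ι n * ι n ≡ ι k
    /ι-* k n = fraction (+ k) n

  clear : ∀ p → p * ι (↧ₙ p) ≡ ↥ p / 1
  clear p = trans (cong (_* ι (↧ₙ p)) (sym (↥p/↧p≡p p))) (fraction (↥ p) (↧ₙ p))

  negative-/1 : ∀ i → -[1+ i ] / 1 < 0ℚ
  negative-/1 i = neg-antimono-< {0ℚ} {ι (suc i)} (0<ι (suc i))

  1<2 : 1 ℕ.< 2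
  1<2 = ℕ.s≤s (ℕ.s≤s ℕ.z≤n)

  ½^-<1 : ∀ i → ½ ^ suc i < 1ℚ
  ½^-<1 i = ≤-<-trans (half≤ i) ½<1
    where
    ½<1 : ½ < 1ℚ
    ½<1 = from-yes (½ <? 1ℚ)
    0≤½^ : ∀ i → 0ℚ ≤ ½ ^ i
    0≤½^ zero    = nonNegative⁻¹ 1ℚ
    0≤½^ (suc i) = 0≤* (nonNegative⁻¹ ½) (0≤½^ i)
    half≤ : ∀ i → ½ ^ suc i ≤ ½
    half≤ zero    = ≤-reflexive (*-identityʳ ½)
    half≤ (suc i) = ≤-trans (*-mono-≤ʳ (0≤½^ (suc i)) (<⇒≤ ½<1))
                      (≤-trans (≤-reflexive (*-identityˡ (½ ^ suc i))) (half≤ i))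

  -- For p = i/d the comparisons below reduce to comparing powers of naturals with exponents i and d.

  ι<⇒ : ∀ p k {i} → ι k < p → ↥ p ≡ + i → k ℕ.* ↧ₙ p ℕ.< i
  ι<⇒ p k {i} k<p eq = ι-cancel-< (subst₂ _<_ (sym (ι-* k (↧ₙ p))) (trans (clear p) (cong (_/ 1) eq))
    (*-mono-<ʳ (0<ι (↧ₙ p)) k<p))

  ι≮negative : ∀ p k {i} → ↥ p ≡ -[1+ i ] → ¬ (ι k < p)
  ι≮negative p k {i} eq k<p = <-asym (negative-/1 i)
    (≤-<-trans (0≤ι (k ℕ.* ↧ₙ p)) (subst₂ _<_ (sym (ι-* k (↧ₙ p))) (trans (clear p) (cong (_/ 1) eq))
      (*-mono-<ʳ (0<ι (↧ₙ p)) k<p)))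

  2^≺⇒< : ∀ p n k → 2^ p ≺ ι n → ι k < p → 2 ℕ.^ k ℕ.< n
  2^≺⇒< p n k (_ , lt) k<p with ↥ p in eq
  ... | -[1+ i ] = contradiction k<p (ι≮negative p k eq)
  ... | + i = ^-cancelʳ-< _ _ (↧ₙ p) (begin-strict
        (2 ℕ.^ k) ℕ.^ ↧ₙ p     ≡⟨ ℕ.^-*-assoc 2 k (↧ₙ p) ⟩
        2 ℕ.^ (k ℕ.* ↧ₙ p)     <⟨ ℕ.^-monoʳ-< 2 1<2 (ι<⇒ p k k<p eq) ⟩
        2 ℕ.^ i                <⟨ ι-cancel-< (subst₂ _<_ (ι-^ 2 i) (ι-^ n (↧ₙ p)) lt) ⟩
        n ℕ.^ ↧ₙ p             ∎)
    where open ℕ.≤-Reasoning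

  <⇒2^≺ : ∀ p n k → 2 ℕ.^ k ℕ.≤ n → p < ι k → 2^ p ≺ ι n
  <⇒2^≺ p n k 2^k≤n p<k = ι-mono-< 0<n , lt
    where
    open ℕ.≤-Reasoning
    d = ↧ₙ p
    0<n : 0 ℕ.< n
    0<n = ℕ.≤-trans (ℕ.m^n>0 2 k) 2^k≤n
    instance
      n≢0 : ℕ.NonZero n
      n≢0 = ℕ.>-nonZero 0<n
    lt : 2^ℤ (↥ p) < ι n ^ ↧ₙ p
    lt with ↥ p in eq
    ... | -[1+ i ] = <-≤-trans (½^-<1 i)
          (≤-trans (ι-mono-≤ (ℕ.m^n>0 n d)) (≤-reflexive (sym (ι-^ n d))))
    ... | + i = subst₂ _<_ (sym (ι-^ 2 i)) (sym (ι-^ n d)) (ι-mono-< (begin-strict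
          2 ℕ.^ i                <⟨ ℕ.^-monoʳ-< 2 1<2 i<kd ⟩
          2 ℕ.^ (k ℕ.* d)        ≡⟨ ℕ.^-*-assoc 2 k d ⟨
          (2 ℕ.^ k) ℕ.^ d        ≤⟨ ℕ.^-monoˡ-≤ d 2^k≤n ⟩
          n ℕ.^ d                ∎))
      where
      i<kd : i ℕ.< k ℕ.* d
      i<kd = ι-cancel-< (subst₂ _<_ (trans (clear p) (cong (_/ 1) eq)) (sym (ι-* k d)) (*-mono-<ʳ (0<ι d) p<k))

  <⇒≺2^ : ∀ p n k → n ℕ.≤ 2 ℕ.^ k → ι k < p → ι n ≺2^ p
  <⇒≺2^ p n k n≤2^k k<p with ↥ p in eq
  ... | -[1+ i ] = contradiction k<p (ι≮negative p k eq)
  ... | + i = inj₂ (subst₂ _<_ (sym (ι-^ n d)) (sym (ι-^ 2 i)) (ι-mono-< (begin-strict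
        n ℕ.^ d                ≤⟨ ℕ.^-monoˡ-≤ d n≤2^k ⟩
        (2 ℕ.^ k) ℕ.^ d        ≡⟨ ℕ.^-*-assoc 2 k d ⟩
        2 ℕ.^ (k ℕ.* d)        <⟨ ℕ.^-monoʳ-< 2 1<2 (ι<⇒ p k k<p eq) ⟩
        2 ℕ.^ i                ∎)))
    where
    open ℕ.≤-Reasoning
    d = ↧ₙ p

  -- Both hypotheses are raised to powers with the common exponent `d * h`, where `d` is the
  -- denominator of `p`, and the d-th root is then cancelled. A negative numerator is impossible, as
  -- it would put n^d below 1.
  ≺2^⇒< : ∀ p n h k .{{_ : ℕ.NonZero n}} → ι n ≺2^ p → p * ι h < ι k → n ℕ.^ h ℕ.< 2 ℕ.^ k
  ≺2^⇒< p n h k (inj₁ n<0) _ = contradiction (0≤ι n) λ 0≤n → <-irrefl refl (<-≤-trans n<0 0≤n)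
  ≺2^⇒< p n h k (inj₂ lt) ph<k with ↥ p in eq
  ... | -[1+ i ] = contradiction (≤-trans (ι-mono-≤ (ℕ.m^n>0 n (↧ₙ p))) (≤-reflexive (sym (ι-^ n (↧ₙ p)))))
        λ 1≤nᵈ → <-irrefl refl (<-≤-trans (<-trans lt (½^-<1 i)) 1≤nᵈ)
  ... | + i = ^-cancelʳ-< _ _ d (begin-strict
        (n ℕ.^ h) ℕ.^ d          ≡⟨ trans (ℕ.^-*-assoc n h d) (trans (cong (n ℕ.^_) (ℕ.*-comm h d)) (sym (ℕ.^-*-assoc n d h))) ⟩
        (n ℕ.^ d) ℕ.^ h          ≤⟨ ℕ.^-monoˡ-≤ h (ℕ.<⇒≤ (ι-cancel-< (subst₂ _<_ (ι-^ n d) (ι-^ 2 i) lt))) ⟩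
        (2 ℕ.^ i) ℕ.^ h          ≡⟨ ℕ.^-*-assoc 2 i h ⟩
        2 ℕ.^ (i ℕ.* h)          <⟨ ℕ.^-monoʳ-< 2 1<2 ih<kd ⟩
        2 ℕ.^ (k ℕ.* d)          ≡⟨ ℕ.^-*-assoc 2 k d ⟨
        (2 ℕ.^ k) ℕ.^ d          ∎)
    where
    open ℕ.≤-Reasoning
    d = ↧ₙ p
    ih<kd : i ℕ.* h ℕ.< k ℕ.* d
    ih<kd = ι-cancel-< (subst₂ _<_
      (trans (solve 3 (λ p h d → p :* h :* d := p :* d :* h) refl p (ι h) (ι d))
        (trans (cong (_* ι h) (trans (clear p) (cong (_/ 1) eq))) (sym (ι-* i h))))
      (sym (ι-* k d)) (*-mono-<ʳ (0<ι d) ph<k))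

  ^-distribʳ-*ℚ : ∀ p q n → (p * q) ^ n ≡ p ^ n * q ^ n
  ^-distribʳ-*ℚ p q zero    = sym (*-identityʳ 1ℚ)
  ^-distribʳ-*ℚ p q (suc n) = trans (cong (p * q *_) (^-distribʳ-*ℚ p q n))
    (solve 4 (λ a b c d → a :* b :* (c :* d) := a :* c :* (b :* d)) refl p q (p ^ n) (q ^ n))

  ½^-* : ∀ i → ½ ^ i * ι (2 ℕ.^ i) ≡ 1ℚ
  ½^-* zero    = *-identityʳ 1ℚ
  ½^-* (suc i) = begin
    ½ * ½ ^ i * ι (2 ℕ.* 2 ℕ.^ i)      ≡⟨ cong (½ * ½ ^ i *_) (ι-* 2 (2 ℕ.^ i)) ⟩
    ½ * ½ ^ i * (ι 2 * ι (2 ℕ.^ i))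
      ≡⟨ solve 4 (λ a b c d → a :* b :* (c :* d) := a :* c :* (b :* d)) refl ½ (½ ^ i) (ι 2) (ι (2 ℕ.^ i)) ⟩
    ½ * ι 2 * (½ ^ i * ι (2 ℕ.^ i))    ≡⟨ cong (½ * ι 2 *_) (½^-* i) ⟩
    ½ * ι 2 * 1ℚ                       ≡⟨⟩
    1ℚ                                 ∎
    where open ≡-Reasoning

  2^ℤ-neg : ∀ i → 2^ℤ (ℤ.- (+ i)) * ι (2 ℕ.^ i) ≡ 1ℚ
  2^ℤ-neg zero    = *-identityʳ 1ℚ
  2^ℤ-neg (suc i) = ½^-* (suc i)

  -- With p = -g/h and u = U/V this is 2^(-g/h) < U/V. The reduced form of `p` need not be -g/h, so
  -- its numerator and denominator are tied to `g` and `h` by cross multiplication, and an h-th root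
  -- is cancelled.
  2^-fraction≺ : ∀ p u g h U V .{{_ : ℕ.NonZero h}} .{{_ : ℕ.NonZero U}} .{{_ : ℕ.NonZero V}} →
    p * ι h ≡ - ι g → u * ι V ≡ ι U → V ℕ.^ h ℕ.< U ℕ.^ h ℕ.* 2 ℕ.^ g → 2^ p ≺ u
  2^-fraction≺ p u g h U V ph uV Vʰ< = 0<u , subst (λ i → 2^ℤ i < u ^ d) (sym num)
    (*-cancel-<ʳ (0≤ι (2 ℕ.^ i)) (subst (_< u ^ d * ι (2 ℕ.^ i)) (sym (2^ℤ-neg i)) 1<))
    where
    d = ↧ₙ p
    i = ℤ.∣ ↥ p ∣
    0<u : 0ℚ < u
    0<u = *-cancel-<ʳ (0≤ι V) (subst₂ _<_ (sym (*-zeroˡ (ι V))) (sym uV) (0<ι U))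
    cross : ↥ p / 1 * ι h ≡ - ι (g ℕ.* d)
    cross = begin
      ↥ p / 1 * ι h       ≡⟨ cong (_* ι h) (clear p) ⟨
      p * ι d * ι h       ≡⟨ solve 3 (λ p h d → p :* d :* h := p :* h :* d) refl p (ι h) (ι d) ⟩
      p * ι h * ι d       ≡⟨ cong (_* ι d) ph ⟩
      - ι g * ι d         ≡⟨ neg-distribˡ-* (ι g) (ι d) ⟨
      - (ι g * ι d)       ≡⟨ cong -_ (ι-* g d) ⟨
      - ι (g ℕ.* d)       ∎
      where open ≡-Reasoning
    num : ↥ p ≡ ℤ.- (+ i)
    num with ↥ p in eq
    ... | -[1+ j ] = refl
    ... | + zero   = refl
    ... | + suc j  = contradiction cross′ (λ e → <-irrefl (sym e)
            (≤-<-trans (neg-antimono-≤ (0≤ι (g ℕ.* d))) (0<* (0<ι (suc j)) (0<ι h))))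
      where
      cross′ : ι (suc j) * ι h ≡ - ι (g ℕ.* d)
      cross′ = subst (λ z → z / 1 * ι h ≡ - ι (g ℕ.* d)) eq cross
    ih≡gd : i ℕ.* h ≡ g ℕ.* d
    ih≡gd = ℕ.≤-antisym (ℕ.≮⇒≥ λ lt → <-irrefl (sym eq) (ι-mono-< lt))
                        (ℕ.≮⇒≥ λ lt → <-irrefl eq (ι-mono-< lt))
      where
      /1-neg : ∀ i → (ℤ.- (+ i)) / 1 ≡ - ι i
      /1-neg zero    = refl
      /1-neg (suc i) = refl
      eq : ι (i ℕ.* h) ≡ ι (g ℕ.* d)
      eq = neg-injective (begin
        - ι (i ℕ.* h)           ≡⟨ cong -_ (ι-* i h) ⟩
        - (ι i * ι h)           ≡⟨ neg-distribˡ-* (ι i) (ι h) ⟩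
        - ι i * ι h             ≡⟨ cong (_* ι h) (trans (sym (/1-neg i)) (cong (_/ 1) (sym num))) ⟩
        ↥ p / 1 * ι h           ≡⟨ cross ⟩
        - ι (g ℕ.* d)           ∎)
        where open ≡-Reasoning
    Vᵈ< : V ℕ.^ d ℕ.< U ℕ.^ d ℕ.* 2 ℕ.^ i
    Vᵈ< = ^-cancelʳ-< _ _ h (begin-strict
      (V ℕ.^ d) ℕ.^ h                          ≡⟨ swap V ⟩
      (V ℕ.^ h) ℕ.^ d                          <⟨ ℕ.^-monoˡ-< d Vʰ< ⟩
      (U ℕ.^ h ℕ.* 2 ℕ.^ g) ℕ.^ d              ≡⟨ ^-distribʳ-* (U ℕ.^ h) (2 ℕ.^ g) d ⟩
      (U ℕ.^ h) ℕ.^ d ℕ.* (2 ℕ.^ g) ℕ.^ d      ≡⟨ cong₂ ℕ._*_ (sym (swap U)) exponent ⟩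
      (U ℕ.^ d) ℕ.^ h ℕ.* (2 ℕ.^ i) ℕ.^ h      ≡⟨ ^-distribʳ-* (U ℕ.^ d) (2 ℕ.^ i) h ⟨
      (U ℕ.^ d ℕ.* 2 ℕ.^ i) ℕ.^ h              ∎)
      where
      open ℕ.≤-Reasoning
      swap : ∀ x → (x ℕ.^ d) ℕ.^ h ≡ (x ℕ.^ h) ℕ.^ d
      swap x = trans (ℕ.^-*-assoc x d h) (trans (cong (x ℕ.^_) (ℕ.*-comm d h)) (sym (ℕ.^-*-assoc x h d)))
      exponent : (2 ℕ.^ g) ℕ.^ d ≡ (2 ℕ.^ i) ℕ.^ h
      exponent = trans (ℕ.^-*-assoc 2 g d) (trans (cong (2 ℕ.^_) (sym ih≡gd)) (sym (ℕ.^-*-assoc 2 i h)))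
    1< : 1ℚ < u ^ d * ι (2 ℕ.^ i)
    1< = *-cancel-<ʳ (0≤ι (V ℕ.^ d)) (subst₂ _<_ (sym (*-identityˡ _)) (sym power) (ι-mono-< Vᵈ<))
      where
      power : u ^ d * ι (2 ℕ.^ i) * ι (V ℕ.^ d) ≡ ι (U ℕ.^ d ℕ.* 2 ℕ.^ i)
      power = begin
        u ^ d * ι (2 ℕ.^ i) * ι (V ℕ.^ d)
          ≡⟨ solve 3 (λ a b c → a :* b :* c := a :* c :* b) refl (u ^ d) (ι (2 ℕ.^ i)) (ι (V ℕ.^ d)) ⟩
        u ^ d * ι (V ℕ.^ d) * ι (2 ℕ.^ i)
          ≡⟨ cong (_* ι (2 ℕ.^ i)) (trans (cong (u ^ d *_) (sym (ι-^ V d)))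
               (trans (sym (^-distribʳ-*ℚ u (ι V) d)) (trans (cong (_^ d) uV) (ι-^ U d)))) ⟩
        ι (U ℕ.^ d) * ι (2 ℕ.^ i)            ≡⟨ ι-* (U ℕ.^ d) (2 ℕ.^ i) ⟨
        ι (U ℕ.^ d ℕ.* 2 ℕ.^ i)              ∎
        where open ≡-Reasoning

-- Deriving inequalities between cuts from rational ones

module Cuts where

  open import Data.Integer.Base as ℤ using (+_)
  open import Data.Nat.Base as ℕ using (ℕ)
  open import Data.Nat.Combinatorics using (_C_)
  import Data.Nat.Properties as ℕ
  open import Data.Product.Base using (∃; ∃₂; _×_; _,_; proj₁; proj₂)
  open import Data.Rational.Base
  open import Data.Rational.Properties
  open import Data.Rational.Solver using (module +-*-Solver)
  open import Data.Sum.Base using (inj₁; inj₂)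
  open import Relation.Binary.PropositionalEquality

  open +-*-Solver using (solve; _:=_; _:+_; _:*_; :-_; con)

  import Defs
  open import Defs using (Lower; Upper; fromℚ; rate; Graph; M)
  open GraphCoding using (slots; slots≡nC2)
  open Rationals

  p≤∣p∣ : ∀ p → p ≤ ∣ p ∣
  p≤∣p∣ p with ∣p∣≡p∨∣p∣≡-p p
  ... | inj₁ eq = ≤-reflexive (sym eq)
  ... | inj₂ eq with ≤-total 0ℚ p
  ...   | inj₁ 0≤p = ≤-reflexive (sym (0≤p⇒∣p∣≡p 0≤p))
  ...   | inj₂ p≤0 = ≤-trans p≤0 (0≤∣p∣ p)

  -- δ = g / (D + g) for the gap g = p - x y and D = |x| + |y| + 1, so that δ ≤ 1 and δ D < g.
  *-neighbourhood : ∀ x y p → x * y < p → ∃ λ δ → 0ℚ < δ ×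
    (∀ σ τ → ∣ σ ∣ ≡ δ → ∣ τ ∣ ≡ δ → (x + σ) * (y + τ) < p)
  *-neighbourhood x y p xy<p = δ , 0<δ , bound
    where
    g D S : ℚ
    g = p - x * y
    D = ∣ x ∣ + ∣ y ∣ + 1ℚ
    S = D + g
    0<g : 0ℚ < g
    0<g = p<q⇒0<q-p xy<p
    0<D : 0ℚ < D
    0<D = +-mono-≤-< (+-mono-≤ (0≤∣p∣ x) (0≤∣p∣ y)) (0<ι 1)
    0<S : 0ℚ < S
    0<S = +-mono-< 0<D 0<g
    instance
      S-positive : Positive S
      S-positive = positive 0<S
      S-nonZero : NonZero S
      S-nonZero = pos⇒nonZero S
      1/S-positive : Positive (1/ S)
      1/S-positive = 1/pos⇒pos S
    δ : ℚ
    δ = g * 1/ S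
    0<δ : 0ℚ < δ
    0<δ = 0<* 0<g (positive⁻¹ (1/ S))
    δS≡g : δ * S ≡ g
    δS≡g = trans (*-assoc g (1/ S) S) (trans (cong (g *_) (*-inverseˡ S)) (*-identityʳ g))
    δ≤1 : δ ≤ 1ℚ
    δ≤1 = *-cancel-≤ʳ 0<S (subst₂ _≤_ (sym δS≡g) (sym (*-identityˡ S))
      (subst (_≤ S) (+-identityˡ g) (+-monoˡ-≤ g (<⇒≤ 0<D))))
    δD<g : δ * D < g
    δD<g = subst₂ _<_ (+-identityʳ (δ * D)) (trans (sym (*-distribˡ-+ δ D g)) δS≡g)
      (+-monoʳ-< (δ * D) (0<* 0<δ 0<g))
    bound : ∀ σ τ → ∣ σ ∣ ≡ δ → ∣ τ ∣ ≡ δ → (x + σ) * (y + τ) < p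
    bound σ τ σδ τδ = begin-strict
      (x + σ) * (y + τ)
        ≡⟨ solve 4 (λ x y s t → (x :+ s) :* (y :+ t) := x :* y :+ (t :* x :+ s :* y :+ s :* t)) refl x y σ τ ⟩
      x * y + (τ * x + σ * y + σ * τ)
        ≤⟨ +-monoʳ-≤ (x * y) (+-mono-≤ (+-mono-≤ (term τ x τδ) (term σ y σδ))
             (≤-trans (term σ τ σδ) (subst (λ z → δ * z ≤ δ * 1ℚ) (sym τδ)
               (*-monoˡ-≤-nonNeg δ {{nonNegative (<⇒≤ 0<δ)}} δ≤1)))) ⟩
      x * y + (δ * ∣ x ∣ + δ * ∣ y ∣ + δ * 1ℚ)
        ≡⟨ solve 4 (λ d a b w → w :+ (d :* a :+ d :* b :+ d :* con 1ℚ) := w :+ d :* (a :+ b :+ con 1ℚ))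
             refl δ ∣ x ∣ ∣ y ∣ (x * y) ⟩
      x * y + δ * D         <⟨ +-monoʳ-< (x * y) δD<g ⟩
      x * y + (p - x * y)   ≡⟨ solve 2 (λ w p → w :+ (p :+ :- w) := p) refl (x * y) p ⟩
      p                     ∎
      where
      open ≤-Reasoning
      term : ∀ σ z → ∣ σ ∣ ≡ δ → σ * z ≤ δ * ∣ z ∣
      term σ z eq = ≤-trans (p≤∣p∣ (σ * z)) (≤-reflexive (trans (∣p*q∣≡∣p∣*∣q∣ σ z) (cong (_* ∣ z ∣) eq)))

  x-δ<x : ∀ x {δ} → 0ℚ < δ → x - δ < x
  x-δ<x x {δ} 0<δ = subst (x - δ <_) (+-identityʳ x) (+-monoʳ-< x (neg-antimono-< 0<δ))

  x<x+δ : ∀ x {δ} → 0ℚ < δ → x < x + δ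
  x<x+δ x 0<δ = subst (_< x + _) (+-identityʳ x) (+-monoʳ-< x 0<δ)

  module _ (x y p : ℚ) where

    *-Upper : x * y < p → Upper (fromℚ x Defs.* fromℚ y) p
    *-Upper lt = x - δ , x + δ , y - δ , y + δ ,
      x-δ<x x 0<δ , x<x+δ x 0<δ , x-δ<x y 0<δ , x<x+δ y 0<δ ,
      bound (- δ) (- δ) ∣-δ∣ ∣-δ∣ , bound (- δ) δ ∣-δ∣ ∣δ∣ , bound δ (- δ) ∣δ∣ ∣-δ∣ , bound δ δ ∣δ∣ ∣δ∣
      where
      nbhd = *-neighbourhood x y p lt
      δ = proj₁ nbhd
      0<δ = proj₁ (proj₂ nbhd)
      bound = proj₂ (proj₂ nbhd)
      ∣δ∣ : ∣ δ ∣ ≡ δ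
      ∣δ∣ = 0≤p⇒∣p∣≡p (<⇒≤ 0<δ)
      ∣-δ∣ : ∣ - δ ∣ ≡ δ
      ∣-δ∣ = trans (∣-p∣≡∣p∣ δ) ∣δ∣

    *-Lower : p < x * y → Lower (fromℚ x Defs.* fromℚ y) p
    *-Lower lt = x - δ , x + δ , y - δ , y + δ ,
      x-δ<x x 0<δ , x<x+δ x 0<δ , x-δ<x y 0<δ , x<x+δ y 0<δ ,
      flip (- δ) (- δ) (bound (- - δ) (- δ) ∣--δ∣ ∣-δ∣) , flip (- δ) δ (bound (- - δ) δ ∣--δ∣ ∣δ∣) ,
      flip δ (- δ) (bound (- δ) (- δ) ∣-δ∣ ∣-δ∣) , flip δ δ (bound (- δ) δ ∣-δ∣ ∣δ∣)
      where
      -- Negating one factor turns the lower estimate into an upper one; `flip` translates back.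
      nbhd = *-neighbourhood (- x) y (- p) (subst (_< - p) (neg-distribˡ-* x y) (neg-antimono-< lt))
      δ = proj₁ nbhd
      0<δ = proj₁ (proj₂ nbhd)
      bound = proj₂ (proj₂ nbhd)
      ∣δ∣ : ∣ δ ∣ ≡ δ
      ∣δ∣ = 0≤p⇒∣p∣≡p (<⇒≤ 0<δ)
      ∣-δ∣ : ∣ - δ ∣ ≡ δ
      ∣-δ∣ = trans (∣-p∣≡∣p∣ δ) ∣δ∣
      ∣--δ∣ : ∣ - - δ ∣ ≡ δ
      ∣--δ∣ = trans (∣-p∣≡∣p∣ (- δ)) ∣-δ∣
      flip : ∀ σ τ → (- x + - σ) * (y + τ) < - p → p < (x + σ) * (y + τ)
      flip σ τ h = subst₂ _<_ (solve 1 (λ p → :- :- p := p) refl p)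
        (solve 4 (λ x s n t → :- ((:- x :+ :- s) :* (n :+ t)) := (x :+ s) :* (n :+ t)) refl x σ y τ)
        (neg-antimono-< h)

  +-Upper : ∀ x y q → x + y < q → ∃₂ λ r s → x < r × y < s × q ≡ r + s
  +-Upper x y q lt =
    let s , y<s , s<q-x = <-dense y<q-x
    in q - s , s ,
       subst₂ _<_ (solve 2 (λ x s → s :+ (x :+ :- s) := x) refl x s)
         (solve 3 (λ x s q → (q :+ :- x) :+ (x :+ :- s) := q :+ :- s) refl x s q)
         (+-monoˡ-< (x - s) s<q-x) ,
       y<s , solve 2 (λ q s → q := (q :+ :- s) :+ s) refl q s
    where
    y<q-x : y < q - x
    y<q-x = subst (_< q - x) (solve 2 (λ x y → (x :+ y) :+ :- x := y) refl x y) (+-monoˡ-< (- x) lt)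

  +-Lower : ∀ x y q → q < x + y → ∃₂ λ r s → r < x × s < y × q ≡ r + s
  +-Lower x y q lt =
    let s , q-x<s , s<y = <-dense q-x<y
    in q - s , s ,
       subst₂ _<_ (solve 3 (λ x s q → (q :+ :- x) :+ (x :+ :- s) := q :+ :- s) refl x s q)
         (solve 2 (λ x s → s :+ (x :+ :- s) := x) refl x s)
         (+-monoˡ-< (x - s) q-x<s) ,
       s<y , solve 2 (λ q s → q := (q :+ :- s) :+ s) refl q s
    where
    q-x<y : q - x < y
    q-x<y = subst (q - x <_) (solve 2 (λ x y → (x :+ y) :+ :- x := y) refl x y) (+-monoˡ-< (- x) lt)

  module _ {k} (L : Graph k) (n : ℕ) where

    -- A rational strictly between `q * ι (slots n)` and `ι x` separates the product cut from the
    -- logarithm, so equality in 2^x ≤ M is allowed.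
    rate-Lower : ∀ x q → 2 ℕ.^ x ℕ.≤ M L n → q * ι (slots n) < ι x → Lower (rate L n) q
    rate-Lower x q 2^x≤M lt =
      let p , qC<p , p<x = <-dense (subst (λ C → q * ι C < ι x) (slots≡nC2 n) lt)
      in p , *-Upper q (ι (n C 2)) p qC<p , <⇒2^≺ p (M L n) x 2^x≤M p<x

    rate-Upper : ∀ x q → M L n ℕ.≤ 2 ℕ.^ x → ι x < q * ι (slots n) → Upper (rate L n) q
    rate-Upper x q M≤2^x lt =
      let p , x<p , p<qC = <-dense (subst (λ C → ι x < q * ι C) (slots≡nC2 n) lt)
      in p , <⇒≺2^ p (M L n) x M≤2^x x<p , *-Lower q (ι (n C 2)) p p<qC

  module _ (x y : ℚ) (m n a b : ℕ) .{{_ : ℕ.NonZero m}} .{{_ : ℕ.NonZero n}}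
    (x≡a/m : x * ι m ≡ ι a) (y≡b/n : y * ι n ≡ ι b) where

    private
      lhs : x * (ι m * ι n) ≡ ι (a ℕ.* n)
      lhs = trans (sym (*-assoc x (ι m) (ι n))) (trans (cong (_* ι n) x≡a/m) (sym (ι-* a n)))
      rhs : y * (ι m * ι n) ≡ ι (b ℕ.* m)
      rhs = trans (solve 3 (λ y m n → y :* (m :* n) := y :* n :* m) refl y (ι m) (ι n))
        (trans (cong (_* ι m) y≡b/n) (sym (ι-* b m)))

    cross-< : a ℕ.* n ℕ.< b ℕ.* m → x < y
    cross-< lt = *-cancel-<ʳ (0≤* (0≤ι m) (0≤ι n)) (subst₂ _<_ (sym lhs) (sym rhs) (ι-mono-< lt))

    cross-≤ : a ℕ.* n ℕ.≤ b ℕ.* m → x ≤ y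
    cross-≤ le = *-cancel-≤ʳ (0<* (0<ι m) (0<ι n)) (subst₂ _≤_ (sym lhs) (sym rhs) (ι-mono-≤ le))

-- The case t = o(log n)

module SmallParts where

  open import Data.Integer.Base as ℤ using (+_; -[1+_])
  open import Data.Nat.Base as ℕ using (ℕ; zero; suc)
  import Data.Nat.Properties as ℕ
  open import Data.Nat.Tactic.RingSolver using (solve-∀)
  open import Data.Product.Base using (∃; ∃₂; _×_; _,_; proj₁; proj₂)
  open import Data.Rational.Base
  open import Data.Rational.Properties
  open import Data.Rational.Solver using (module +-*-Solver)

  open import Relation.Binary.PropositionalEquality
  open import Relation.Nullary using (contradiction)
  open +-*-Solver using (solve; _:=_; _:+_; _:*_; :-_; con)

  import Defs
  open import Defs using (Lower; Upper; fromℚ; fromℕ; log; rate; M; K; _=o_)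
  open GraphCoding using (slots)
  open Packing using (M≤2^slots)
  open Bounds using (module LowerBound)
  open Rationals
  open Cuts

  numerator : ∀ p → 0ℚ < p → ∃ λ k → 0 ℕ.< k × p * ι (↧ₙ p) ≡ ι k
  numerator p 0<p = natural (↥ p) (clear p)
    where
    natural : ∀ i → p * ι (↧ₙ p) ≡ i / 1 → ∃ λ k → 0 ℕ.< k × p * ι (↧ₙ p) ≡ ι k
    natural (+ zero)   eq = contradiction (subst (0ℚ <_) eq (0<* 0<p (0<ι (↧ₙ p)))) (<-irrefl refl)
    natural (+ suc k)  eq = suc k , ℕ.s≤s ℕ.z≤n , eq
    natural (-[1+ k ]) eq = contradiction (subst (0ℚ <_) eq (0<* 0<p (0<ι (↧ₙ p)))) (<-asym (negative-/1 k))

  2slots+n≡n² : ∀ n → 2 ℕ.* slots n ℕ.+ n ≡ n ℕ.* n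
  2slots+n≡n² zero    = refl
  2slots+n≡n² (suc n) = trans (expand n (slots n))
    (trans (cong (λ x → x ℕ.+ n ℕ.+ n ℕ.+ 1) (2slots+n≡n² n)) (collect n))
    where
    expand : ∀ n c → 2 ℕ.* (n ℕ.+ c) ℕ.+ suc n ≡ 2 ℕ.* c ℕ.+ n ℕ.+ n ℕ.+ n ℕ.+ 1
    expand = solve-∀
    collect : ∀ n → n ℕ.* n ℕ.+ n ℕ.+ n ℕ.+ 1 ≡ suc n ℕ.* suc n
    collect = solve-∀

  n²≤4slots : ∀ n → 2 ℕ.≤ n → n ℕ.* n ℕ.≤ 4 ℕ.* slots n
  n²≤4slots n 2≤n = ℕ.+-cancelʳ-≤ (n ℕ.* n) _ _ (begin
    n ℕ.* n ℕ.+ n ℕ.* n                       ≡⟨ cong₂ ℕ._+_ (2slots+n≡n² n) (2slots+n≡n² n) ⟨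
    2 ℕ.* slots n ℕ.+ n ℕ.+ (2 ℕ.* slots n ℕ.+ n)  ≡⟨ collect n (slots n) ⟩
    4 ℕ.* slots n ℕ.+ 2 ℕ.* n                 ≤⟨ ℕ.+-monoʳ-≤ (4 ℕ.* slots n) (ℕ.*-monoˡ-≤ n 2≤n) ⟩
    4 ℕ.* slots n ℕ.+ n ℕ.* n                 ∎)
    where
    open ℕ.≤-Reasoning
    collect : ∀ n c → 2 ℕ.* c ℕ.+ n ℕ.+ (2 ℕ.* c ℕ.+ n) ≡ 4 ℕ.* c ℕ.+ 2 ℕ.* n
    collect = solve-∀

  0<slots : ∀ n → 2 ℕ.≤ n → 0 ℕ.< slots n
  0<slots (suc (suc n)) _ = ℕ.s≤s ℕ.z≤n
  0<slots (suc zero) (ℕ.s≤s ())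

  -- Lower cuts are strict, so the hypothesis is tested at T/2 rather than `T`: from T/2 < (log
  -- n)/(2k) follows kT < log n. For `T` = 0 the test point would not lie below `T`, and the claim
  -- is immediate.
  o-log⇒2^≤ : ∀ k .{{_ : ℕ.NonZero k}} .{{_ : ℕ.NonZero (2 ℕ.* k)}} T n → 0 ℕ.< n →
    fromℕ T Defs.≤ fromℚ (+ 1 / (2 ℕ.* k)) Defs.* log n → 2 ℕ.^ (k ℕ.* T) ℕ.≤ n
  o-log⇒2^≤ k zero n 0<n _ = ℕ.≤-trans (ℕ.≤-reflexive (cong (2 ℕ.^_) (ℕ.*-zeroʳ k))) 0<n
  o-log⇒2^≤ k T@(suc _) n 0<n T≤ = extract (T≤ q q<T)
    where
    q ε : ℚ
    q = ½ * ι T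
    ε = + 1 / (2 ℕ.* k)
    q*2≡T : q * ι 2 ≡ ι T
    q*2≡T = trans (solve 3 (λ h t w → h :* t :* w := h :* w :* t) refl ½ (ι T) (ι 2)) (*-identityˡ (ι T))
    ε*2k≡1 : ε * ι (2 ℕ.* k) ≡ 1ℚ
    ε*2k≡1 = fraction (+ 1) (2 ℕ.* k)
    0<q : 0ℚ < q
    0<q = 0<* (positive⁻¹ ½) (0<ι T)
    0<ε : 0ℚ < ε
    0<ε = *-cancel-<ʳ (0≤ι (2 ℕ.* k)) (subst₂ _<_ (sym (*-zeroˡ (ι (2 ℕ.* k)))) (sym ε*2k≡1) (0<ι 1))
    q<T : q < ι T
    q<T = cross-< q (ι T) 2 1 T T q*2≡T (*-identityʳ (ι T)) (ℕ.*-monoʳ-< T (ℕ.s≤s (ℕ.s≤s ℕ.z≤n)))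
    extract : Lower (fromℚ ε Defs.* log n) q → 2 ℕ.^ (k ℕ.* T) ℕ.≤ n
    -- Positivity of `q` and `b` forces x > 0 through q < b x; then q < a x can be weakened to q < ε
    -- x.
    extract (a , b , x , y , a<ε , ε<b , x<log , _ , q<ax , _ , q<bx , _) =
      ℕ.<⇒≤ (2^≺⇒< x n (k ℕ.* T) x<log kT<x)
      where
      0<x : 0ℚ < x
      0<x = *-cancel-<ʳ (<⇒≤ (<-trans 0<ε ε<b))
        (subst₂ _<_ (sym (*-zeroˡ b)) (*-comm b x) (<-trans 0<q q<bx))
      q<εx : q < ε * x
      q<εx = <-trans q<ax (*-mono-<ʳ 0<x a<ε)
      kT<x : ι (k ℕ.* T) < x
      kT<x = subst₂ _<_ lhs rhs (*-mono-<ʳ (0<ι (2 ℕ.* k)) q<εx)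
        where
        lhs : q * ι (2 ℕ.* k) ≡ ι (k ℕ.* T)
        lhs = trans (cong (q *_) (ι-* 2 k)) (trans (sym (*-assoc q (ι 2) (ι k)))
          (trans (cong (_* ι k) q*2≡T) (trans (*-comm (ι T) (ι k)) (sym (ι-* k T)))))
        rhs : ε * x * ι (2 ℕ.* k) ≡ x
        rhs = trans (solve 3 (λ e x w → e :* x :* w := e :* w :* x) refl ε x (ι (2 ℕ.* k)))
          (trans (cong (_* x) ε*2k≡1) (*-identityˡ x))

  half-pos : ∀ ε → 0ℚ < ε → 0ℚ < ½ * ε
  half-pos ε = 0<* (positive⁻¹ ½)

  half< : ∀ ε → 0ℚ < ε → ½ * ε < ε
  half< ε 0<ε = subst (½ * ε <_) (solve 1 (λ e → con ½ :* e :+ con ½ :* e := e) refl ε) (x<x+δ (½ * ε) (half-pos ε 0<ε))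

  module _ (ε : ℚ) (0<ε : 0ℚ < ε) where

    private
      d e₀ : ℕ
      d = ↧ₙ ε
      e₀ = proj₁ (numerator ε 0<ε)
      half : ℚ
      half = ½ * ε
      half*2d : half * ι (2 ℕ.* d) ≡ ι e₀
      half*2d = trans (cong (half *_) (ι-* 2 d))
        (trans (solve 3 (λ e d w → con ½ :* e :* (w :* d) := con ½ :* w :* (e :* d)) refl ε (ι d) (ι 2))
          (trans (*-identityˡ (ε * ι d)) (proj₂ (proj₂ (numerator ε 0<ε)))))
      -- With n^2 ≤ 4C this gives 4dz ≤ C, hence z < C/(2d), which is at most (ε/2)C because ε has
      -- denominator `d` and numerator at least 1.
      open LowerBound (16 ℕ.* d) {{ℕ.m*n≢0 16 d}}

    rate<1+ε : ∀ t n → 2 ℕ.≤ n → rate (K t t) n Defs.< fromℕ 1 Defs.+ fromℚ ε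
    rate<1+ε t n 2≤n = 1ℚ + half ,
      rate-Upper (K t t) n (slots n) (1ℚ + half) (M≤2^slots (K t t) n) C<qC ,
      +-Lower 1ℚ ε (1ℚ + half) (+-monoʳ-< 1ℚ (half< ε 0<ε))
      where
      instance
        C≢0 : ℕ.NonZero (slots n)
        C≢0 = ℕ.>-nonZero (0<slots n 2≤n)
      C<qC : ι (slots n) < (1ℚ + half) * ι (slots n)
      C<qC = subst₂ _<_ (+-identityʳ (ι (slots n)))
        (solve 2 (λ h c → c :+ h :* c := (con 1ℚ :+ h) :* c) refl half (ι (slots n)))
        (+-monoʳ-< (ι (slots n)) (0<* (half-pos ε 0<ε) (0<ι (slots n))))

    1-ε<rate : ∀ t n → threshold ℕ.≤ n → 2 ℕ.≤ n → 2 ℕ.^ (slope ℕ.* t) ℕ.≤ n →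
               fromℕ 1 Defs.- fromℚ ε Defs.< rate (K t t) n
    1-ε<rate t n large 2≤n 2^≤n = 1ℚ - half ,
      upper (+-Upper 1ℚ (- ε) (1ℚ - half) (+-monoʳ-< 1ℚ (neg-antimono-< (half< ε 0<ε)))) ,
      rate-Lower (K t t) n x (1ℚ - half) 2^x≤M qC<x
      where
      open ℕ.≤-Reasoning
      upper : (∃₂ λ r s → 1ℚ < r × - ε < s × 1ℚ - half ≡ r + s) → Upper (fromℕ 1 Defs.- fromℚ ε) (1ℚ - half)
      upper (r , s , 1<r , -ε<s , eq) = r , s , 1<r ,
        subst (- s <_) (solve 1 (λ e → :- :- e := e) refl ε) (neg-antimono-< -ε<s) , eq
      lb = lower-bound n t large 2^≤n
      z C x : ℕ
      z = proj₁ lb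
      C = slots n
      x = C ℕ.∸ z
      instance
        C≢0 : ℕ.NonZero C
        C≢0 = ℕ.>-nonZero (0<slots n 2≤n)
      4dz≤C : 2 ℕ.* (z ℕ.* (2 ℕ.* d)) ℕ.≤ C
      4dz≤C = ℕ.*-cancelˡ-≤ 4 (begin
        4 ℕ.* (2 ℕ.* (z ℕ.* (2 ℕ.* d)))   ≡⟨ regroup z d ⟩
        16 ℕ.* d ℕ.* z                    ≤⟨ proj₁ (proj₂ lb) ⟩
        n ℕ.* n                           ≤⟨ n²≤4slots n 2≤n ⟩
        4 ℕ.* C                           ∎)
        where
        regroup : ∀ z d → 4 ℕ.* (2 ℕ.* (z ℕ.* (2 ℕ.* d))) ≡ 16 ℕ.* d ℕ.* z
        regroup = solve-∀
      2dz<C : z ℕ.* (2 ℕ.* d) ℕ.< C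
      2dz<C = ℕ.*-cancelˡ-< 2 _ _ (ℕ.≤-<-trans 4dz≤C (ℕ.m<m+n C (ℕ.≤-trans (0<slots n 2≤n) (ℕ.m≤m+n C 0))))
      z≤C : z ℕ.≤ C
      z≤C = ℕ.≤-trans (ℕ.m≤m*n z (2 ℕ.* d) {{ℕ.m*n≢0 2 d}}) (ℕ.<⇒≤ 2dz<C)
      2^x≤M : 2 ℕ.^ x ℕ.≤ M (K t t) n
      2^x≤M = ℕ.*-cancelʳ-≤ _ _ (2 ℕ.^ z) {{ℕ.m^n≢0 2 z}} (begin
        2 ℕ.^ x ℕ.* 2 ℕ.^ z          ≡⟨ ℕ.^-distribˡ-+-* 2 x z ⟨
        2 ℕ.^ (x ℕ.+ z)              ≡⟨ cong (2 ℕ.^_) (ℕ.m∸n+n≡m z≤C) ⟩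
        2 ℕ.^ C                      ≤⟨ proj₂ (proj₂ lb) ⟩
        M (K t t) n ℕ.* 2 ℕ.^ z      ∎)
      z<halfC : ι z < half * ι C
      z<halfC = cross-< (ι z) (half * ι C) 1 (2 ℕ.* d) z (e₀ ℕ.* C) {{_}} {{ℕ.m*n≢0 2 d}}
        (*-identityʳ (ι z))
        (trans (solve 3 (λ h c w → h :* c :* w := h :* w :* c) refl half (ι C) (ι (2 ℕ.* d)))
          (trans (cong (_* ι C) half*2d) (sym (ι-* e₀ C))))
        (begin-strict
          z ℕ.* (2 ℕ.* d)     <⟨ 2dz<C ⟩
          C                   ≤⟨ ℕ.m≤n*m C e₀ {{ℕ.>-nonZero (proj₁ (proj₂ (numerator ε 0<ε)))}} ⟩
          e₀ ℕ.* C            ≡⟨ ℕ.*-identityʳ (e₀ ℕ.* C) ⟨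
          e₀ ℕ.* C ℕ.* 1      ∎)
      qC<x : (1ℚ - half) * ι C < ι x
      qC<x = subst₂ _<_
        (solve 2 (λ h c → c :+ :- (h :* c) := (con 1ℚ :+ :- h) :* c) refl half (ι C))
        (trans (cong (_- ι z) (trans (cong ι (sym (ℕ.m∸n+n≡m z≤C))) (ι-+ x z)))
          (solve 2 (λ x z → x :+ z :+ :- z := x) refl (ι x) (ι z)))
        (+-monoʳ-< (ι C) (neg-antimono-< z<halfC))

  small-t : (t : ℕ → ℕ) → (λ n → fromℕ (t n)) =o log →
            Defs.Lim (λ n → rate (K (t n) (t n)) n) equals fromℕ 1
  small-t t t=o ε 0<ε = N , λ n N≤n →
    let 2≤n = ℕ.≤-trans (ℕ.m≤n⊔m threshold 2) (ℕ.≤-trans (ℕ.m≤n⊔m N₀ _) N≤n)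
        large = ℕ.≤-trans (ℕ.m≤m⊔n threshold 2) (ℕ.≤-trans (ℕ.m≤n⊔m N₀ _) N≤n)
        0<n = ℕ.≤-trans (ℕ.s≤s ℕ.z≤n) 2≤n
        2^≤n = o-log⇒2^≤ k {{_}} {{_}} (t n) n 0<n (proj₂ small n (ℕ.≤-trans (ℕ.m≤m⊔n N₀ _) N≤n))
    in 1-ε<rate ε 0<ε (t n) n large 2≤n
         (ℕ.≤-trans (ℕ.^-monoʳ-≤ 2 (ℕ.*-monoˡ-≤ (t n) (ℕ.n≤1+n slope))) 2^≤n) ,
       rate<1+ε ε 0<ε (t n) n 2≤n
    where
    open LowerBound (16 ℕ.* ↧ₙ ε) {{ℕ.m*n≢0 16 (↧ₙ ε)}} using (slope; threshold)
    -- The successor makes `2 * k` visibly nonzero, as the denominator of the test value of ε must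
    -- be.
    k = suc slope
    small = t=o (+ 1 / (2 ℕ.* k)) (positive⁻¹ _ {{normalize-pos 1 (2 ℕ.* k)}})
    N₀ = proj₁ small
    N = N₀ ℕ.⊔ (threshold ℕ.⊔ 2)

-- The case t = c log n

module CriticalParts where

  open import Data.Integer.Base as ℤ using (ℤ; +_; -[1+_])
  open import Data.Nat.Base as ℕ using (ℕ; zero; suc)
  import Data.Nat.Properties as ℕ
  open import Data.Nat.Tactic.RingSolver using (solve-∀)
  open import Data.Product.Base using (∃; _×_; _,_; proj₁; proj₂)
  open import Data.Rational.Base
  open import Data.Rational.Properties
  open import Data.Rational.Solver using (module +-*-Solver)
  open import Data.Sum.Base using ([_,_]′)
  open import Function.Bundles using (Equivalence)
  open import Relation.Binary.Definitions using (tri<; tri≈; tri>)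
  open import Relation.Binary.PropositionalEquality
  open import Relation.Nullary using (¬_; yes; no; contradiction)
  open import Relation.Unary using (Decidable)
  open +-*-Solver using (solve; _:=_; _:+_; _:*_; :-_; con)

  import Defs
  open import Defs using (ℝ; cut; isDedekind; IsDedekind; Lower; Upper; fromℚ; fromℕ; log; rate; K; Eventually; _RoundingOf_; 2^_)
  open GraphCoding using (slots)
  open Bounds using (module UpperBound; growth-^; ^-distribʳ-*)
  open Rationals
  open Cuts
  open SmallParts using (numerator; 0<slots)

  last-true : {P : ℕ → Set} → Decidable P → ∀ k r → P k → ¬ P (k ℕ.+ r) →
              ∃ λ a → k ℕ.≤ a × a ℕ.< k ℕ.+ r × P a × ¬ P (suc a)
  last-true {P} P? k zero    pk ¬p = contradiction (subst P (sym (ℕ.+-identityʳ k)) pk) ¬p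
  last-true {P} P? k (suc r) pk ¬p with P? (suc k)
  ... | no ¬q = k , ℕ.≤-refl , ℕ.m<m+n k (ℕ.s≤s ℕ.z≤n) , pk , ¬q
  ... | yes q with last-true P? (suc k) r q (λ h → ¬p (subst P (sym (ℕ.+-suc k r)) h))
  ...   | a , k<a , a<k+r , pa , ¬pa =
          a , ℕ.<⇒≤ k<a , ℕ.<-≤-trans a<k+r (ℕ.≤-reflexive (sym (ℕ.+-suc k r))) , pa , ¬pa

  <ι : ∀ p → ∃ λ N → p < ι N
  <ι p = suc ℤ.∣ ↥ p ∣ , *-cancel-<ʳ (0≤ι d) (≤-<-trans (≤-reflexive (clear p)) (≤-<-trans (≤∣∣ (↥ p))
      (subst (ι ℤ.∣ ↥ p ∣ <_) (ι-* (suc ℤ.∣ ↥ p ∣) d)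
        (ι-mono-< (ℕ.<-≤-trans (ℕ.n<1+n ℤ.∣ ↥ p ∣) (ℕ.m≤m*n (suc ℤ.∣ ↥ p ∣) d))))))
    where
    d = ↧ₙ p
    ≤∣∣ : ∀ i → i / 1 ≤ ι ℤ.∣ i ∣
    ≤∣∣ (+ n)      = ≤-refl
    ≤∣∣ (-[1+ n ]) = ≤-trans (<⇒≤ (negative-/1 n)) (0≤ι (suc n))

  module Real (x : ℝ) where

    open IsDedekind (isDedekind x) public

    Upper-up : ∀ {q r} → q < r → Upper (cut x) q → Upper (cut x) r
    Upper-up {q} {r} q<r x<q = Equivalence.from (roundedᵘ r) (q , q<r , x<q)

    Lower<Upper : ∀ {q r} → Lower (cut x) q → Upper (cut x) r → q < r
    Lower<Upper {q} {r} q<x x<r with <-cmp q r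
    ... | tri< q<r _ _    = q<r
    ... | tri≈ _ refl _   = contradiction (q<x , x<r) (disjoint q)
    ... | tri> _ _ r<q    = contradiction (q<x , Upper-up r<q x<r) (disjoint q)

  -- The shift by 2 keeps the denominator positive, and x < `grid h g` then gives 2/x > (g+2)/h,
  -- which leaves room for (g+1)/h strictly between g/h and that value.
  grid : ℕ → ℕ → ℚ
  grid h g = (2 ℕ.* h) /ι suc (suc g)

  grid-fraction : ∀ h g → grid h g * ι (suc (suc g)) ≡ ι (2 ℕ.* h)
  grid-fraction h g = /ι-* (2 ℕ.* h) (suc (suc g))

  -- The points 2h/(g+2) locate 2/x to within 2/h without inverting x.
  module Grid (x : ℝ) (h c₁ d₁ : ℕ) (c₀ : ℚ) (0<c₁ : 0 ℕ.< c₁) .{{_ : ℕ.NonZero d₁}}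
    (c₀≡ : c₀ * ι d₁ ≡ ι c₁) (c₀<x : Lower (cut x) c₀) where

    open Real x

    private
      -- At this index the grid point lies below c₀, hence below x, so the descent must have stopped
      -- earlier.
      n₀ : ℕ
      n₀ = 2 ℕ.* h ℕ.* d₁

      grid-n₀<c₀ : grid h n₀ < c₀
      grid-n₀<c₀ = cross-< (grid h n₀) c₀ (suc (suc n₀)) d₁ (2 ℕ.* h) c₁ (grid-fraction h n₀) c₀≡
        (ℕ.<-≤-trans (ℕ.m<n⇒m<1+n (ℕ.n<1+n n₀)) (ℕ.m≤n*m (suc (suc n₀)) c₁ {{ℕ.>-nonZero 0<c₁}}))

    module _ .{{_ : ℕ.NonZero h}} where

      grid-decreasing : ∀ g → grid h (suc g) < grid h g
      grid-decreasing g = cross-< (grid h (suc g)) (grid h g) (suc (suc (suc g))) (suc (suc g))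
        (2 ℕ.* h) (2 ℕ.* h) (grid-fraction h (suc g)) (grid-fraction h g)
        (ℕ.*-monoʳ-< (2 ℕ.* h) {{ℕ.m*n≢0 2 h}} (ℕ.n<1+n (suc (suc g))))

      -- Comparing x with a single point is undecidable, but locatedness at two neighbouring points
      -- either stops the descent or moves it one step down. The overlap of the two answers makes
      -- the final bracket two steps wide.
      locate : ∀ fuel g → g ℕ.+ fuel ≡ n₀ → Upper (cut x) (grid h g) →
               ∃ λ g → Upper (cut x) (grid h g) × Lower (cut x) (grid h (suc (suc g)))
      locate zero g eq x<g = contradiction (<-trans c₀<grid grid-n₀<c₀) (<-irrefl {c₀} refl)
        where
        c₀<grid : c₀ < grid h n₀
        c₀<grid = subst (λ k → c₀ < grid h k) (trans (sym (ℕ.+-identityʳ g)) eq) (Lower<Upper c₀<x x<g)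
      locate (suc fuel) g eq x<g =
        [ (λ g<x → g , x<g , g<x) , locate fuel (suc g) (trans (sym (ℕ.+-suc g fuel)) eq) ]′
        (located (grid h (suc (suc g))) (grid h (suc g)) (grid-decreasing (suc g)))

      located-on-grid : Upper (cut x) (grid h 0) →
                        ∃ λ g → Upper (cut x) (grid h g) × Lower (cut x) (grid h (suc (suc g)))
      located-on-grid = locate n₀ 0 refl

  -- (1 + 1/m)^(5m) ≥ 2^5 more than compensates for the factor 2^4.
  rescale : ∀ a b m g h .{{_ : ℕ.NonZero a}} .{{_ : ℕ.NonZero m}} → m ℕ.* 5 ℕ.≤ h →
    b ℕ.^ h ℕ.≤ a ℕ.^ h ℕ.* 2 ℕ.^ (4 ℕ.+ g) → (b ℕ.* m) ℕ.^ h ℕ.< (a ℕ.* suc m) ℕ.^ h ℕ.* 2 ℕ.^ g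
  rescale a b m g h 5m≤h b≤ = begin-strict
    (b ℕ.* m) ℕ.^ h                          ≡⟨ ^-distribʳ-* b m h ⟩
    b ℕ.^ h ℕ.* m ℕ.^ h                      ≤⟨ ℕ.*-monoˡ-≤ (m ℕ.^ h) b≤ ⟩
    aʰ ℕ.* 2 ℕ.^ (4 ℕ.+ g) ℕ.* m ℕ.^ h       ≡⟨ cong (λ z → aʰ ℕ.* z ℕ.* m ℕ.^ h) (ℕ.^-distribˡ-+-* 2 4 g) ⟩
    aʰ ℕ.* (2 ℕ.^ 4 ℕ.* 2 ℕ.^ g) ℕ.* m ℕ.^ h ≡⟨ regroup aʰ (2 ℕ.^ 4) (2 ℕ.^ g) (m ℕ.^ h) ⟩
    aʰ ℕ.* m ℕ.^ h ℕ.* 2 ℕ.^ g ℕ.* 2 ℕ.^ 4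
      <⟨ ℕ.*-monoʳ-< (aʰ ℕ.* m ℕ.^ h ℕ.* 2 ℕ.^ g) {{positive-product}} (ℕ.^-monoʳ-< 2 1<2 (ℕ.n<1+n 4)) ⟩
    aʰ ℕ.* m ℕ.^ h ℕ.* 2 ℕ.^ g ℕ.* 2 ℕ.^ 5   ≡⟨ regroup′ aʰ (2 ℕ.^ 5) (2 ℕ.^ g) (m ℕ.^ h) ⟩
    aʰ ℕ.* (2 ℕ.^ 5 ℕ.* m ℕ.^ h) ℕ.* 2 ℕ.^ g
      ≤⟨ ℕ.*-monoˡ-≤ (2 ℕ.^ g) (ℕ.*-monoʳ-≤ aʰ (growth-^ m 5 h 5m≤h)) ⟩
    aʰ ℕ.* suc m ℕ.^ h ℕ.* 2 ℕ.^ g           ≡⟨ cong (ℕ._* 2 ℕ.^ g) (^-distribʳ-* a (suc m) h) ⟨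
    (a ℕ.* suc m) ℕ.^ h ℕ.* 2 ℕ.^ g          ∎
    where
    open ℕ.≤-Reasoning
    aʰ = a ℕ.^ h
    positive-product : ℕ.NonZero (aʰ ℕ.* m ℕ.^ h ℕ.* 2 ℕ.^ g)
    positive-product = ℕ.m*n≢0 (aʰ ℕ.* m ℕ.^ h) (2 ℕ.^ g)
      {{ℕ.m*n≢0 aʰ (m ℕ.^ h) {{ℕ.m^n≢0 a h}} {{ℕ.m^n≢0 m h}}}} {{ℕ.m^n≢0 2 g}}
    regroup : ∀ p s q r → p ℕ.* (s ℕ.* q) ℕ.* r ≡ p ℕ.* r ℕ.* q ℕ.* s
    regroup = solve-∀
    regroup′ : ∀ p s q r → p ℕ.* r ℕ.* q ℕ.* s ≡ p ℕ.* (s ℕ.* r) ℕ.* q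
    regroup′ = solve-∀

  -- Traps 2^(-G/h) between a/b and (a+1)/b without roots: the test holds at 1 because 2^G < b and
  -- fails at `b`, so it changes somewhere in between.
  search : ∀ b h G .{{_ : ℕ.NonZero h}} → 2 ℕ.^ G ℕ.< b → ∃ λ a →
    1 ℕ.≤ a × a ℕ.< b × a ℕ.^ h ℕ.* 2 ℕ.^ G ℕ.< b ℕ.^ h × b ℕ.^ h ℕ.≤ suc a ℕ.^ h ℕ.* 2 ℕ.^ G
  search b@(suc b-1) h G 2ᴳ<b =
    let a , 1≤a , a<b , small , ¬small = last-true (λ a → a ℕ.^ h ℕ.* 2 ℕ.^ G ℕ.<? b ℕ.^ h) 1 b-1 small₁
          (ℕ.≤⇒≯ (ℕ.m≤m*n (b ℕ.^ h) (2 ℕ.^ G) {{ℕ.m^n≢0 2 G}}))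
    in a , 1≤a , a<b , small , ℕ.≮⇒≥ ¬small
    where
    open ℕ.≤-Reasoning
    small₁ : 1 ℕ.^ h ℕ.* 2 ℕ.^ G ℕ.< b ℕ.^ h
    small₁ = begin-strict
      1 ℕ.^ h ℕ.* 2 ℕ.^ G    ≡⟨ trans (cong (ℕ._* 2 ℕ.^ G) (ℕ.^-zeroˡ h)) (ℕ.*-identityˡ (2 ℕ.^ G)) ⟩
      2 ℕ.^ G                <⟨ 2ᴳ<b ⟩
      b                      ≡⟨ ℕ.*-identityʳ b ⟨
      b ℕ.^ 1                ≤⟨ ℕ.^-monoʳ-≤ b (ℕ.>-nonZero⁻¹ h) ⟩
      b ℕ.^ h                ∎

  -- The constants: a/b < 2^(-2/x) < u, both within ε, with 2/x between g/h and (g + 4)/h.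
  module Approximation (x : ℝ) (ε c₀ : ℚ) (d e₀ m h g b a c : ℕ)
    .{{_ : ℕ.NonZero d}} .{{_ : ℕ.NonZero m}} .{{_ : ℕ.NonZero h}} .{{_ : ℕ.NonZero b}}
    .{{_ : ℕ.NonZero a}} .{{_ : ℕ.NonZero c}}
    (0<c₀ : 0ℚ < c₀) (c₀<x : Lower (cut x) c₀)
    (ε*d≡e₀ : ε * ι d ≡ ι e₀) (4d≤e₀m : 4 ℕ.* d ℕ.≤ e₀ ℕ.* m) (5m≤h : m ℕ.* 5 ℕ.≤ h) (m≤b : m ℕ.≤ b)
    (x<2h/[g+2] : Upper (cut x) (grid h g)) (2h/G<x : Lower (cut x) (grid h (suc (suc g))))
    (a+c≡b : a ℕ.+ c ≡ b) (aʰ2ᴳ<bʰ : a ℕ.^ h ℕ.* 2 ℕ.^ (4 ℕ.+ g) ℕ.< b ℕ.^ h)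
    (bʰ≤[1+a]ʰ2ᴳ : b ℕ.^ h ℕ.≤ suc a ℕ.^ h ℕ.* 2 ℕ.^ (4 ℕ.+ g))
    where

    open Real x

    a<b : a ℕ.< b
    a<b = ℕ.<-≤-trans (ℕ.m<m+n a (ℕ.>-nonZero⁻¹ c)) (ℕ.≤-reflexive a+c≡b)

    G R : ℕ
    G = 4 ℕ.+ g
    -- Large enough that b < aR for every positive `a`, and that 1/R ≤ 1/m.
    R = suc b

    b<aR : b ℕ.< a ℕ.* R
    b<aR = ℕ.m≤n*m R a

    γ : ℚ
    γ = g /ι h

    γ*h≡g : γ * ι h ≡ ι g
    γ*h≡g = /ι-* g h

    -- Unfolded, the claim is γ x < 2. The product cut asks for an interval around γ; its upper end
    -- β = (g+1)/h still satisfies β x < 2, because x < 2h/(g+2), and β times that grid point bounds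
    -- all four corner products.
    -γ<x⁻¹ : Upper (Defs.- (fromℕ 2 Defs.÷ cut x)) (- γ)
    -γ<x⁻¹ = subst (λ q → fromℚ q Defs.* cut x Defs.< fromℕ 2) (sym (solve 1 (λ e → :- :- e := e) refl γ))
      (r , (γ - 1ℚ , β , c₀ , grid h g , x-δ<x γ (0<ι 1) , γ<β , c₀<x , x<2h/[g+2] ,
            <-trans (*-mono-<ʳ 0<c₀ γ-1<β) βc₀<r ,
            <-trans (*-mono-<ʳ 0<grid γ-1<β) βd<r , βc₀<r , βd<r) , r<2)
      where
      β : ℚ
      β = suc g /ι h
      β*h : β * ι h ≡ ι (suc g)
      β*h = /ι-* (suc g) h
      γ<β : γ < β
      γ<β = cross-< γ β h h g (suc g) γ*h≡g β*h (ℕ.*-monoˡ-< h (ℕ.n<1+n g))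
      γ-1<β : γ - 1ℚ < β
      γ-1<β = <-trans (x-δ<x γ (0<ι 1)) γ<β
      0<β : 0ℚ < β
      0<β = cross-< 0ℚ β 1 h 0 (suc g) (*-zeroˡ (ι 1)) β*h (ℕ.s≤s ℕ.z≤n)
      0<grid : 0ℚ < grid h g
      0<grid = <-trans 0<c₀ (Lower<Upper c₀<x x<2h/[g+2])
      βd<2 : β * grid h g < ι 2
      βd<2 = cross-< (β * grid h g) (ι 2) (h ℕ.* suc (suc g)) 1 (suc g ℕ.* (2 ℕ.* h)) 2 {{ℕ.m*n≢0 h (suc (suc g))}}
        (trans (cong (β * grid h g *_) (ι-* h (suc (suc g))))
          (trans (solve 4 (λ b c h g → b :* c :* (h :* g) := b :* h :* (c :* g)) refl β (grid h g) (ι h) (ι (suc (suc g))))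
            (trans (cong₂ _*_ β*h (grid-fraction h g)) (sym (ι-* (suc g) (2 ℕ.* h))))))
        (*-identityʳ (ι 2))
        (ℕ.<-≤-trans (ℕ.≤-<-trans (ℕ.≤-reflexive (lhs g h)) (ℕ.*-monoʳ-< (2 ℕ.* h) {{ℕ.m*n≢0 2 h}} (ℕ.n<1+n (suc g))))
          (ℕ.≤-reflexive (rhs g h)))
        where
        lhs : ∀ g h → suc g ℕ.* (2 ℕ.* h) ℕ.* 1 ≡ 2 ℕ.* h ℕ.* suc g
        lhs = solve-∀
        rhs : ∀ g h → 2 ℕ.* h ℕ.* suc (suc g) ≡ 2 ℕ.* (h ℕ.* suc (suc g))
        rhs = solve-∀
      r = proj₁ (<-dense βd<2)
      βd<r : β * grid h g < r
      βd<r = proj₁ (proj₂ (<-dense βd<2))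
      r<2 : r < ι 2
      r<2 = proj₂ (proj₂ (<-dense βd<2))
      βc₀<r : β * c₀ < r
      βc₀<r = <-trans (subst₂ _<_ (*-comm c₀ β) (*-comm (grid h g) β) (*-mono-<ʳ 0<β (Lower<Upper c₀<x x<2h/[g+2]))) βd<r

    -- The fraction U/V is (a+1)/b, which is at least 2^(-G/h), times 1 + 1/m, which makes up for
    -- passing from `G` down to `g`.
    U V : ℕ
    U = suc a ℕ.* suc m
    V = b ℕ.* m

    instance
      U≢0 : ℕ.NonZero U
      U≢0 = ℕ.m*n≢0 (suc a) (suc m)
      V≢0 : ℕ.NonZero V
      V≢0 = ℕ.m*n≢0 b m

    u : ℚ
    u = U /ι V

    u*V≡U : u * ι V ≡ ι U
    u*V≡U = /ι-* U V

    Vʰ<Uʰ2ᵍ : V ℕ.^ h ℕ.< U ℕ.^ h ℕ.* 2 ℕ.^ g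
    Vʰ<Uʰ2ᵍ = rescale (suc a) b m g h 5m≤h bʰ≤[1+a]ʰ2ᴳ

    2^<u : Upper (2^ (Defs.- (fromℕ 2 Defs.÷ cut x))) u
    2^<u = - γ , -γ<x⁻¹ , 2^-fraction≺ (- γ) u g h U V
      (trans (sym (neg-distribˡ-* γ (ι h))) (cong -_ γ*h≡g)) u*V≡U Vʰ<Uʰ2ᵍ

    α ρ κ : ℚ
    α = a /ι b
    ρ = 1 /ι R
    κ = 1 /ι m

    α*b≡a : α * ι b ≡ ι a
    α*b≡a = /ι-* a b

    ρ*R≡1 : ρ * ι R ≡ 1ℚ
    ρ*R≡1 = /ι-* 1 R

    κ*m≡1 : κ * ι m ≡ 1ℚ
    κ*m≡1 = /ι-* 1 m

    -- The difference of `u` and `α` is (a + 1 + m)/(bm), and both a + 1 and m are at most b.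
    u≤α+2κ : u ≤ α + (κ + κ)
    u≤α+2κ = cross-≤ u (α + (κ + κ)) V V U (a ℕ.* m ℕ.+ (b ℕ.+ b)) u*V≡U rhs (ℕ.*-monoˡ-≤ V U≤)
      where
      open ℕ.≤-Reasoning
      U≤ : U ℕ.≤ a ℕ.* m ℕ.+ (b ℕ.+ b)
      U≤ = begin
        U                              ≡⟨ expand a m ⟩
        a ℕ.* m ℕ.+ (suc a ℕ.+ m)      ≤⟨ ℕ.+-monoʳ-≤ (a ℕ.* m) (ℕ.+-mono-≤ a<b m≤b) ⟩
        a ℕ.* m ℕ.+ (b ℕ.+ b)          ∎
        where
        expand : ∀ a m → suc a ℕ.* suc m ≡ a ℕ.* m ℕ.+ (suc a ℕ.+ m)
        expand = solve-∀
      rhs : (α + (κ + κ)) * ι V ≡ ι (a ℕ.* m ℕ.+ (b ℕ.+ b))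
      rhs = ≡.begin
        (α + (κ + κ)) * ι V                                    ≡.≡⟨ cong ((α + (κ + κ)) *_) (ι-* b m) ⟩
        (α + (κ + κ)) * (ι b * ι m)
          ≡.≡⟨ solve 4 (λ a k b m → (a :+ (k :+ k)) :* (b :* m) := a :* b :* m :+ (k :* m :* b :+ k :* m :* b))
                 refl α κ (ι b) (ι m) ⟩
        α * ι b * ι m + (κ * ι m * ι b + κ * ι m * ι b)
          ≡.≡⟨ cong₂ (λ v w → v * ι m + (w * ι b + w * ι b)) α*b≡a κ*m≡1 ⟩
        ι a * ι m + (1ℚ * ι b + 1ℚ * ι b)
          ≡.≡⟨ cong₂ _+_ (sym (ι-* a m)) (trans (cong (λ v → v + v) (*-identityˡ (ι b))) (sym (ι-+ b b))) ⟩
        ι (a ℕ.* m) + ι (b ℕ.+ b)                              ≡.≡⟨ ι-+ (a ℕ.* m) (b ℕ.+ b) ⟨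
        ι (a ℕ.* m ℕ.+ (b ℕ.+ b))                              ≡.∎
        where module ≡ = ≡-Reasoning

    ρ≤κ : ρ ≤ κ
    ρ≤κ = cross-≤ ρ κ R m 1 1 ρ*R≡1 κ*m≡1 (ℕ.*-monoʳ-≤ 1 (ℕ.≤-trans m≤b (ℕ.n≤1+n b)))

    0<κ : 0ℚ < κ
    0<κ = cross-< 0ℚ κ 1 m 0 1 (*-zeroˡ (ι 1)) κ*m≡1 (ℕ.s≤s ℕ.z≤n)

    4κ≤ε : κ * ι 4 ≤ ε
    4κ≤ε = cross-≤ (κ * ι 4) ε m d 4 e₀
      (trans (solve 3 (λ k f m → k :* f :* m := k :* m :* f) refl κ (ι 4) (ι m))
        (trans (cong (_* ι 4) κ*m≡1) (*-identityˡ (ι 4))))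
      ε*d≡e₀ 4d≤e₀m

    bound : ℚ
    bound = 1ℚ + ρ - α

    -- Passing from `α` to `u` costs 2κ, the loss ρ costs at most κ, and one more κ makes the
    -- inequality strict; the size of `m` comes from 4κ ≤ ε.
    bound<1-u+ε : bound < (1ℚ - u) + ε
    bound<1-u+ε = begin-strict
      1ℚ + ρ - α                                <⟨ x<x+δ (1ℚ + ρ - α) 0<κ ⟩
      1ℚ + ρ - α + κ
        ≤⟨ +-monoˡ-≤ κ (+-monoˡ-≤ (- α) (+-monoʳ-≤ 1ℚ ρ≤κ)) ⟩
      1ℚ + κ - α + κ
        ≡⟨ solve 2 (λ a k → con 1ℚ :+ k :+ :- a :+ k := (con 1ℚ :+ :- (a :+ (k :+ k))) :+ k :* con (ι 4)) refl α κ ⟩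
      (1ℚ - (α + (κ + κ))) + κ * ι 4
        ≤⟨ +-mono-≤ (+-monoʳ-≤ 1ℚ (neg-antimono-≤ u≤α+2κ)) 4κ≤ε ⟩
      (1ℚ - u) + ε                              ∎
      where open ≤-Reasoning

    private
      dense-q = <-dense bound<1-u+ε

    q : ℚ
    q = proj₁ dense-q

    bound<q : bound < q
    bound<q = proj₁ (proj₂ dense-q)

    q<1-2^+ε : Lower ((fromℕ 1 Defs.- (2^ (Defs.- (fromℕ 2 Defs.÷ cut x)))) Defs.+ fromℚ ε) q
    q<1-2^+ε = r , s , (r + u , - u ,
        subst (r + u <_) (solve 1 (λ u → (con 1ℚ :+ :- u) :+ u := con 1ℚ) refl u) (+-monoˡ-< u r<1-u) ,
        subst (Upper (2^ (Defs.- (fromℕ 2 Defs.÷ cut x)))) (solve 1 (λ u → u := :- :- u) refl u) 2^<u ,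
        solve 2 (λ r u → r := (r :+ u) :+ :- u) refl r u) ,
      proj₁ (proj₂ (proj₂ (proj₂ split))) , proj₂ (proj₂ (proj₂ (proj₂ split)))
      where
      split = +-Lower (1ℚ - u) ε q (proj₂ (proj₂ dense-q))
      r = proj₁ split
      s = proj₁ (proj₂ split)
      r<1-u : r < 1ℚ - u
      r<1-u = proj₁ (proj₂ (proj₂ split))

    -- From (2h/G) log n < x log n < T + 1. On cuts, log n is replaced by the upper endpoint `hi` of
    -- the product interval, whose sign is treated by cases.
    rounding⇒ : ∀ T n → 0 ℕ.< n → T RoundingOf (cut x Defs.* log n) → n ℕ.^ (2 ℕ.* h) ℕ.< 2 ℕ.^ (suc T ℕ.* G)
    rounding⇒ T n 0<n (_ , w , (a′ , b′ , lo , hi , _ , x<b′ , _ , log<hi , _ , _ , _ , b′hi<w) , r , s , r<T , s<1 , w≡r+s) =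
      ≺2^⇒< hi n (2 ℕ.* h) (suc T ℕ.* G) {{ℕ.>-nonZero 0<n}} log<hi hi2h<
      where
      b′hi<1+T : b′ * hi < ι (suc T)
      b′hi<1+T = <-trans b′hi<w (subst₂ _<_ (sym w≡r+s)
        (trans (+-comm (ι T) 1ℚ) (sym (ι-+ 1 T))) (+-mono-< r<T s<1))
      grid*hi< : 0ℚ < hi → hi * ι (2 ℕ.* h) < ι (suc T ℕ.* G)
      grid*hi< 0<hi = subst₂ _<_ lhs (sym (ι-* (suc T) G))
        (*-mono-<ʳ (0<ι G) (<-trans (*-mono-<ʳ 0<hi (Lower<Upper 2h/G<x x<b′)) b′hi<1+T))
        where
        lhs : grid h (suc (suc g)) * hi * ι G ≡ hi * ι (2 ℕ.* h)
        lhs = trans (solve 3 (λ p h g → p :* h :* g := h :* (p :* g)) refl (grid h (suc (suc g))) hi (ι G))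
          (cong (hi *_) (grid-fraction h (suc (suc g))))
      hi2h< : hi * ι (2 ℕ.* h) < ι (suc T ℕ.* G)
      hi2h< with <-cmp 0ℚ hi
      ... | tri< 0<hi _ _ = grid*hi< 0<hi
      ... | tri≈ _ refl _ = subst (_< ι (suc T ℕ.* G)) (sym (*-zeroˡ (ι (2 ℕ.* h)))) (0<ι (suc T ℕ.* G))
      ... | tri> _ _ hi<0 = <-trans (subst (hi * ι (2 ℕ.* h) <_) (*-zeroˡ (ι (2 ℕ.* h)))
                              (*-mono-<ʳ (0<ι (2 ℕ.* h) {{ℕ.m*n≢0 2 h}}) hi<0)) (0<ι (suc T ℕ.* G))

    open UpperBound a c G h R
      (subst (λ b → a ℕ.^ h ℕ.* 2 ℕ.^ G ℕ.< b ℕ.^ h) (sym a+c≡b) aʰ2ᴳ<bʰ)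
      (subst (ℕ._< a ℕ.* R) (sym a+c≡b) b<aR) public using (threshold; upper-bound)

    exponent< : ∀ C y → 0 ℕ.< C →
      C ℕ.* (a ℕ.* R) ℕ.+ R ℕ.* (a ℕ.+ c) ℕ.* y ℕ.≤ R ℕ.* (a ℕ.+ c) ℕ.* C ℕ.+ C ℕ.* (a ℕ.+ c) → ι y < q * ι C
    exponent< C y 0<C le = ≤-<-trans y≤ (*-mono-<ʳ (0<ι C {{ℕ.>-nonZero 0<C}}) bound<q)
      where
      open ≤-Reasoning
      Rb = ι R * ι b
      0<Rb : 0ℚ < Rb
      0<Rb = 0<* (0<ι R) (0<ι b)
      le′ : C ℕ.* (a ℕ.* R) ℕ.+ R ℕ.* b ℕ.* y ℕ.≤ R ℕ.* b ℕ.* C ℕ.+ C ℕ.* b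
      le′ = subst (λ b → C ℕ.* (a ℕ.* R) ℕ.+ R ℕ.* b ℕ.* y ℕ.≤ R ℕ.* b ℕ.* C ℕ.+ C ℕ.* b) a+c≡b le
      lhs : ι (C ℕ.* (a ℕ.* R) ℕ.+ R ℕ.* b ℕ.* y) ≡ ι C * (ι a * ι R) + Rb * ι y
      lhs = trans (ι-+ (C ℕ.* (a ℕ.* R)) (R ℕ.* b ℕ.* y)) (cong₂ _+_
        (trans (ι-* C (a ℕ.* R)) (cong (ι C *_) (ι-* a R)))
        (trans (ι-* (R ℕ.* b) y) (cong (_* ι y) (ι-* R b))))
      rhs : ι (R ℕ.* b ℕ.* C ℕ.+ C ℕ.* b) ≡ Rb * ι C + ι C * ι b
      rhs = trans (ι-+ (R ℕ.* b ℕ.* C) (C ℕ.* b)) (cong₂ _+_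
        (trans (ι-* (R ℕ.* b) C) (cong (_* ι C) (ι-* R b))) (ι-* C b))
      y≤ : ι y ≤ bound * ι C
      y≤ = *-cancel-≤ʳ 0<Rb (begin
        ι y * Rb
          ≡⟨ solve 5 (λ y r b c a → y :* (r :* b) := (c :* (a :* r) :+ r :* b :* y) :+ :- (c :* (a :* r)))
               refl (ι y) (ι R) (ι b) (ι C) (ι a) ⟩
        (ι C * (ι a * ι R) + Rb * ι y) - ι C * (ι a * ι R)
          ≤⟨ +-monoˡ-≤ (- (ι C * (ι a * ι R))) (subst₂ _≤_ lhs rhs (ι-mono-≤ le′)) ⟩
        (Rb * ι C + ι C * ι b) - ι C * (ι a * ι R)
          ≡⟨ cong (λ v → (Rb * ι C + ι C * v) - ι C * (ι a * ι R)) (*-identityˡ (ι b)) ⟨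
        (Rb * ι C + ι C * (1ℚ * ι b)) - ι C * (ι a * ι R)
          ≡⟨ cong₂ (λ v w → (Rb * ι C + ι C * (v * ι b)) - ι C * (w * ι R)) ρ*R≡1 α*b≡a ⟨
        (Rb * ι C + ι C * (ρ * ι R * ι b)) - ι C * (α * ι b * ι R)
          ≡⟨ solve 5 (λ r b c p a → (r :* b :* c :+ c :* (p :* r :* b)) :+ :- (c :* (a :* b :* r))
                         := (con 1ℚ :+ p :+ :- a) :* c :* (r :* b)) refl (ι R) (ι b) (ι C) ρ α ⟩
        bound * ι C * Rb ∎)

    conclusion : (t : ℕ → ℕ) → Eventually (λ n → t n RoundingOf (cut x Defs.* log n)) →
      Eventually λ n → rate (K (t n) (t n)) n Defs.<
        (fromℕ 1 Defs.- (2^ (Defs.- (fromℕ 2 Defs.÷ cut x)))) Defs.+ fromℚ ε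
    conclusion t (N₀ , rounding) = N₀ ℕ.⊔ (threshold ℕ.⊔ 2) , λ n N≤n →
      let N₀≤n = ℕ.≤-trans (ℕ.m≤m⊔n N₀ _) N≤n
          large = ℕ.≤-trans (ℕ.m≤m⊔n threshold 2) (ℕ.≤-trans (ℕ.m≤n⊔m N₀ _) N≤n)
          2≤n = ℕ.≤-trans (ℕ.m≤n⊔m threshold 2) (ℕ.≤-trans (ℕ.m≤n⊔m N₀ _) N≤n)
          y , M≤2^y , le = upper-bound n (t n) large
            (rounding⇒ (t n) n (ℕ.≤-trans (ℕ.s≤s ℕ.z≤n) 2≤n) (rounding n N₀≤n))
      in q , rate-Upper (K (t n) (t n)) n y q M≤2^y (exponent< (slots n) y (0<slots n 2≤n) le) , q<1-2^+ε

  critical-t : (t : ℕ → ℕ) (x : ℝ) → fromℕ 0 Defs.< cut x →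
    Eventually (λ n → t n RoundingOf (cut x Defs.* log n)) →
    Defs.LimSup (λ n → rate (K (t n) (t n)) n) ≤ (fromℕ 1 Defs.- (2^ (Defs.- (fromℕ 2 Defs.÷ cut x))))
  critical-t t x (c₀ , 0<c₀ , c₀<x) rounding ε 0<ε = from-numerators (numerator ε 0<ε) (numerator c₀ 0<c₀) (<ι (proj₁ inhabitedᵘ))
    where
    open Real x
    Goal : Set
    Goal = Eventually λ n → rate (K (t n) (t n)) n Defs.<
      (fromℕ 1 Defs.- (2^ (Defs.- (fromℕ 2 Defs.÷ cut x)))) Defs.+ fromℚ ε
    d = ↧ₙ ε

    from-search : ∀ e₀ m h g b .{{_ : ℕ.NonZero m}} .{{_ : ℕ.NonZero h}} → ε * ι d ≡ ι e₀ →
      4 ℕ.* d ℕ.≤ e₀ ℕ.* m → m ℕ.* 5 ℕ.≤ h → m ℕ.≤ b →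
      Upper (cut x) (grid h g) × Lower (cut x) (grid h (suc (suc g))) →
      (∃ λ a → 1 ℕ.≤ a × a ℕ.< b × a ℕ.^ h ℕ.* 2 ℕ.^ (4 ℕ.+ g) ℕ.< b ℕ.^ h ×
               b ℕ.^ h ℕ.≤ suc a ℕ.^ h ℕ.* 2 ℕ.^ (4 ℕ.+ g)) → Goal
    from-search e₀ m h g b ε*d≡e₀ 4d≤e₀m 5m≤h m≤b (x<g , g<x) (a , 1≤a , a<b , small , large) =
      Approximation.conclusion x ε c₀ d e₀ m h g b a (b ℕ.∸ a)
        0<c₀ c₀<x ε*d≡e₀ 4d≤e₀m 5m≤h m≤b x<g g<x (ℕ.m+[n∸m]≡n (ℕ.<⇒≤ a<b)) small large t rounding
      where
      instance
        b≢0 : ℕ.NonZero b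
        b≢0 = ℕ.>-nonZero (ℕ.≤-trans 1≤a (ℕ.<⇒≤ a<b))
        a≢0 : ℕ.NonZero a
        a≢0 = ℕ.>-nonZero 1≤a
        c≢0 : ℕ.NonZero (b ℕ.∸ a)
        c≢0 = ℕ.>-nonZero (ℕ.m<n⇒0<n∸m a<b)

    from-grid : ∀ e₀ m h .{{_ : ℕ.NonZero m}} .{{_ : ℕ.NonZero h}} → ε * ι d ≡ ι e₀ →
      4 ℕ.* d ℕ.≤ e₀ ℕ.* m → m ℕ.* 5 ℕ.≤ h → 1 ℕ.< m →
      (∃ λ g → Upper (cut x) (grid h g) × Lower (cut x) (grid h (suc (suc g)))) → Goal
    from-grid e₀ m h ε*d≡e₀ 4d≤e₀m 5m≤h 1<m (g , bracket) =
      -- This value of `b` exceeds 2^G because m > 1, so the search can start at 1, and it is at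
      -- least m, so steps of 1/b are as fine as 1/m.
      from-search e₀ m h g (m ℕ.* 2 ℕ.^ (4 ℕ.+ g)) ε*d≡e₀ 4d≤e₀m 5m≤h
        (ℕ.m≤m*n m (2 ℕ.^ (4 ℕ.+ g)) {{ℕ.m^n≢0 2 (4 ℕ.+ g)}}) bracket
        (search (m ℕ.* 2 ℕ.^ (4 ℕ.+ g)) h (4 ℕ.+ g)
          (ℕ.<-≤-trans (ℕ.≤-<-trans (ℕ.≤-reflexive (sym (ℕ.*-identityˡ _)))
            (ℕ.*-monoˡ-< (2 ℕ.^ (4 ℕ.+ g)) {{ℕ.m^n≢0 2 (4 ℕ.+ g)}} 1<m)) ℕ.≤-refl))

    from-numerators : (∃ λ e₀ → 0 ℕ.< e₀ × ε * ι d ≡ ι e₀) →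
      (∃ λ c₁ → 0 ℕ.< c₁ × c₀ * ι (↧ₙ c₀) ≡ ι c₁) → (∃ λ N → proj₁ inhabitedᵘ < ι N) → Goal
    from-numerators (e₀ , 0<e₀ , ε*d≡e₀) (c₁ , 0<c₁ , c₀≡c₁) (N , c∞<N) =
      from-grid e₀ m h ε*d≡e₀
        (ℕ.≤-trans (ℕ.m≤m*n (4 ℕ.* d) (suc N)) (ℕ.m≤n*m m e₀ {{ℕ.>-nonZero 0<e₀}}))
        ℕ.≤-refl
        (ℕ.≤-trans (ℕ.s≤s (ℕ.s≤s ℕ.z≤n)) (ℕ.≤-trans (ℕ.m≤m*n 4 d) (ℕ.m≤m*n (4 ℕ.* d) (suc N))))
        (Grid.located-on-grid x h c₁ (↧ₙ c₀) c₀ 0<c₁ c₀≡c₁ c₀<x x<grid0)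
      where
      m h : ℕ
      -- The factor 4d yields 4/m ≤ ε. Since N exceeds an upper bound of x, the factor `suc N` puts
      -- x below `grid h 0` = h, where the descent starts.
      m = 4 ℕ.* d ℕ.* suc N
      h = m ℕ.* 5
      instance
        4d≢0 : ℕ.NonZero (4 ℕ.* d)
        4d≢0 = ℕ.m*n≢0 4 d
        m≢0 : ℕ.NonZero m
        m≢0 = ℕ.m*n≢0 (4 ℕ.* d) (suc N)
        h≢0 : ℕ.NonZero h
        h≢0 = ℕ.m*n≢0 m 5
      x<grid0 : Upper (cut x) (grid h 0)
      x<grid0 = Upper-up (<-≤-trans c∞<N (≤-trans (ι-mono-≤ N≤h) h≤grid0)) (proj₂ inhabitedᵘ)
        where
        N≤h : N ℕ.≤ h
        N≤h = ℕ.≤-trans (ℕ.n≤1+n N) (ℕ.≤-trans (ℕ.m≤n*m (suc N) (4 ℕ.* d)) (ℕ.m≤m*n m 5))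
        h≤grid0 : ι h ≤ grid h 0
        h≤grid0 = cross-≤ (ι h) (grid h 0) 1 2 h (2 ℕ.* h) (*-identityʳ (ι h)) (grid-fraction h 0)
          (ℕ.≤-reflexive (trans (ℕ.*-comm h 2) (sym (ℕ.*-identityʳ (2 ℕ.* h)))))

open import Data.Nat.Base using (ℕ)
open import Data.Product.Base using (_×_; _,_)
open import Defs

theorem1p5 : (t : ℕ → ℕ) →
    ((λ n → fromℕ (t n)) =o log → Lim (λ n → rate (K (t n) (t n)) n) equals fromℕ 1)
    ×
    ((c : ℝ) → fromℕ 0 < cut c →
    Eventually (λ n → t n RoundingOf (cut c * log n)) →
    LimSup (λ n → rate (K (t n) (t n)) n) ≤ (fromℕ 1 - 2^ (- (fromℕ 2 ÷ cut c))))
theorem1p5 t = SmallParts.small-t t , CriticalParts.critical-t t
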